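{- There exist sets $D, E \subseteq \omega$ which are $\Delta^0_2$, and in fact co-2-c.e., such that $D <_s E$ and there is no set $Z \subseteq \omega$ with $D <_s Z <_s E$.
   Context: For finite sets we use canonical indices: $D_u$ is the finite set with canonical index $u$. An $e$-operator is a c.e. set $\Phi$ of pairs $\langle x, u\rangle$, and for $B \subseteq \omega$ we set $\Phi(B) = \{x : (\exists u)[\langle x,u\rangle \in \Phi \ \&\ D_u \subseteq B]\}$. An $s$-operator is an $e$-operator $\Phi$ such that whenever $\langle x, u\rangle \in \Phi$, the set $D_u$ is empty or a singleton. For $A, B \subseteq \omega$, $A \le_s B$ ($A$ is singleton-reducible to $B$) means $A = \Phi(B)$ for some $s$-operator $\Phi$; $A <_s B$ means $A \le_s B$ and not $B \le_s A$. A set is 2-c.e. if it is the difference $W_1 \setminus W_2$ of two c.e. sets, and co-2-c.e. if its complement is 2-c.e. -}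

module Defs where

open import Data.Fin.Base using (Fin)
open import Data.Nat.Base using (ℕ; zero; suc; _<_; _^_; _/_; _%_)
open import Data.Nat.Properties using (m^n≢0)
open import Data.Product.Base using (_×_; _,_; ∃; ∃₂; ∃-syntax)
open import Data.Sum.Base using (_⊎_)
open import Data.Vec.Base using (Vec; []; _∷_; lookup)
open import Data.Vec.Relation.Binary.Pointwise.Inductive using (Pointwise)
open import Function.Bundles using (_⇔_)
open import Level using (0ℓ)
open import Relation.Binary.PropositionalEquality.Core using (_≡_)
open import Relation.Nullary.Negation.Core using (¬_)
open import Relation.Unary
  using (Pred; _∈_; _∉_; _⊆_; _≐_; _∖_; ∁; Empty; ｛_｝)

-- Subsets of ω.  No decidability is built in; under ExcludedMiddle 0ℓ these
-- behave as the full classical power set.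
Subset : Set₁
Subset = Pred ℕ 0ℓ

------------------------------------------------------------------------
-- Partial recursive functions ℕⁿ ⇀ ℕ

data PR : ℕ → Set where
  zer  : ∀ {n} → PR n
  succ : PR 1
  proj : ∀ {n} → Fin n → PR n
  comp : ∀ {m n} → PR m → Vec (PR n) m → PR n
  prec : ∀ {n} → PR n → PR (suc (suc n)) → PR (suc n)
  mu   : ∀ {n} → PR (suc n) → PR n

-- f [ v ]⇓ y : the computation of f on input v converges with value y.
-- The recursion argument of prec and the search argument of mu come
-- first; the step function of prec receives the counter and then the
-- previous value.
infix 4 _[_]⇓_

data _[_]⇓_ : ∀ {n} → PR n → Vec ℕ n → ℕ → Set where
  ⇓zer   : ∀ {n} {v : Vec ℕ n} → zer [ v ]⇓ 0
  ⇓succ  : ∀ {x} → succ [ x ∷ [] ]⇓ suc x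
  ⇓proj  : ∀ {n} {v : Vec ℕ n} (i : Fin n) → proj i [ v ]⇓ lookup v i
  ⇓comp  : ∀ {m n} {f : PR m} {gs : Vec (PR n) m} {v ys y} →
           Pointwise (λ g z → g [ v ]⇓ z) gs ys →
           f [ ys ]⇓ y →
           comp f gs [ v ]⇓ y
  ⇓prec₀ : ∀ {n} {f : PR n} {g : PR (suc (suc n))} {v y} →
           f [ v ]⇓ y →
           prec f g [ 0 ∷ v ]⇓ y
  ⇓precₛ : ∀ {n} {f : PR n} {g : PR (suc (suc n))} {k v r y} →
           prec f g [ k ∷ v ]⇓ r →
           g [ k ∷ r ∷ v ]⇓ y →
           prec f g [ suc k ∷ v ]⇓ y
  ⇓mu    : ∀ {n} {f : PR (suc n)} {v y} →
           (∀ i → i < y → ∃[ k ] f [ i ∷ v ]⇓ suc k) →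
           f [ y ∷ v ]⇓ 0 →
           mu f [ v ]⇓ y

infix 4 _↓_

_↓_ : ∀ {n} → PR n → Vec ℕ n → Set
f ↓ v = ∃[ y ] f [ v ]⇓ y

------------------------------------------------------------------------
-- Computable relations, c.e. sets, and the classes built from them

-- The characteristic function of R is (total) recursive.
Computable : ∀ {n} → Pred (Vec ℕ n) 0ℓ → Set
Computable R = ∃[ f ] ∀ v → (v ∈ R × f [ v ]⇓ 1) ⊎ (v ∉ R × f [ v ]⇓ 0)

CE : Subset → Set
CE W = ∃[ f ] ∀ x → x ∈ W ⇔ f ↓ (x ∷ [])

-- C.e. sets of pairs, as domains of binary partial recursive functions;
-- no numerical coding of pairs is involved.
CE₂ : Pred (ℕ × ℕ) 0ℓ → Set
CE₂ Φ = ∃[ f ] ∀ x u → (x , u) ∈ Φ ⇔ f ↓ (x ∷ u ∷ [])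

2-CE : Subset → Set₁
2-CE A = ∃₂ λ (W₁ W₂ : Subset) → CE W₁ × CE W₂ × A ≐ W₁ ∖ W₂

Co-2-CE : Subset → Set₁
Co-2-CE A = 2-CE (∁ A)

Σ⁰₂ : Subset → Set₁
Σ⁰₂ A = ∃ λ (R : Pred (Vec ℕ 3) 0ℓ) → Computable R ×
  (∀ x → x ∈ A ⇔ (∃[ y ] ∀ z → (x ∷ y ∷ z ∷ []) ∈ R))

Π⁰₂ : Subset → Set₁
Π⁰₂ A = ∃ λ (R : Pred (Vec ℕ 3) 0ℓ) → Computable R ×
  (∀ x → x ∈ A ⇔ (∀ y → ∃[ z ] (x ∷ y ∷ z ∷ []) ∈ R))

Δ⁰₂ : Subset → Set₁
Δ⁰₂ A = Σ⁰₂ A × Π⁰₂ A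

------------------------------------------------------------------------
-- Enumeration operators and singleton reducibility

-- The finite set with canonical index u, where u = Σ { 2 ^ x ∣ x ∈ D⟨ u ⟩ }:
-- x is a member iff the x-th binary digit of u is 1.
D⟨_⟩ : ℕ → Subset
D⟨ u ⟩ x = ((u / 2 ^ x) {{m^n≢0 2 x}}) % 2 ≡ 1

IsEOperator : Pred (ℕ × ℕ) 0ℓ → Set
IsEOperator Φ = CE₂ Φ

IsSOperator : Pred (ℕ × ℕ) 0ℓ → Set
IsSOperator Φ = IsEOperator Φ ×
  (∀ x u → (x , u) ∈ Φ → Empty D⟨ u ⟩ ⊎ (∃[ y ] D⟨ u ⟩ ≐ ｛ y ｝))

_⟦_⟧ : Pred (ℕ × ℕ) 0ℓ → Subset → Subset
(Φ ⟦ B ⟧) x = ∃[ u ] ((x , u) ∈ Φ × D⟨ u ⟩ ⊆ B)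

infix 4 _≤ₛ_ _<ₛ_

_≤ₛ_ : Subset → Subset → Set₁
A ≤ₛ B = ∃ λ (Φ : Pred (ℕ × ℕ) 0ℓ) → IsSOperator Φ × A ≐ Φ ⟦ B ⟧

_<ₛ_ : Subset → Subset → Set₁
A <ₛ B = A ≤ₛ B × ¬ (B ≤ₛ A)

{-# OPTIONS --safe #-}
-- The elements of E are codes: ⟨ a , 0 ⟩ says a ∈ A for a set A built in stages, and
-- ⟨ a , 1 + ⟨ j , ⟨ x , n ⟩ ⟩ ⟩ is a copy of ⟨ a , 0 ⟩ reserved for an axiom ⟨ x , {⟨ a , 0 ⟩} ⟩ that the j-th
-- s-operator Φ j has by stage n.  D consists of the codes of the second kind, so D ≤ₛ E.
--
-- Level i of a tree of outcomes ensures E ≠ Ψ (D) for the i-th operator Ψ.  It moves an element a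
-- out of A (outcome 0) as soon as Ψ enumerates ⟨ a , 0 ⟩ from a condition on D that survives this.  The
-- only other conditions in D are copies ⟨ a , 1 + ⟨ j , ⟨ x , n ⟩ ⟩ ⟩ of a itself.  If these occur with some
-- j < i for infinitely many a, then level i has outcome 1 + j for the least such j and x becomes the
-- label of a; otherwise it has outcome 1 + i.  Under outcome 1 + o the copies for Φ j with j ≥ o leave D,
-- and since no smaller j occurs, ⟨ a , 0 ⟩ ∉ Ψ (D).
--
-- Let Z = Φ j (E) with D ≤ₛ Z.  If some level i > j has outcome 1 + j on the true path, then a ∈ A iff
-- the label of a is in Z: were a ∉ A and its label x in Z, the copy of a in the axiom of Ψ could be put
-- back into D, so that ⟨ a , 0 ⟩ ∈ Ψ (D) ∖ E and level i would have had outcome 0.  Hence E ≤ₛ Z.  If there is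
-- no such level, almost every a keeps its copies for Φ j, and they replace ⟨ a , 0 ⟩ in the axioms of Φ j, so
-- Z ≤ₛ D.  An element leaves E at most once and returns at most once, so D and E are co-2-c.e.
module Submission where

open import Defs
open import Axiom.ExcludedMiddle using (ExcludedMiddle)
open import Data.Empty using (⊥; ⊥-elim)
open import Data.Fin.Base using (Fin; zero; suc; toℕ; fromℕ<)
open import Data.Fin.Properties using (toℕ<n; toℕ-fromℕ<)
open import Data.Nat.Base
open import Data.Nat.DivMod using (n/1≡n; m/n/o≡m/[n*o]; m*n/n≡m; m*n%n≡0; m%n<n; m≡m%n+[m/n]*n; m/n<m)
open import Data.Nat.Induction using (<-rec)
open import Data.Nat.Properties
open import Data.Product.Base using (_×_; _,_; ∃; ∃₂; ∃-syntax; proj₁; proj₂)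
open import Data.Sum.Base using (_⊎_; inj₁; inj₂; [_,_]′)
open import Data.Vec.Base as Vec using (Vec; []; _∷_; lookup; tabulate)
open import Data.Vec.Relation.Binary.Pointwise.Inductive using (Pointwise; []; _∷_)
open import Function.Bundles using (_⇔_; mk⇔; Equivalence)
open import Level using (0ℓ)
open import Relation.Binary.Definitions using (tri<; tri≈; tri>)
open import Relation.Binary.PropositionalEquality hiding (J)
open import Relation.Nullary using (Dec; yes; no; ¬_)
open import Relation.Nullary.Decidable using (_×-dec_; _⊎-dec_; _→-dec_; ¬?)
open import Relation.Unary using (Pred; _⊆_; _≐_; Empty; ｛_｝)

-- Primitive recursive functions and bounded formulas

-- Whether labels occur for infinitely many elements is never tested. Each element moves on its own
-- to a preceding address when its label appears, every action cancels the entries at addresses that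
-- do not precede its own, and the true path takes the least recurring outcome. Elements left
-- without an entry return to A for good. This event is c.e., so the reductions treat these elements
-- with empty conditions.
--
-- The obstacle to keeping copies is an entry off the true path, whose guess about the copies that
-- must leave may be wrong. Therefore a copy carries a stage n, and an entry made at stage u below
-- the address of a removes only copies of a with n < u. An address off the true path is eventually
-- not extended any more and costs only copies with small n; on the true path extensions recur, and
-- all copies concerned leave.
--
-- On one path, a label outcome for Φ j is allowed at most once among the levels i > j, and the
-- copies for Φ j leave at all later levels. If it could recur, it would remove the copies for
-- larger indices at infinitely many levels.

record Fn (n : ℕ) : Set where
  constructor mkFn
  field
    fun  : Vec ℕ n → ℕ
    prog : PR n
    ok   : ∀ v → prog [ v ]⇓ fun v
open Fn

precFun : ∀ {n} → (Vec ℕ n → ℕ) → (Vec ℕ (suc (suc n)) → ℕ) → Vec ℕ (suc n) → ℕ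
precFun f g (zero  ∷ v) = f v
precFun f g (suc k ∷ v) = g (k ∷ precFun f g (k ∷ v) ∷ v)

precF : ∀ {n} → Fn n → Fn (suc (suc n)) → Fn (suc n)
fun  (precF f g) = precFun (fun f) (fun g)
prog (precF f g) = prec (prog f) (prog g)
ok   (precF f g) (zero  ∷ v) = ⇓prec₀ (ok f v)
ok   (precF f g) (suc k ∷ v) = ⇓precₛ (ok (precF f g) (k ∷ v)) (ok g _)

data Tm (n : ℕ) : Set where
  var : Fin n → Tm n
  lit : ℕ → Tm n
  app : ∀ {m} → Fn m → Vec (Tm n) m → Tm n

eval : ∀ {n} → Tm n → Vec ℕ n → ℕ
eval* : ∀ {n m} → Vec (Tm n) m → Vec ℕ n → Vec ℕ m
eval (var i) v = lookup v i
eval (lit k) v = k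
eval (app f ts) v = fun f (eval* ts v)
eval* [] v = []
eval* (t ∷ ts) v = eval t v ∷ eval* ts v

numeral : ∀ {n} → ℕ → PR n
numeral zero = zer
numeral (suc k) = comp succ (numeral k ∷ [])

numeral-⇓ : ∀ {n} k (v : Vec ℕ n) → numeral k [ v ]⇓ k
numeral-⇓ zero v = ⇓zer
numeral-⇓ (suc k) v = ⇓comp (numeral-⇓ k v ∷ []) ⇓succ

tmPR : ∀ {n} → Tm n → PR n
tmPR* : ∀ {n m} → Vec (Tm n) m → Vec (PR n) m
tmPR (var i) = proj i
tmPR (lit k) = numeral k
tmPR (app f ts) = comp (prog f) (tmPR* ts)
tmPR* [] = []
tmPR* (t ∷ ts) = tmPR t ∷ tmPR* ts

tm-⇓ : ∀ {n} (t : Tm n) v → tmPR t [ v ]⇓ eval t v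
tm-⇓* : ∀ {n m} (ts : Vec (Tm n) m) v → Pointwise (λ g z → g [ v ]⇓ z) (tmPR* ts) (eval* ts v)
tm-⇓ (var i) v = ⇓proj i
tm-⇓ (lit k) v = numeral-⇓ k v
tm-⇓ (app f ts) v = ⇓comp (tm-⇓* ts v) (ok f _)
tm-⇓* [] v = []
tm-⇓* (t ∷ ts) v = tm-⇓ t v ∷ tm-⇓* ts v

tmF : ∀ {n} → Tm n → Fn n
tmF t = mkFn (eval t) (tmPR t) (tm-⇓ t)

pattern #0 = var zero
pattern #1 = var (suc zero)
pattern #2 = var (suc (suc zero))
pattern #3 = var (suc (suc (suc zero)))
pattern #4 = var (suc (suc (suc (suc zero))))
pattern #5 = var (suc (suc (suc (suc (suc zero)))))
pattern #6 = var (suc (suc (suc (suc (suc (suc zero))))))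

sucF : Fn 1
fun  sucF (x ∷ []) = suc x
prog sucF = succ
ok   sucF (x ∷ []) = ⇓succ

predF : Fn 1
predF = precF (mkFn (λ _ → 0) zer (λ _ → ⇓zer)) (tmF #0)

addF : Fn 2
addF = precF (tmF #0) (tmF (app sucF (#1 ∷ [])))

-- The subtrahend comes first.
monusF : Fn 2
monusF = precF (tmF #0) (tmF (app predF (#1 ∷ [])))

add-fun : ∀ x y → fun addF (x ∷ y ∷ []) ≡ x + y
add-fun zero y = refl
add-fun (suc x) y = cong suc (add-fun x y)

pred-fun : ∀ x → fun predF (x ∷ []) ≡ pred x
pred-fun zero = refl
pred-fun (suc x) = refl

monus-fun : ∀ y x → fun monusF (y ∷ x ∷ []) ≡ x ∸ y
monus-fun zero x = refl
monus-fun (suc y) x =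
  trans (pred-fun (fun monusF (y ∷ x ∷ []))) (trans (cong pred (monus-fun y x)) (pred[m∸n]≡m∸[1+n] x y))

infixr 4 _⇒ᶠ_
infixr 6 _∧ᶠ_
infixr 5 _∨ᶠ_
infix 7 _≈ᶠ_ _<ᶠ_

-- All quantifiers are bounded, so truth is decided by a program built along the formula. Once a
-- stage of the construction is written as a formula, its recursiveness needs no further argument.
-- `call` is substitution, which lets a formula be reused without renaming variables.
data Fm : ℕ → Set where
  _≈ᶠ_ _<ᶠ_ : ∀ {n} → Tm n → Tm n → Fm n
  _∧ᶠ_ _∨ᶠ_ _⇒ᶠ_ : ∀ {n} → Fm n → Fm n → Fm n
  ¬ᶠ_ : ∀ {n} → Fm n → Fm n
  ∃ᶠ ∀ᶠ : ∀ {n} → Tm n → Fm (suc n) → Fm n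
  call : ∀ {n m} → Fm m → Vec (Tm n) m → Fm n

Holds : ∀ {n} → Fm n → Vec ℕ n → Set
Holds (t ≈ᶠ u) v = eval t v ≡ eval u v
Holds (t <ᶠ u) v = eval t v < eval u v
Holds (φ ∧ᶠ ψ) v = Holds φ v × Holds ψ v
Holds (φ ∨ᶠ ψ) v = Holds φ v ⊎ Holds ψ v
Holds (φ ⇒ᶠ ψ) v = Holds φ v → Holds ψ v
Holds (¬ᶠ φ) v = ¬ Holds φ v
Holds (∃ᶠ t φ) v = ∃[ k ] (k < eval t v × Holds φ (k ∷ v))
Holds (∀ᶠ t φ) v = ∀ k → k < eval t v → Holds φ (k ∷ v)
Holds (call φ ts) v = Holds φ (eval* ts v)

all<? : ∀ {P : ℕ → Set} → (∀ k → Dec (P k)) → ∀ b → Dec (∀ k → k < b → P k)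
all<? P? b with allUpTo? P? b
... | yes p = yes λ k → p {k}
... | no ¬p = no λ q → ¬p λ {k} → q k

holds? : ∀ {n} (φ : Fm n) v → Dec (Holds φ v)
holds? (t ≈ᶠ u) v = eval t v ≟ eval u v
holds? (t <ᶠ u) v = eval t v <? eval u v
holds? (φ ∧ᶠ ψ) v = holds? φ v ×-dec holds? ψ v
holds? (φ ∨ᶠ ψ) v = holds? φ v ⊎-dec holds? ψ v
holds? (φ ⇒ᶠ ψ) v = holds? φ v →-dec holds? ψ v
holds? (¬ᶠ φ) v = ¬? (holds? φ v)
holds? (∃ᶠ t φ) v = anyUpTo? (λ k → holds? φ (k ∷ v)) (eval t v)
holds? (∀ᶠ t φ) v = all<? (λ k → holds? φ (k ∷ v)) (eval t v)
holds? (call φ ts) v = holds? φ (eval* ts v)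

-- Programs that decide bounded formulas

Decides : ∀ {n} → PR n → Vec ℕ n → Set → Set
Decides p v P = (P × p [ v ]⇓ 1) ⊎ ((¬ P) × p [ v ]⇓ 0)

Decides-⇔ : ∀ {n} {p : PR n} {v P Q} → (P → Q) → (Q → P) → Decides p v P → Decides p v Q
Decides-⇔ f g (inj₁ (x , c)) = inj₁ (f x , c)
Decides-⇔ f g (inj₂ (x , c)) = inj₂ ((λ q → x (g q)) , c)

-- Primitive recursion on a truth value is a case distinction: the base case answers 0, the step
-- answers 1.
notPR : PR 1
notPR = prec (numeral 1) zer

orPR : PR 2
orPR = prec (proj zero) (numeral 1)

andPR : PR 2
andPR = prec zer (proj (suc (suc zero)))

not-Decides : ∀ {n} {p : PR n} {v P} → Decides p v P → Decides (comp notPR (p ∷ [])) v (¬ P)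
not-Decides (inj₁ (x , c)) = inj₂ ((λ k → k x) , ⇓comp (c ∷ []) (⇓precₛ (⇓prec₀ (numeral-⇓ 1 _)) ⇓zer))
not-Decides (inj₂ (x , c)) = inj₁ (x , ⇓comp (c ∷ []) (⇓prec₀ (numeral-⇓ 1 _)))

or-Decides : ∀ {n} {p q : PR n} {v P Q} → Decides p v P → Decides q v Q →
             Decides (comp orPR (p ∷ q ∷ [])) v (P ⊎ Q)
or-Decides (inj₁ (x , c)) (inj₁ (y , d)) =
  inj₁ (inj₁ x , ⇓comp (c ∷ d ∷ []) (⇓precₛ (⇓prec₀ (⇓proj zero)) (numeral-⇓ 1 _)))
or-Decides (inj₁ (x , c)) (inj₂ (y , d)) =
  inj₁ (inj₁ x , ⇓comp (c ∷ d ∷ []) (⇓precₛ (⇓prec₀ (⇓proj zero)) (numeral-⇓ 1 _)))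
or-Decides (inj₂ (x , c)) (inj₁ (y , d)) =
  inj₁ (inj₂ y , ⇓comp (c ∷ d ∷ []) (⇓prec₀ (⇓proj zero)))
or-Decides (inj₂ (x , c)) (inj₂ (y , d)) =
  inj₂ ([ x , y ]′ , ⇓comp (c ∷ d ∷ []) (⇓prec₀ (⇓proj zero)))

and-Decides : ∀ {n} {p q : PR n} {v P Q} → Decides p v P → Decides q v Q →
              Decides (comp andPR (p ∷ q ∷ [])) v (P × Q)
and-Decides (inj₁ (x , c)) (inj₁ (y , d)) =
  inj₁ ((x , y) , ⇓comp (c ∷ d ∷ []) (⇓precₛ (⇓prec₀ ⇓zer) (⇓proj (suc (suc zero)))))
and-Decides (inj₁ (x , c)) (inj₂ (y , d)) =
  inj₂ ((λ (_ , b) → y b) , ⇓comp (c ∷ d ∷ []) (⇓precₛ (⇓prec₀ ⇓zer) (⇓proj (suc (suc zero)))))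
and-Decides (inj₂ (x , c)) (inj₁ (y , d)) =
  inj₂ ((λ (a , _) → x a) , ⇓comp (c ∷ d ∷ []) (⇓prec₀ ⇓zer))
and-Decides (inj₂ (x , c)) (inj₂ (y , d)) =
  inj₂ ((λ (a , _) → x a) , ⇓comp (c ∷ d ∷ []) (⇓prec₀ ⇓zer))

projs : ∀ {n m} → (Fin m → Fin n) → Vec (PR n) m
projs f = tabulate (λ i → proj (f i))

projs-⇓ : ∀ {n m} (f : Fin m → Fin n) (w : Vec ℕ n) (v : Vec ℕ m) →
          (∀ i → lookup w (f i) ≡ lookup v i) → Pointwise (λ g z → g [ w ]⇓ z) (projs f) v
projs-⇓ f w [] eq = []
projs-⇓ f w (x ∷ v) eq =
  subst (λ z → proj (f zero) [ w ]⇓ z) (eq zero) (⇓proj (f zero)) ∷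
  projs-⇓ (λ i → f (suc i)) w v (λ i → eq (suc i))

∃-PR : ∀ {n} → PR (suc n) → PR (suc n)
∃-PR p = prec zer (comp orPR (proj (suc zero) ∷ comp p (proj zero ∷ projs (λ i → suc (suc i))) ∷ []))

∃-Decides : ∀ {n} {p : PR (suc n)} {v} {P : ℕ → Set} → (∀ k → Decides p (k ∷ v) (P k)) →
            ∀ b → Decides (∃-PR p) (b ∷ v) (∃[ k ] (k < b × P k))
∃-Decides dp zero = inj₂ ((λ ()) , ⇓prec₀ ⇓zer)
∃-Decides {p = p} {v} {P} dp (suc b) =
  Decides-⇔ {P = (∃[ k ] (k < b × P k)) ⊎ P b} to from (lift (∃-Decides dp b) (dp b))
  where
  to : (∃[ k ] (k < b × P k)) ⊎ P b → ∃[ k ] (k < suc b × P k)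
  to (inj₁ (k , k<b , x)) = k , m<n⇒m<1+n k<b , x
  to (inj₂ x) = b , ≤-refl , x
  from : ∃[ k ] (k < suc b × P k) → (∃[ k ] (k < b × P k)) ⊎ P b
  from (k , k<1+b , x) with m≤n⇒m<n∨m≡n (s≤s⁻¹ k<1+b)
  ... | inj₁ k<b = inj₁ (k , k<b , x)
  ... | inj₂ refl = inj₂ x
  q : ∀ r z → p [ b ∷ v ]⇓ z → comp p (proj zero ∷ projs (λ i → suc (suc i))) [ b ∷ r ∷ v ]⇓ z
  q r z d = ⇓comp (⇓proj zero ∷ projs-⇓ _ _ v (λ _ → refl)) d
  lift : Decides (∃-PR p) (b ∷ v) (∃[ k ] (k < b × P k)) → Decides p (b ∷ v) (P b) →
         Decides (∃-PR p) (suc b ∷ v) ((∃[ k ] (k < b × P k)) ⊎ P b)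
  lift d (inj₁ (y , e)) with d
  ... | inj₁ (x , c) = inj₁ (inj₂ y , ⇓precₛ c (⇓comp (⇓proj _ ∷ q _ _ e ∷ []) (⇓precₛ (⇓prec₀ (⇓proj zero)) (numeral-⇓ 1 _))))
  ... | inj₂ (x , c) = inj₁ (inj₂ y , ⇓precₛ c (⇓comp (⇓proj _ ∷ q _ _ e ∷ []) (⇓prec₀ (⇓proj zero))))
  lift d (inj₂ (y , e)) with d
  ... | inj₁ (x , c) = inj₁ (inj₁ x , ⇓precₛ c (⇓comp (⇓proj _ ∷ q _ _ e ∷ []) (⇓precₛ (⇓prec₀ (⇓proj zero)) (numeral-⇓ 1 _))))
  ... | inj₂ (x , c) = inj₂ ([ x , y ]′ , ⇓precₛ c (⇓comp (⇓proj _ ∷ q _ _ e ∷ []) (⇓prec₀ (⇓proj zero))))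

ltPR : PR 2
ltPR = comp notPR (comp notPR (prog monusF ∷ []) ∷ [])

lt-Decides : ∀ x y → Decides ltPR (x ∷ y ∷ []) (x < y)
lt-Decides x y with x <? y
... | yes p = inj₁ (p , ⇓comp (⇓comp (ok monusF _ ∷ []) (pos _ eq) ∷ []) (⇓prec₀ (numeral-⇓ 1 _)))
  where
  eq : 0 < fun monusF (x ∷ y ∷ [])
  eq = subst (0 <_) (sym (monus-fun x y)) (m<n⇒0<n∸m p)
  pos : ∀ k → 0 < k → notPR [ k ∷ [] ]⇓ 0
  pos zero ()
  pos (suc zero) _ = ⇓precₛ (⇓prec₀ (numeral-⇓ 1 _)) ⇓zer
  pos (suc (suc k)) _ = ⇓precₛ (pos (suc k) (s≤s z≤n)) ⇓zer
... | no ¬p = inj₂ (¬p , ⇓comp (⇓comp (ok monusF _ ∷ []) (nil _ eq) ∷ []) (⇓precₛ (⇓prec₀ (numeral-⇓ 1 _)) ⇓zer))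
  where
  eq : fun monusF (x ∷ y ∷ []) ≡ 0
  eq = trans (monus-fun x y) (m≤n⇒m∸n≡0 (≮⇒≥ ¬p))
  nil : ∀ k → k ≡ 0 → notPR [ k ∷ [] ]⇓ 1
  nil zero refl = ⇓prec₀ (numeral-⇓ 1 _)

comp-Decides : ∀ {n m} {p : PR m} (ts : Vec (Tm n) m) {v P} →
               Decides p (eval* ts v) P → Decides (comp p (tmPR* ts)) v P
comp-Decides ts (inj₁ (x , c)) = inj₁ (x , ⇓comp (tm-⇓* ts _) c)
comp-Decides ts (inj₂ (x , c)) = inj₂ (x , ⇓comp (tm-⇓* ts _) c)

fmPR : ∀ {n} → Fm n → PR n
fmPR (t ≈ᶠ u) = comp andPR (comp notPR (comp ltPR (tmPR* (t ∷ u ∷ [])) ∷ []) ∷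
                            comp notPR (comp ltPR (tmPR* (u ∷ t ∷ [])) ∷ []) ∷ [])
fmPR (t <ᶠ u) = comp ltPR (tmPR* (t ∷ u ∷ []))
fmPR (φ ∧ᶠ ψ) = comp andPR (fmPR φ ∷ fmPR ψ ∷ [])
fmPR (φ ∨ᶠ ψ) = comp orPR (fmPR φ ∷ fmPR ψ ∷ [])
fmPR (φ ⇒ᶠ ψ) = comp orPR (comp notPR (fmPR φ ∷ []) ∷ fmPR ψ ∷ [])
fmPR (¬ᶠ φ) = comp notPR (fmPR φ ∷ [])
fmPR (∃ᶠ t φ) = comp (∃-PR (fmPR φ)) (tmPR t ∷ projs (λ i → i))
fmPR (∀ᶠ t φ) = comp notPR (comp (∃-PR (comp notPR (fmPR φ ∷ []))) (tmPR t ∷ projs (λ i → i)) ∷ [])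
fmPR (call φ ts) = comp (fmPR φ) (tmPR* ts)

bounded-Decides : ∀ {n} {p : PR (suc n)} (t : Tm n) {v P} →
                  Decides p (eval t v ∷ v) P → Decides (comp p (tmPR t ∷ projs (λ i → i))) v P
bounded-Decides t {v} (inj₁ (x , c)) = inj₁ (x , ⇓comp (tm-⇓ t v ∷ projs-⇓ _ v v (λ _ → refl)) c)
bounded-Decides t {v} (inj₂ (x , c)) = inj₂ (x , ⇓comp (tm-⇓ t v ∷ projs-⇓ _ v v (λ _ → refl)) c)

fm-Decides : ∀ {n} (φ : Fm n) v → Decides (fmPR φ) v (Holds φ v)
fm-Decides (t ≈ᶠ u) v =
  Decides-⇔ (λ (p , q) → ≤-antisym (≮⇒≥ q) (≮⇒≥ p))
            (λ e → (λ l → <-irrefl e l) , (λ l → <-irrefl (sym e) l))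
            (and-Decides (not-Decides (comp-Decides (t ∷ u ∷ []) (lt-Decides _ _)))
                         (not-Decides (comp-Decides (u ∷ t ∷ []) (lt-Decides _ _))))
fm-Decides (t <ᶠ u) v = comp-Decides (t ∷ u ∷ []) (lt-Decides _ _)
fm-Decides (φ ∧ᶠ ψ) v = and-Decides (fm-Decides φ v) (fm-Decides ψ v)
fm-Decides (φ ∨ᶠ ψ) v = or-Decides (fm-Decides φ v) (fm-Decides ψ v)
fm-Decides (φ ⇒ᶠ ψ) v =
  Decides-⇔ [ (λ ¬h h → ⊥-elim (¬h h)) , (λ k _ → k) ]′ from
    (or-Decides (not-Decides (fm-Decides φ v)) (fm-Decides ψ v))
  where
  from : (Holds φ v → Holds ψ v) → ¬ Holds φ v ⊎ Holds ψ v
  from f with holds? φ v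
  ... | yes h = inj₂ (f h)
  ... | no ¬h = inj₁ ¬h
fm-Decides (¬ᶠ φ) v = not-Decides (fm-Decides φ v)
fm-Decides (∃ᶠ t φ) v = bounded-Decides t (∃-Decides (λ k → fm-Decides φ (k ∷ v)) _)
fm-Decides (∀ᶠ t φ) v =
  Decides-⇔ {P = ¬ (∃[ k ] (k < eval t v × ¬ Holds φ (k ∷ v)))} to from
    (not-Decides (bounded-Decides t (∃-Decides (λ k → not-Decides (fm-Decides φ (k ∷ v))) _)))
  where
  to : ¬ (∃[ k ] (k < eval t v × ¬ Holds φ (k ∷ v))) → ∀ k → k < eval t v → Holds φ (k ∷ v)
  to ne k lt with holds? φ (k ∷ v)
  ... | yes h = h
  ... | no ¬h = ⊥-elim (ne (k , lt , ¬h))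
  from : (∀ k → k < eval t v → Holds φ (k ∷ v)) → ¬ (∃[ k ] (k < eval t v × ¬ Holds φ (k ∷ v)))
  from h (k , lt , ¬h) = ¬h (h k lt)
fm-Decides (call φ ts) v = comp-Decides ts (fm-Decides φ _)

χ : ∀ {P : Set} → Dec P → ℕ
χ (yes _) = 1
χ (no _)  = 0

fmF : ∀ {n} → Fm n → Fn n
fun  (fmF φ) v = χ (holds? φ v)
prog (fmF φ) = fmPR φ
ok   (fmF φ) v with holds? φ v | fm-Decides φ v
... | yes h | inj₁ (_ , c) = c
... | yes h | inj₂ (¬h , _) = ⊥-elim (¬h h)
... | no ¬h | inj₁ (h , _) = ⊥-elim (¬h h)
... | no ¬h | inj₂ (_ , c) = c

χ⇒ : ∀ {P : Set} (d : Dec P) → χ d ≡ 1 → P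
χ⇒ (yes p) _ = p

⇒χ : ∀ {P : Set} (d : Dec P) → P → χ d ≡ 1
⇒χ (yes _) _ = refl
⇒χ (no ¬p) p = ⊥-elim (¬p p)

reFn : ∀ {n} (F : Fn n) (g : Vec ℕ n → ℕ) → (∀ v → fun F v ≡ g v) → Fn n
reFn F g eq = mkFn g (prog F) (λ v → subst (prog F [ v ]⇓_) (eq v) (ok F v))

plusF : Fn 2
fun  plusF (x ∷ y ∷ []) = x + y
prog plusF = prog addF
ok   plusF (x ∷ y ∷ []) = subst (prog addF [ x ∷ y ∷ [] ]⇓_) (add-fun x y) (ok addF (x ∷ y ∷ []))

minusF : Fn 2
fun  minusF (x ∷ y ∷ []) = x ∸ y
prog minusF = comp (prog monusF) (proj (suc zero) ∷ proj zero ∷ [])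
ok   minusF (x ∷ y ∷ []) =
  subst (prog minusF [ x ∷ y ∷ [] ]⇓_) (monus-fun y x)
    (⇓comp (⇓proj (suc zero) ∷ ⇓proj zero ∷ []) (ok monusF (y ∷ x ∷ [])))

Suc : ∀ {n} → Tm n → Tm n
Suc t = app sucF (t ∷ [])

-- Pairing and histories

triangle : ℕ → ℕ
triangle zero = 0
triangle (suc k) = suc k + triangle k

triangleF : Fn 1
triangleF = reFn (precF (tmF (lit 0)) (tmF (app plusF (Suc #0 ∷ #1 ∷ [])))) (λ { (x ∷ []) → triangle x }) eq
  where
  eq : ∀ v → _ ≡ _
  eq (zero ∷ []) = refl
  eq (suc k ∷ []) = cong (suc k +_) (eq (k ∷ []))

diagonalFm : Fm 2
diagonalFm = app triangleF (Suc #1 ∷ []) <ᶠ Suc (Suc #0)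

-- The index of the Cantor diagonal through `n`, by recursion on `n`: it advances by one exactly
-- when the next number reaches `triangle (suc d)`.
diagonalF : Fn 1
diagonalF = precF (tmF (lit 0)) (tmF (app plusF (app (fmF diagonalFm) (#0 ∷ #1 ∷ []) ∷ #1 ∷ [])))

diagonal : ℕ → ℕ
diagonal n = fun diagonalF (n ∷ [])

diagonal-step : ∀ n d (δ : Dec (triangle (suc d) < suc (suc n))) →
                triangle d ≤ n × n < triangle (suc d) →
                triangle (χ δ + d) ≤ suc n × suc n < triangle (suc (χ δ + d))
diagonal-step n d (yes p) (lo , hi) =
  s≤s⁻¹ p , ≤-<-trans hi (m<n+m (triangle (suc d)) {suc (suc d)} (s≤s z≤n))
diagonal-step n d (no ¬p) (lo , hi) = m≤n⇒m≤1+n lo , ≰⇒> (λ q → ¬p (s≤s q))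

diagonal-spec : ∀ n → triangle (diagonal n) ≤ n × n < triangle (suc (diagonal n))
diagonal-spec zero = z≤n , s≤s z≤n
diagonal-spec (suc n) =
  diagonal-step n (diagonal n) (holds? diagonalFm (n ∷ diagonal n ∷ [])) (diagonal-spec n)

triangle-mono : ∀ {m n} → m ≤ n → triangle m ≤ triangle n
triangle-mono {n = n} z≤n = z≤n
triangle-mono (s≤s p) = +-mono-≤ (s≤s p) (triangle-mono p)

diagonal-unique : ∀ {s n} → triangle s ≤ n → n < triangle (suc s) → diagonal n ≡ s
diagonal-unique {s} {n} lo hi with diagonal-spec n | <-cmp (diagonal n) s
... | lo′ , hi′ | tri≈ _ e _ = e
... | lo′ , hi′ | tri< l _ _ = ⊥-elim (<-irrefl refl (<-≤-trans hi′ (≤-trans (triangle-mono l) lo)))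
... | lo′ , hi′ | tri> _ _ g = ⊥-elim (<-irrefl refl (<-≤-trans hi (≤-trans (triangle-mono g) lo′)))

opaque
  pair : ℕ → ℕ → ℕ
  pair x y = y + triangle (x + y)

  π₁ π₂ : ℕ → ℕ
  π₂ n = n ∸ triangle (diagonal n)
  π₁ n = diagonal n ∸ π₂ n

  private
    diagonal-pair : ∀ x y → diagonal (pair x y) ≡ x + y
    diagonal-pair x y = diagonal-unique (m≤n+m (triangle (x + y)) y)
      (+-monoˡ-< (triangle (x + y)) (s≤s (m≤n+m y x)))

  π₂-pair : ∀ x y → π₂ (pair x y) ≡ y
  π₂-pair x y = trans (cong (λ d → pair x y ∸ triangle d) (diagonal-pair x y)) (m+n∸n≡m y (triangle (x + y)))

  π₁-pair : ∀ x y → π₁ (pair x y) ≡ x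
  π₁-pair x y = trans (cong₂ _∸_ (diagonal-pair x y) (π₂-pair x y)) (m+n∸n≡m x y)

  pair-π : ∀ n → pair (π₁ n) (π₂ n) ≡ n
  pair-π n = trans (cong (λ d → π₂ n + triangle d) eq) (m∸n+n≡m (proj₁ (diagonal-spec n)))
    where
    π₂≤ : π₂ n ≤ diagonal n
    π₂≤ = s≤s⁻¹ (subst (π₂ n <_) (m+n∸n≡m (suc (diagonal n)) (triangle (diagonal n)))
      (∸-monoˡ-< (proj₂ (diagonal-spec n)) (proj₁ (diagonal-spec n))))
    eq : π₁ n + π₂ n ≡ diagonal n
    eq = m∸n+n≡m π₂≤

  n≤pair : ∀ m n → n ≤ pair m n
  n≤pair m n = m≤m+n n _

  private
    pairTm : Tm 2
    pairTm = app plusF (#1 ∷ app triangleF (app plusF (#0 ∷ #1 ∷ []) ∷ []) ∷ [])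
    π₂Tm : Tm 1
    π₂Tm = app minusF (#0 ∷ app triangleF (app diagonalF (#0 ∷ []) ∷ []) ∷ [])

  pairPR : PR 2
  pairPR = tmPR pairTm
  pair-⇓ : ∀ x y → pairPR [ x ∷ y ∷ [] ]⇓ pair x y
  pair-⇓ x y = tm-⇓ pairTm (x ∷ y ∷ [])
  π₁PR π₂PR : PR 1
  π₁PR = tmPR (app minusF (app diagonalF (#0 ∷ []) ∷ π₂Tm ∷ []))
  π₂PR = tmPR π₂Tm
  π₁-⇓ : ∀ x → π₁PR [ x ∷ [] ]⇓ π₁ x
  π₁-⇓ x = tm-⇓ (app minusF (app diagonalF (#0 ∷ []) ∷ π₂Tm ∷ [])) (x ∷ [])
  π₂-⇓ : ∀ x → π₂PR [ x ∷ [] ]⇓ π₂ x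
  π₂-⇓ x = tm-⇓ π₂Tm (x ∷ [])

pairF : Fn 2
fun  pairF (x ∷ y ∷ []) = pair x y
prog pairF = pairPR
ok   pairF (x ∷ y ∷ []) = pair-⇓ x y

π₁F π₂F : Fn 1
fun  π₁F (x ∷ []) = π₁ x
prog π₁F = π₁PR
ok   π₁F (x ∷ []) = π₁-⇓ x
fun  π₂F (x ∷ []) = π₂ x
prog π₂F = π₂PR
ok   π₂F (x ∷ []) = π₂-⇓ x

Pair : ∀ {n} → Tm n → Tm n → Tm n
Pair t u = app pairF (t ∷ u ∷ [])

Fst Snd : ∀ {n} → Tm n → Tm n
Fst t = app π₁F (t ∷ [])
Snd t = app π₂F (t ∷ [])

-- Iterated unpairing makes every number the code of an infinite sequence. Lookup is total, no
-- length is stored, and `encode` prescribes any finite part.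
nth : ℕ → ℕ → ℕ
nth c zero = π₁ c
nth c (suc i) = nth (π₂ c) i

nthF : Fn 2
nthF = reFn (tmF (Fst (app tails (#1 ∷ #0 ∷ [])))) (λ { (c ∷ i ∷ []) → nth c i }) λ { (c ∷ i ∷ []) → eq i c }
  where
  tails : Fn 2
  tails = precF (tmF #0) (tmF (Snd #1))
  shift : ∀ i c → fun tails (suc i ∷ c ∷ []) ≡ fun tails (i ∷ π₂ c ∷ [])
  shift zero c = refl
  shift (suc i) c = cong π₂ (shift i c)
  eq : ∀ i c → π₁ (fun tails (i ∷ c ∷ [])) ≡ nth c i
  eq zero c = refl
  eq (suc i) c = trans (cong π₁ (shift i c)) (eq i (π₂ c))

Nth : ∀ {n} → Tm n → Tm n → Tm n
Nth c i = app nthF (c ∷ i ∷ [])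

nth-pair-suc : ∀ x c i → nth (pair x c) (suc i) ≡ nth c i
nth-pair-suc x c i = cong (λ d → nth d i) (π₂-pair x c)

encode : ∀ n (f : ℕ → ℕ) → ∃[ c ] (∀ i → i < n → nth c i ≡ f i)
encode zero f = 0 , λ _ ()
encode (suc n) f with encode n (λ i → f (suc i))
... | c , h = pair (f 0) c , λ where
  zero _ → π₁-pair _ _
  (suc i) (s≤s p) → trans (nth-pair-suc _ c i) (h i p)

-- A history of length s is coded as ⟨ s , bits ⟩ with the newest bit first.
look : ℕ → ℕ → ℕ
look H t = nth (π₂ H) (π₁ H ∸ suc t)

lookF : Fn 2
fun  lookF (H ∷ t ∷ []) = look H t
prog lookF = prog (tmF (Nth (Snd #0) (app minusF (Fst #0 ∷ Suc #1 ∷ []))))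
ok   lookF (H ∷ t ∷ []) = tm-⇓ (Nth (Snd #0) (app minusF (Fst #0 ∷ Suc #1 ∷ []))) (H ∷ t ∷ [])

Bit : ∀ {n} → Tm n → Tm n → Fm n
Bit H t = app lookF (H ∷ t ∷ []) ≈ᶠ lit 1

-- Course-of-values recursion: the decision at stage `s` is made by `φ` from the code of all earlier
-- decisions. It serves both the universal relation and the construction.
module History (φ : Fm 2) where

  private
    rawF : Fn 1
    rawF = precF (tmF (lit (pair 0 0)))
      (tmF (Pair (Suc #0) (Pair (app (fmF φ) (#1 ∷ #0 ∷ [])) (Snd #1))))
    bitTm : Tm 1
    bitTm = app (fmF φ) (app rawF (#0 ∷ []) ∷ #0 ∷ [])

  opaque
    hist : ℕ → ℕ
    hist s = fun rawF (s ∷ [])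

    bit : ℕ → ℕ
    bit s = χ (holds? φ (hist s ∷ s ∷ []))

    histPR bitPR : PR 1
    histPR = prog rawF
    bitPR = prog (tmF bitTm)

    hist-⇓ : ∀ s → histPR [ s ∷ [] ]⇓ hist s
    hist-⇓ s = ok rawF (s ∷ [])

    bit-⇓ : ∀ s → bitPR [ s ∷ [] ]⇓ bit s
    bit-⇓ s = tm-⇓ bitTm (s ∷ [])

  Perf : ℕ → Set
  Perf t = bit t ≡ 1

  histF bitF : Fn 1
  fun  histF (s ∷ []) = hist s
  prog histF = histPR
  ok   histF (s ∷ []) = hist-⇓ s
  fun  bitF (s ∷ []) = bit s
  prog bitF = bitPR
  ok   bitF (s ∷ []) = bit-⇓ s

  opaque
    unfolding hist

    perf⇒ : ∀ s → Perf s → Holds φ (hist s ∷ s ∷ [])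
    perf⇒ s = χ⇒ (holds? φ _)

    ⇒perf : ∀ s → Holds φ (hist s ∷ s ∷ []) → Perf s
    ⇒perf s = ⇒χ (holds? φ _)

    length-hist : ∀ s → π₁ (hist s) ≡ s
    length-hist zero = π₁-pair 0 0
    length-hist (suc s) = π₁-pair _ _

    look-hist : ∀ s t → t < s → look (hist s) t ≡ bit t
    look-hist (suc s) t (s≤s t≤s) with m≤n⇒m<n∨m≡n t≤s
    ... | inj₂ refl = begin
      nth (π₂ (hist (suc s))) (π₁ (hist (suc s)) ∸ suc s) ≡⟨ cong₂ nth (π₂-pair _ _) (trans (cong (_∸ suc s) (π₁-pair _ _)) (n∸n≡0 s)) ⟩
      nth (pair (bit s) (π₂ (hist s))) 0 ≡⟨ π₁-pair _ _ ⟩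
      bit s ∎
      where open ≡-Reasoning
    ... | inj₁ t<s = begin
      nth (π₂ (hist (suc s))) (π₁ (hist (suc s)) ∸ suc t) ≡⟨ cong₂ nth (π₂-pair _ _) (trans (cong (_∸ suc t) (π₁-pair _ _)) (+-∸-assoc 1 t<s)) ⟩
      nth (pair (bit s) (π₂ (hist s))) (suc (s ∸ suc t)) ≡⟨ nth-pair-suc (bit s) (π₂ (hist s)) (s ∸ suc t) ⟩
      nth (π₂ (hist s)) (s ∸ suc t) ≡⟨ cong (λ l → nth (π₂ (hist s)) (l ∸ suc t)) (sym (length-hist s)) ⟩
      look (hist s) t ≡⟨ look-hist s t t<s ⟩
      bit t ∎
      where open ≡-Reasoning

    look⇒perf : ∀ {s t} → t < s → look (hist s) t ≡ 1 → Perf t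
    look⇒perf t<s e = trans (sym (look-hist _ _ t<s)) e

    perf⇒look : ∀ {s t} → t < s → Perf t → look (hist s) t ≡ 1
    perf⇒look t<s e = trans (look-hist _ _ t<s) e

-- A universal c.e. relation

gödel : ∀ {n} → PR n → ℕ
gödel* : ∀ {n m} → Vec (PR n) m → ℕ
gödel zer = pair 0 0
gödel succ = pair 1 0
gödel (proj i) = pair 2 (toℕ i)
-- The number `m` of inner functions is stored because it bounds the universal quantifier in
-- `compFm`.
gödel (comp {m} f gs) = pair 3 (pair (gödel f) (pair m (gödel* gs)))
gödel (prec f g) = pair 4 (pair (gödel f) (gödel g))
gödel (mu f) = pair 5 (gödel f)
gödel* [] = 0
gödel* (g ∷ gs) = pair (gödel g) (gödel* gs)

-- A judgement ⟨ c , ⟨ e , y ⟩ ⟩ says that program c on environment e has value y.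
Prog Env Val Tag Body : ∀ {n} → Tm n → Tm n
Prog J = Fst J
Env J = Fst (Snd J)
Val J = Snd (Snd J)
Tag J = Fst (Fst J)
Body J = Snd (Fst J)

-- Variables: history, stage, judgement.
derivedFm : Fm 3
derivedFm = ∃ᶠ #1 (Bit #1 #0 ∧ᶠ Fst #0 ≈ᶠ #3)

-- One formula for each rule of the evaluation relation. In `compFm` the environment of the outer
-- judgement doubles as the list of intermediate values, so no separate quantifier over sequences
-- occurs.
zerFm succFm projFm compFm precFm muFm : Fm 2
zerFm = Val (Fst #1) ≈ᶠ lit 0
succFm = Val (Fst #1) ≈ᶠ Suc (Fst (Env (Fst #1)))
projFm = Val (Fst #1) ≈ᶠ Nth (Env (Fst #1)) (Body (Fst #1))
compFm = ∃ᶠ #1 (Bit #1 #0 ∧ᶠ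
  Prog (Fst #0) ≈ᶠ Fst (Body (Fst #2)) ∧ᶠ
  Val (Fst #0) ≈ᶠ Val (Fst #2) ∧ᶠ
  ∀ᶠ (Fst (Snd (Body (Fst #2)))) (call derivedFm (#2 ∷ #3 ∷
    Pair (Nth (Snd (Snd (Body (Fst #3)))) #0) (Pair (Env (Fst #3)) (Nth (Env (Fst #1)) #0)) ∷ [])))
precFm =
  (Fst (Env (Fst #1)) ≈ᶠ lit 0 ∧ᶠ
   call derivedFm (#0 ∷ #1 ∷ Pair (Fst (Body (Fst #1))) (Pair (Snd (Env (Fst #1))) (Val (Fst #1))) ∷ []))
  ∨ᶠ
  ∃ᶠ (Fst (Env (Fst #1))) (Suc #0 ≈ᶠ Fst (Env (Fst #2)) ∧ᶠ
    ∃ᶠ #2 (Bit #2 #0 ∧ᶠ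
      Prog (Fst #0) ≈ᶠ Prog (Fst #3) ∧ᶠ
      Env (Fst #0) ≈ᶠ Pair #1 (Snd (Env (Fst #3))) ∧ᶠ
      call derivedFm (#2 ∷ #3 ∷ Pair (Snd (Body (Fst #3)))
        (Pair (Pair #1 (Pair (Val (Fst #0)) (Snd (Env (Fst #3))))) (Val (Fst #3))) ∷ [])))
muFm =
  call derivedFm (#0 ∷ #1 ∷ Pair (Body (Fst #1)) (Pair (Pair (Val (Fst #1)) (Env (Fst #1))) (lit 0)) ∷ []) ∧ᶠ
  ∀ᶠ (Val (Fst #1)) (∃ᶠ #2 (Bit #2 #0 ∧ᶠ
    Prog (Fst #0) ≈ᶠ Body (Fst #3) ∧ᶠ
    Env (Fst #0) ≈ᶠ Pair #1 (Env (Fst #3)) ∧ᶠ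
    lit 0 <ᶠ Val (Fst #0)))

-- The universal relation is a proof search: stage `t` derives `π₁ t` if one rule yields it from
-- judgements of earlier stages. Since `J` is proposed at every `pair J N`, each derivable judgement
-- gets a turn after its premises, and soundness is an induction on the stage.
stepFm : Fm 2
stepFm = (Tag (Fst #1) ≈ᶠ lit 0 ∧ᶠ zerFm) ∨ᶠ (Tag (Fst #1) ≈ᶠ lit 1 ∧ᶠ succFm) ∨ᶠ
  (Tag (Fst #1) ≈ᶠ lit 2 ∧ᶠ projFm) ∨ᶠ (Tag (Fst #1) ≈ᶠ lit 3 ∧ᶠ compFm) ∨ᶠ
  (Tag (Fst #1) ≈ᶠ lit 4 ∧ᶠ precFm) ∨ᶠ (Tag (Fst #1) ≈ᶠ lit 5 ∧ᶠ muFm)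

open module Derivation = History stepFm using () renaming
  (hist to dhist; bit to dbit; Perf to Derived; bitF to dbitF; perf⇒ to derived⇒; ⇒perf to ⇒derived;
   look⇒perf to look⇒derived; perf⇒look to derived⇒look)

Case : ℕ → Vec ℕ 2 → Set
Case 0 v = Holds zerFm v
Case 1 v = Holds succFm v
Case 2 v = Holds projFm v
Case 3 v = Holds compFm v
Case 4 v = Holds precFm v
Case 5 v = Holds muFm v
Case _ v = ⊥

-- Splitting on the program fixes the tag, so that of the six rules only one remains.
select : ∀ {τ v m} → τ ≡ m →
  (τ ≡ 0 × Case 0 v) ⊎ (τ ≡ 1 × Case 1 v) ⊎ (τ ≡ 2 × Case 2 v) ⊎
  (τ ≡ 3 × Case 3 v) ⊎ (τ ≡ 4 × Case 4 v) ⊎ (τ ≡ 5 × Case 5 v) → Case m v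
select refl (inj₁ (refl , c)) = c
select refl (inj₂ (inj₁ (refl , c))) = c
select refl (inj₂ (inj₂ (inj₁ (refl , c)))) = c
select refl (inj₂ (inj₂ (inj₂ (inj₁ (refl , c))))) = c
select refl (inj₂ (inj₂ (inj₂ (inj₂ (inj₁ (refl , c)))))) = c
select refl (inj₂ (inj₂ (inj₂ (inj₂ (inj₂ (refl , c)))))) = c

-- Junk beyond the n-th component of e is allowed.
record Codes {n} (e : ℕ) (v : Vec ℕ n) : Set where
  constructor codes
  field at : ∀ i → nth e (toℕ i) ≡ lookup v i
open Codes

codes-∷ : ∀ {n x e} {v : Vec ℕ n} → Codes e v → Codes (pair x e) (x ∷ v)
at (codes-∷ h) zero = π₁-pair _ _
at (codes-∷ {x = x} {e} h) (suc i) = trans (nth-pair-suc x e (toℕ i)) (at h i)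

codes-tail : ∀ {n x e} {v : Vec ℕ n} → Codes e (x ∷ v) → Codes (π₂ e) v
codes-tail h = codes (λ i → at h (suc i))

codes-subst : ∀ {n e e′} {v : Vec ℕ n} → e ≡ e′ → Codes e v → Codes e′ v
codes-subst refl h = h

nth-gödel* : ∀ {n m} (gs : Vec (PR n) m) i → nth (gödel* gs) (toℕ i) ≡ gödel (lookup gs i)
nth-gödel* (g ∷ gs) zero = π₁-pair _ _
nth-gödel* (g ∷ gs) (suc i) = trans (nth-pair-suc (gödel g) (gödel* gs) (toℕ i)) (nth-gödel* gs i)

pointwise : ∀ {n m} {P : PR n → ℕ → Set} (gs : Vec (PR n) m) (f : ℕ → ℕ) →
            (∀ i → P (lookup gs i) (f (toℕ i))) → Pointwise P gs (tabulate {n = m} (λ i → f (toℕ i)))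
pointwise [] f h = []
pointwise (g ∷ gs) f h = h zero ∷ pointwise gs (λ i → f (suc i)) (λ i → h (suc i))

codes-tabulate : ∀ e m → Codes {m} e (tabulate (λ i → nth e (toℕ i)))
codes-tabulate e m = codes (go e m)
  where
  go : ∀ e m (i : Fin m) → nth e (toℕ i) ≡ lookup (tabulate (λ i → nth e (toℕ i))) i
  go e (suc m) zero = refl
  go e (suc m) (suc i) = go (π₂ e) m i

Computes : ℕ → Set
Computes J = ∀ {n} (f : PR n) v → π₁ J ≡ gödel f → Codes (π₁ (π₂ J)) v → f [ v ]⇓ π₂ (π₂ J)

computes-pair : ∀ {c e y} → Computes (pair c (pair e y)) → ∀ {n} (f : PR n) v → c ≡ gödel f → Codes e v → f [ v ]⇓ y
computes-pair {c} {e} {y} h f v p q =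
  subst (f [ v ]⇓_) (trans (cong π₂ (π₂-pair c (pair e y))) (π₂-pair e y))
    (h f v (trans (π₁-pair c _) p)
       (codes-subst (sym (trans (cong π₁ (π₂-pair c (pair e y))) (π₁-pair e y))) q))

tag-of : ∀ {J : ℕ} {t b} → π₁ J ≡ pair t b → π₁ (π₁ J) ≡ t
tag-of e = trans (cong π₁ e) (π₁-pair _ _)

body-of : ∀ {J : ℕ} {t b} → π₁ J ≡ pair t b → π₂ (π₁ J) ≡ b
body-of e = trans (cong π₂ e) (π₂-pair _ _)

sound : ∀ t → Derived t → Computes (π₁ t)
sound = <-rec _ go
  where
  go : ∀ t → (∀ {u} → u < t → Derived u → Computes (π₁ u)) → Derived t → Computes (π₁ t)
  go t ih d = λ f v → by-cases f v
    where
    J : ℕ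
    J = π₁ t
    step : Holds stepFm (dhist t ∷ t ∷ [])
    step = derived⇒ t d
    use : ∀ {K} → Holds derivedFm (dhist t ∷ t ∷ K ∷ []) → Computes K
    use (u , u<t , b , refl) = ih u<t (look⇒derived u<t b)
    ih′ : ∀ {u} → u < t → look (dhist t) u ≡ 1 → Computes (π₁ u)
    ih′ u<t b = ih u<t (look⇒derived u<t b)
    by-cases : ∀ {n} (f : PR n) v → π₁ J ≡ gödel f → Codes (π₁ (π₂ J)) v → f [ v ]⇓ π₂ (π₂ J)
    by-cases zer v p q with select {v = dhist t ∷ t ∷ []} (tag-of {J} p) step
    ... | e = subst (zer [ v ]⇓_) (sym e) ⇓zer
    by-cases succ (x ∷ []) p q with select {v = dhist t ∷ t ∷ []} (tag-of {J} p) step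
    ... | e = subst (succ [ x ∷ [] ]⇓_) (sym (trans e (cong suc (at q zero)))) ⇓succ
    by-cases (proj i) v p q with select {v = dhist t ∷ t ∷ []} (tag-of {J} p) step
    ... | e = subst (proj i [ v ]⇓_)
                (sym (trans e (trans (cong (nth (π₁ (π₂ J))) (body-of {J} p)) (at q i)))) (⇓proj i)
    by-cases (comp {m} f gs) v p q with select {v = dhist t ∷ t ∷ []} (tag-of {J} p) step
    ... | u , u<t , b , e₁ , e₂ , h =
      ⇓comp (pointwise gs (nth e) λ i →
               computes-pair (use (h (toℕ i) (subst (toℕ i <_) (sym m≡) (toℕ<n i)))) (lookup gs i) v
                 (trans (cong (λ c → nth c (toℕ i)) gs≡) (nth-gödel* gs i)) q)
            (subst (f [ tabulate {n = m} (λ i → nth e (toℕ i)) ]⇓_) e₂ (ih′ u<t b f _ (trans e₁ f≡) (codes-tabulate e m)))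
      where
      e = π₁ (π₂ (π₁ u))
      body≡ : π₂ (π₁ J) ≡ pair (gödel f) (pair m (gödel* gs))
      body≡ = body-of {J} p
      f≡ : π₁ (π₂ (π₁ J)) ≡ gödel f
      f≡ = trans (cong π₁ body≡) (π₁-pair _ _)
      rest≡ : π₂ (π₂ (π₁ J)) ≡ pair m (gödel* gs)
      rest≡ = trans (cong π₂ body≡) (π₂-pair _ _)
      m≡ : π₁ (π₂ (π₂ (π₁ J))) ≡ m
      m≡ = trans (cong π₁ rest≡) (π₁-pair _ _)
      gs≡ : π₂ (π₂ (π₂ (π₁ J))) ≡ gödel* gs
      gs≡ = trans (cong π₂ rest≡) (π₂-pair _ _)
    by-cases (prec f g) (x ∷ v) p q with select {v = dhist t ∷ t ∷ []} (tag-of {J} p) step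
    ... | inj₁ (e , h) =
      subst (λ z → prec f g [ z ∷ v ]⇓ _) (trans (sym e) (at q zero))
        (⇓prec₀ (computes-pair (use h) f v
          (trans (cong π₁ (body-of {J} p)) (π₁-pair _ _)) (codes-tail q)))
    ... | inj₂ (k , _ , e , u , u<t , b , e₁ , e₂ , h) =
      subst (λ z → prec f g [ z ∷ v ]⇓ _) (trans e (at q zero))
        (⇓precₛ (ih′ u<t b (prec f g) (k ∷ v) (trans e₁ p) (codes-subst (sym e₂) (codes-∷ (codes-tail q))))
          (computes-pair (use h) g _
            (trans (cong π₂ (body-of {J} p)) (π₂-pair _ _)) (codes-∷ (codes-∷ (codes-tail q)))))
    by-cases (mu f) v p q with select {v = dhist t ∷ t ∷ []} (tag-of {J} p) step
    ... | h , hs = ⇓mu below (computes-pair (use h) f _ (body-of {J} p) (codes-∷ q))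
      where
      below : ∀ i → i < π₂ (π₂ J) → ∃[ k ] f [ i ∷ v ]⇓ suc k
      below i i<y with hs i i<y
      ... | u , u<t , b , e₁ , e₂ , pos =
        pred (π₂ (π₂ (π₁ u))) ,
        subst (f [ i ∷ v ]⇓_) (sym (suc-pred _ {{>-nonZero pos}}))
          (ih′ u<t b f (i ∷ v) (trans e₁ (body-of {J} p)) (codes-subst (sym e₂) (codes-∷ q)))

Derivable : ℕ → Set
Derivable J = ∃[ t ] (Derived t × π₁ t ≡ J)

judgement : ℕ → ℕ → ℕ → ℕ
judgement c e y = pair c (pair e y)

record Shape (t c e y : ℕ) : Set where
  field
    prog≡ : π₁ (π₁ t) ≡ c
    env≡ : π₁ (π₂ (π₁ t)) ≡ e
    val≡ : π₂ (π₂ (π₁ t)) ≡ y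

shape : ∀ {t c e y} → π₁ t ≡ judgement c e y → Shape t c e y
shape {t} {c} {e} {y} p = record
  { prog≡ = trans (cong π₁ p) (π₁-pair _ _)
  ; env≡ = trans (cong π₁ r) (π₁-pair _ _)
  ; val≡ = trans (cong π₂ r) (π₂-pair _ _) }
  where
  r : π₂ (π₁ t) ≡ pair e y
  r = trans (cong π₂ p) (π₂-pair _ _)

derive : ∀ {J} N → (∀ t → N ≤ t → π₁ t ≡ J → Holds stepFm (dhist t ∷ t ∷ [])) → Derivable J
derive {J} N h = pair J N , ⇒derived _ (h (pair J N) (n≤pair J N) (π₁-pair J N)) , π₁-pair J N

bound-below : ∀ {P : ℕ → ℕ → Set} m → (∀ i → i < m → ∃[ t ] P i t) →
              ∃[ N ] (∀ i → i < m → ∃[ t ] (t < N × P i t))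
bound-below zero h = 0 , λ _ ()
bound-below (suc m) h with bound-below m (λ i p → h i (m<n⇒m<1+n p)) | h m ≤-refl
... | N , hN | t , pt = suc N + suc t , λ i p → go i (m≤n⇒m<n∨m≡n (s≤s⁻¹ p))
  where
  go : ∀ i → i < m ⊎ i ≡ m → _
  go i (inj₁ p) with hN i p
  ... | u , u<N , pu = u , <-≤-trans u<N (≤-trans (n≤1+n N) (m≤m+n (suc N) (suc t))) , pu
  go i (inj₂ refl) = t , m≤n+m (suc t) (suc N) , pt

derived-at : ∀ {t K} → ∃[ u ] (u < t × Derived u × π₁ u ≡ K) → Holds derivedFm (dhist t ∷ t ∷ K ∷ [])
derived-at (u , u<t , d , e) = u , u<t , derived⇒look u<t d , e

complete : ∀ {n} {f : PR n} {v y} → f [ v ]⇓ y → ∀ e → Codes e v → Derivable (judgement (gödel f) e y)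
complete* : ∀ {n m} {gs : Vec (PR n) m} {v ys} → Pointwise (λ g z → g [ v ]⇓ z) gs ys → ∀ e → Codes e v →
            ∀ i → Derivable (judgement (gödel (lookup gs i)) e (lookup ys i))
complete* (d ∷ ds) e q zero = complete d e q
complete* (d ∷ ds) e q (suc i) = complete* ds e q i
complete ⇓zer e q = derive 0 λ t _ p → let open Shape (shape {t} p) in
  inj₁ (tag-of prog≡ , val≡)
complete ⇓succ e q = derive 0 λ t _ p → let open Shape (shape {t} p) in
  inj₂ (inj₁ (tag-of prog≡ , trans val≡ (cong suc (sym (trans (cong π₁ env≡) (at q zero))))))
complete (⇓proj i) e q = derive 0 λ t _ p → let open Shape (shape {t} p) in
  inj₂ (inj₂ (inj₁ (tag-of prog≡ ,
    trans val≡ (sym (trans (cong₂ nth env≡ (body-of prog≡)) (at q i))))))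
complete (⇓comp {m = m} {f = f} {gs = gs} {v = v} {ys = ys} {y = y} ds d) e q
  with encode m (λ i → nth (Vec.foldr′ pair 0 ys) i)
... | e′ , he = derive (N + suc u) λ t N≤t p →
  let open Shape (shape {t} p)
      body≡ = body-of {π₁ t} prog≡
      rest≡ = trans (cong π₂ body≡) (π₂-pair _ _)
      open Shape (shape {u} pu) renaming (prog≡ to uprog≡; env≡ to uenv≡; val≡ to uval≡)
      u<t = ≤-trans (m≤n+m (suc u) N) N≤t
  in inj₂ (inj₂ (inj₂ (inj₁ (tag-of prog≡ ,
     u , u<t , derived⇒look u<t du ,
     trans uprog≡ (sym (trans (cong π₁ body≡) (π₁-pair _ _))) ,
     trans uval≡ (sym val≡) ,
     λ i i<m → let i<m′ = subst (i <_) (trans (cong π₁ rest≡) (π₁-pair _ _)) i<m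
                   (w , w<N , dw , pw) = hN i i<m′
       in derived-at (w , ≤-trans w<N (≤-trans (m≤m+n N _) N≤t) , dw ,
            trans pw (cong₂ pair (cong (λ c → nth c i) (sym (trans (cong π₂ rest≡) (π₂-pair _ _))))
              (cong₂ pair (sym env≡) (cong (λ c → nth c i) (sym uenv≡)))))))))
  where
  codes-ys : ∀ {k} (ys : Vec ℕ k) → Codes (Vec.foldr′ pair 0 ys) ys
  codes-ys [] = codes λ ()
  codes-ys (y ∷ ys) = codes-∷ (codes-ys ys)
  q′ : Codes e′ ys
  q′ = codes λ i → trans (he (toℕ i) (toℕ<n i)) (at (codes-ys ys) i)
  fd : Derivable (judgement (gödel f) e′ y)
  fd = complete d e′ q′
  u = proj₁ fd
  du = proj₁ (proj₂ fd)
  pu = proj₂ (proj₂ fd)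
  args : ∀ i → i < m → ∃[ t ] (Derived t × π₁ t ≡ judgement (nth (gödel* gs) i) e (nth e′ i))
  args i i<m with complete* ds e q (fromℕ< i<m)
  ... | w , dw , pw = w , dw , trans pw (cong₂ (λ a b → judgement a e b)
    (sym (subst (λ z → nth (gödel* gs) z ≡ gödel (lookup gs (fromℕ< i<m))) (toℕ-fromℕ< i<m) (nth-gödel* gs (fromℕ< i<m))))
    (sym (subst (λ z → nth e′ z ≡ lookup ys (fromℕ< i<m)) (toℕ-fromℕ< i<m) (at q′ (fromℕ< i<m)))))
  bounded = bound-below m args
  N = proj₁ bounded
  hN = proj₂ bounded
complete (⇓prec₀ {f = f} {g = g} d) e q with complete d (π₂ e) (codes-tail q)
... | u , du , pu = derive (suc u) λ t N≤t p →
  let open Shape (shape {t} p)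
      body≡ = body-of {π₁ t} prog≡
  in inj₂ (inj₂ (inj₂ (inj₂ (inj₁ (tag-of prog≡ , inj₁ (trans (cong π₁ env≡) (at q zero) ,
    derived-at (u , N≤t , du , trans pu (cong₂ pair (sym (trans (cong π₁ body≡) (π₁-pair _ _)))
      (cong₂ pair (cong π₂ (sym env≡)) (sym val≡))))))))))
complete (⇓precₛ {f = f} {g = g} {k = k} {r = r} d d′) e q
  with complete d (pair k (π₂ e)) (codes-∷ (codes-tail q))
     | complete d′ (pair k (pair r (π₂ e))) (codes-∷ (codes-∷ (codes-tail q)))
... | u , du , pu | w , dw , pw = derive (suc u + suc w) λ t N≤t p →
  let open Shape (shape {t} p)
      body≡ = body-of {π₁ t} prog≡
      open Shape (shape {u} pu) renaming (prog≡ to uprog≡; env≡ to uenv≡; val≡ to uval≡)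
      u<t = ≤-trans (m≤m+n (suc u) (suc w)) N≤t
      head≡ = trans (cong π₁ env≡) (at q zero)
  in inj₂ (inj₂ (inj₂ (inj₂ (inj₁ (tag-of prog≡ , inj₂ (k , subst (k <_) (sym head≡) (n<1+n k) , sym head≡ ,
    u , u<t , derived⇒look u<t du , trans uprog≡ (sym prog≡) ,
    trans uenv≡ (cong (λ z → pair k (π₂ z)) (sym env≡)) ,
    derived-at (w , ≤-trans (m≤n+m (suc w) (suc u)) N≤t , dw ,
      trans pw (cong₂ pair (sym (trans (cong π₂ body≡) (π₂-pair _ _)))
        (cong₂ pair (cong (pair k) (cong₂ pair (sym uval≡) (cong π₂ (sym env≡)))) (sym val≡))))))))))
complete (⇓mu {f = f} {v = v} {y = y} ds d) e q with complete d (pair y e) (codes-∷ q)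
... | u , du , pu = derive (suc u + N) λ t N≤t p →
  let open Shape (shape {t} p)
  in inj₂ (inj₂ (inj₂ (inj₂ (inj₂ (tag-of prog≡ ,
    derived-at (u , ≤-trans (m≤m+n (suc u) N) N≤t , du ,
      trans pu (cong₂ pair (sym (body-of prog≡)) (cong (λ z → pair z 0) (cong₂ pair (sym val≡) (sym env≡))))) ,
    λ i i<y → let (w , w<N , z , dw , pw) = hN i (subst (i <_) val≡ i<y)
                  open Shape (shape {w} pw) renaming (prog≡ to wprog≡; env≡ to wenv≡; val≡ to wval≡)
                  w<t = ≤-trans w<N (≤-trans (m≤n+m N (suc u)) N≤t)
      in w , w<t , derived⇒look w<t dw , trans wprog≡ (sym (body-of prog≡)) ,
         trans wenv≡ (cong (pair i) (sym env≡)) , subst (0 <_) (sym wval≡) (s≤s z≤n))))))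
  where
  below : ∀ i → i < y → ∃[ w ] ∃[ z ] (Derived w × π₁ w ≡ judgement (gödel f) (pair i e) (suc z))
  below i i<y with ds i i<y
  ... | z , dz with complete dz (pair i e) (codes-∷ q)
  ... | w , dw , pw = w , z , dw , pw
  bounded = bound-below y below
  N = proj₁ bounded
  hN = proj₂ bounded

-- W e x y n : the e-th s-operator has the axiom ⟨ x , y ⟩ before stage n, where y is a condition in the sense of _∈⁺_.
-- Stage t derives at most the judgement π₁ t, hence the bound t < n.
opaque
  WFm : Fm 4
  WFm = ∃ᶠ #3 (app dbitF (#0 ∷ []) ≈ᶠ lit 1 ∧ᶠ Prog (Fst #0) ≈ᶠ #1 ∧ᶠ Env (Fst #0) ≈ᶠ Pair #2 (Pair #3 (lit 0)))

  W : ℕ → ℕ → ℕ → ℕ → Set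
  W e x y n = Holds WFm (e ∷ x ∷ y ∷ n ∷ [])

  W⇒ : ∀ {e x y n} → W e x y n → Holds WFm (e ∷ x ∷ y ∷ n ∷ [])
  W⇒ w = w

  ⇒W : ∀ {e x y n} → Holds WFm (e ∷ x ∷ y ∷ n ∷ []) → W e x y n
  ⇒W w = w

  W-mono : ∀ {e x y m n} → m ≤ n → W e x y m → W e x y n
  W-mono m≤n (t , t<m , h) = t , ≤-trans t<m m≤n , h

  W-sound : ∀ (f : PR 2) {x y n} → W (gödel f) x y n → f ↓ (x ∷ y ∷ [])
  W-sound f {x} {y} (t , _ , d , e₁ , e₂) =
    _ , sound t d f (x ∷ y ∷ []) e₁ (codes-subst (sym e₂) (codes-∷ (codes-∷ (codes λ ()))))

  W-complete : ∀ (f : PR 2) {x y} → f ↓ (x ∷ y ∷ []) → ∃[ n ] W (gödel f) x y n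
  W-complete f {x} {y} (z , d) with complete d (pair x (pair y 0)) (codes-∷ (codes-∷ (codes λ ())))
  ... | t , dt , p = suc t , t , ≤-refl , dt , prog≡ , env≡
    where open Shape (shape {t} p)

-- Unbounded search and determinism of computations

least : ∀ {P : ℕ → Set} → (∀ n → Dec (P n)) → ∀ n → P n → ∃[ m ] (P m × ∀ i → i < m → ¬ P i)
least {P} P? = <-rec _ go
  where
  go : ∀ n → (∀ {k} → k < n → P k → ∃[ m ] (P m × ∀ i → i < m → ¬ P i)) → P n → ∃[ m ] (P m × ∀ i → i < m → ¬ P i)
  go n rec p with anyUpTo? P? n
  ... | yes (k , k<n , q) = rec k<n q
  ... | no none = n , p , λ i i<n q → none (i , i<n , q)

deterministic : ∀ {n} {f : PR n} {v y z} → f [ v ]⇓ y → f [ v ]⇓ z → y ≡ z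
deterministic* : ∀ {n m} {gs : Vec (PR n) m} {v ys zs} → Pointwise (λ g z → g [ v ]⇓ z) gs ys →
                 Pointwise (λ g z → g [ v ]⇓ z) gs zs → ys ≡ zs
deterministic* [] [] = refl
deterministic* (c ∷ cs) (d ∷ ds) = cong₂ _∷_ (deterministic c d) (deterministic* cs ds)
deterministic ⇓zer ⇓zer = refl
deterministic ⇓succ ⇓succ = refl
deterministic (⇓proj i) (⇓proj .i) = refl
deterministic (⇓comp cs c) (⇓comp ds d) with deterministic* cs ds
... | refl = deterministic c d
deterministic (⇓prec₀ c) (⇓prec₀ d) = deterministic c d
deterministic (⇓precₛ c c′) (⇓precₛ d d′) with deterministic c d
... | refl = deterministic c′ d′
deterministic (⇓mu {y = y} cs c) (⇓mu {y = z} ds d) with <-cmp y z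
... | tri≈ _ y≡z _ = y≡z
... | tri< y<z _ _ with deterministic c (proj₂ (ds y y<z))
...   | ()
deterministic (⇓mu {y = y} cs c) (⇓mu {y = z} ds d) | tri> _ _ z<y with deterministic (proj₂ (cs z z<y)) d
...   | ()

searchPR : ∀ {n} → Fm (suc n) → PR n
searchPR φ = mu (comp notPR (fmPR φ ∷ []))

search-⇔ : ∀ {n} (φ : Fm (suc n)) v → (∃[ k ] Holds φ (k ∷ v)) ⇔ searchPR φ ↓ v
search-⇔ φ v = mk⇔ to from
  where
  to : (∃[ k ] Holds φ (k ∷ v)) → searchPR φ ↓ v
  to (k , h) with least (λ i → holds? φ (i ∷ v)) k h
  ... | m , hm , below = m , ⇓mu (λ i i<m → 0 , fails i (below i i<m)) (succeeds hm)
    where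
    succeeds : ∀ {i} → Holds φ (i ∷ v) → comp notPR (fmPR φ ∷ []) [ i ∷ v ]⇓ 0
    succeeds {i} h with not-Decides (fm-Decides φ (i ∷ v))
    ... | inj₁ (¬h , _) = ⊥-elim (¬h h)
    ... | inj₂ (_ , c) = c
    fails : ∀ i → ¬ Holds φ (i ∷ v) → comp notPR (fmPR φ ∷ []) [ i ∷ v ]⇓ 1
    fails i ¬h with not-Decides (fm-Decides φ (i ∷ v))
    ... | inj₁ (_ , c) = c
    ... | inj₂ (¬¬h , _) = ⊥-elim (¬¬h ¬h)
  not⇓0 : ∀ {z} → notPR [ z ∷ [] ]⇓ 0 → ∃[ y ] z ≡ suc y
  not⇓0 {zero} (⇓prec₀ (⇓comp (⇓zer ∷ []) ()))
  not⇓0 {suc z} _ = z , refl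
  from : searchPR φ ↓ v → ∃[ k ] Holds φ (k ∷ v)
  from (k , ⇓mu _ (⇓comp (d ∷ []) e)) with not⇓0 e | fm-Decides φ (k ∷ v)
  ... | y , refl | inj₁ (h , _) = k , h
  ... | y , refl | inj₂ (_ , c) with deterministic c d
  ... | ()

ce : ∀ {A : Subset} (φ : Fm 2) → (∀ x → A x ⇔ (∃[ k ] Holds φ (k ∷ x ∷ []))) → CE A
ce φ h = searchPR φ , λ x → mk⇔ (λ a → Equivalence.to (search-⇔ φ _) (Equivalence.to (h x) a))
                                 (λ d → Equivalence.from (h x) (Equivalence.from (search-⇔ φ _) d))

computable : ∀ {n} (φ : Fm n) → Computable (Holds φ)
computable φ = fmPR φ , fm-Decides φ

-- Canonical indices and a normal form for s-operators

bit-zero : ∀ u → D⟨ u ⟩ 0 ⇔ u % 2 ≡ 1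
bit-zero u = mk⇔ (subst (λ w → w % 2 ≡ 1) (n/1≡n u)) (subst (λ w → w % 2 ≡ 1) (sym (n/1≡n u)))

bit-suc : ∀ u x → D⟨ u ⟩ (suc x) ⇔ D⟨ u / 2 ⟩ x
bit-suc u x = mk⇔ (subst (λ w → w % 2 ≡ 1) (sym eq)) (subst (λ w → w % 2 ≡ 1) eq)
  where
  instance
    nz : NonZero (2 ^ x)
    nz = m^n≢0 2 x
    nz′ : NonZero (2 ^ suc x)
    nz′ = m^n≢0 2 (suc x)
  eq : u / 2 / 2 ^ x ≡ u / 2 ^ suc x
  eq = m/n/o≡m/[n*o] u 2 (2 ^ x)

open Equivalence

even : ∀ u → ¬ (u % 2 ≡ 1) → u ≡ u / 2 * 2
even u ¬1 with u % 2 in e | m%n<n u 2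
... | zero | _ = trans (m≡m%n+[m/n]*n u 2) (cong (_+ u / 2 * 2) e)
... | suc zero | _ = ⊥-elim (¬1 refl)
... | suc (suc _) | s≤s (s≤s ())

D-empty : ∀ u → Empty D⟨ u ⟩ → u ≡ 0
D-empty = <-rec _ go
  where
  go : ∀ u → (∀ {w} → w < u → Empty D⟨ w ⟩ → w ≡ 0) → Empty D⟨ u ⟩ → u ≡ 0
  go zero rec h = refl
  go (suc u) rec h = trans (even (suc u) (λ e → h 0 (from (bit-zero (suc u)) e))) (cong (_* 2) half)
    where
    half : suc u / 2 ≡ 0
    half = rec (m/n<m (suc u) 2 ≤-refl) (λ x d → h (suc x) (from (bit-suc (suc u) x) d))

D-singleton : ∀ y u → (∀ x → D⟨ u ⟩ x ⇔ y ≡ x) → u ≡ 2 ^ y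
D-singleton zero u h = begin
  u ≡⟨ m≡m%n+[m/n]*n u 2 ⟩
  u % 2 + u / 2 * 2 ≡⟨ cong₂ (λ a b → a + b * 2) (to (bit-zero u) (from (h 0) refl))
     (D-empty (u / 2) (λ x d → 0≢1+n (to (h (suc x)) (from (bit-suc u x) d)))) ⟩
  1 ∎
  where open ≡-Reasoning
D-singleton (suc y) u h = begin
  u ≡⟨ even u (λ e → 1+n≢0 (to (h 0) (from (bit-zero u) e))) ⟩
  u / 2 * 2 ≡⟨ cong (_* 2) (D-singleton y (u / 2) half) ⟩
  2 ^ y * 2 ≡⟨ *-comm (2 ^ y) 2 ⟩
  2 ^ suc y ∎
  where
  open ≡-Reasoning
  half : ∀ x → D⟨ u / 2 ⟩ x ⇔ y ≡ x
  half x = mk⇔ (λ d → suc-injective (to (h (suc x)) (from (bit-suc u x) d)))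
               (λ e → to (bit-suc u x) (from (h (suc x)) (cong suc e)))

D-0 : Empty D⟨ 0 ⟩
D-0 zero ()
D-0 (suc x) d = D-0 x (to (bit-suc 0 x) d)

D-2^ : ∀ y x → D⟨ 2 ^ y ⟩ x ⇔ y ≡ x
D-2^ zero zero = mk⇔ (λ _ → refl) (λ _ → refl)
D-2^ zero (suc x) = mk⇔ (λ d → ⊥-elim (D-0 x (to (bit-suc 1 x) d))) (λ ())
D-2^ (suc y) zero = mk⇔ (λ d → ⊥-elim (0≢1+n (trans (sym (trans (cong (_% 2) (*-comm 2 (2 ^ y))) (m*n%n≡0 (2 ^ y) 2))) (to (bit-zero (2 ^ suc y)) d)))) (λ ())
D-2^ (suc y) (suc x) = mk⇔
  (λ d → cong suc (to (D-2^ y x) (subst (λ w → D⟨ w ⟩ x) half (to (bit-suc (2 ^ suc y) x) d))))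
  (λ e → from (bit-suc (2 ^ suc y) x) (subst (λ w → D⟨ w ⟩ x) (sym half) (from (D-2^ y x) (suc-injective e))))
  where
  half : 2 ^ suc y / 2 ≡ 2 ^ y
  half = trans (cong (_/ 2) (*-comm 2 (2 ^ y))) (m*n/n≡m (2 ^ y) 2)

-- A condition on an oracle: 0 is the empty condition, suc e asks for membership of e.
infix 4 _∈⁺_
_∈⁺_ : ℕ → Subset → Set
y ∈⁺ B = y ≡ 0 ⊎ ∃[ e ] (y ≡ suc e × B e)

index : ℕ → ℕ
index zero = 0
index (suc e) = 2 ^ e

indexF : Fn 1
indexF = reFn (precF (tmF (lit 0)) (tmF (app powF (#0 ∷ [])))) (λ { (y ∷ []) → index y })
  λ { (zero ∷ []) → refl ; (suc e ∷ []) → refl }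
  where
  powF : Fn 1
  powF = reFn (precF (tmF (lit 1)) (tmF (app plusF (#1 ∷ app plusF (#1 ∷ lit 0 ∷ []) ∷ [])))) (λ { (y ∷ []) → 2 ^ y }) eq
    where
    eq : ∀ v → _ ≡ _
    eq (zero ∷ []) = refl
    eq (suc k ∷ []) = cong (λ z → z + (z + 0)) (eq (k ∷ []))

index-⊆ : ∀ {B} y → (D⟨ index y ⟩ ⊆ B) ⇔ y ∈⁺ B
index-⊆ {B} zero = mk⇔ (λ _ → inj₁ refl) (λ _ {x} d → ⊥-elim (D-0 x d))
index-⊆ {B} (suc e) = mk⇔ (λ h → inj₂ (e , refl , h (from (D-2^ e e) refl)))
  λ { (inj₂ (.e , refl , b)) {x} d → subst B (to (D-2^ e x) d) b }

index-shape : ∀ u → Empty D⟨ u ⟩ ⊎ (∃[ y ] D⟨ u ⟩ ≐ ｛ y ｝) → ∃[ y ] u ≡ index y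
index-shape u (inj₁ e) = 0 , D-empty u e
index-shape u (inj₂ (y , p , q)) = suc y , D-singleton y u (λ x → mk⇔ p q)

shape-index : ∀ y → Empty D⟨ index y ⟩ ⊎ (∃[ z ] D⟨ index y ⟩ ≐ ｛ z ｝)
shape-index zero = inj₁ D-0
shape-index (suc e) = inj₂ (e , (λ {x} → to (D-2^ e x)) , (λ {x} → from (D-2^ e x)))

code-operator : ∀ {Φ} → (∀ x u → Φ (x , u) → Empty D⟨ u ⟩ ⊎ (∃[ y ] D⟨ u ⟩ ≐ ｛ y ｝)) →
  (f : PR 2) → (∀ x y → Φ (x , index y) ⇔ f ↓ (x ∷ y ∷ [])) →
  ∀ B x → (Φ ⟦ B ⟧) x ⇔ (∃₂ λ y n → W (gödel f) x y n × y ∈⁺ B)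
code-operator {Φ} sh f hf B x = mk⇔ to′ from′
  where
  to′ : (Φ ⟦ B ⟧) x → ∃₂ λ y n → W (gödel f) x y n × y ∈⁺ B
  to′ (u , φ , d) with index-shape u (sh x u φ)
  ... | y , refl with W-complete f {x} {y} (to (hf x y) φ)
  ... | n , w = y , n , w , to (index-⊆ y) d
  from′ : (∃₂ λ y n → W (gödel f) x y n × y ∈⁺ B) → (Φ ⟦ B ⟧) x
  from′ (y , n , w , b) = index y , from (hf x y) (W-sound f {x} {y} {n} w) , from (index-⊆ y) b

-- Precomposition with `index` replaces canonical indices by conditions. A condition asks about at
-- most one element, so every index `e` describes an s-operator and none has to be filtered out of
-- the list.
s-index : ∀ {Φ} → IsSOperator Φ → ∃[ e ] (∀ B x → (Φ ⟦ B ⟧) x ⇔ (∃₂ λ y n → W e x y n × y ∈⁺ B))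
s-index {Φ} ((f , hf) , sh) = gödel f′ , code-operator sh f′ (λ x y → mk⇔ (to′ x y) (from′ x y))
  where
  f′ : PR 2
  f′ = comp f (proj zero ∷ tmPR (app indexF (#1 ∷ [])) ∷ [])
  to′ : ∀ x y → Φ (x , index y) → f′ ↓ (x ∷ y ∷ [])
  to′ x y φ with to (hf x (index y)) φ
  ... | z , c = z , ⇓comp (⇓proj zero ∷ tm-⇓ (app indexF (#1 ∷ [])) (x ∷ y ∷ []) ∷ []) c
  from′ : ∀ x y → f′ ↓ (x ∷ y ∷ []) → Φ (x , index y)
  from′ x y (z , ⇓comp (⇓proj .zero ∷ (c ∷ [])) d) with deterministic c (tm-⇓ (app indexF (#1 ∷ [])) (x ∷ y ∷ []))
  ... | refl = from (hf x (index y)) (z , d)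

≤ₛ-index : ∀ {A B} → A ≤ₛ B → ∃[ e ] (∀ x → A x ⇔ (∃₂ λ y n → W e x y n × y ∈⁺ B))
≤ₛ-index {A} {B} (Φ , s , p , q) with s-index s
... | e , h = e , λ x → mk⇔ (λ a → to (h B x) (p a)) (λ w → q (from (h B x) w))

-- The tool for building reductions, converse to `≤ₛ-index`: the stage `n` and the condition `y` are
-- searched for together, as one number `pair n y`.
≤ₛ-fm : ∀ {A B : Subset} (φ : Fm 3) → (∀ x → A x ⇔ (∃₂ λ y n → Holds φ (n ∷ x ∷ y ∷ []) × y ∈⁺ B)) → A ≤ₛ B
≤ₛ-fm {A} {B} φ h = Φ , ((searchPR ψ , λ x u → search-⇔ ψ (x ∷ u ∷ [])) , sh) ,
  (λ {x} a → to′ x (to (h x) a)) , (λ {x} d → from (h x) (from′ x d))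
  where
  ψ : Fm 3
  ψ = app indexF (Snd #0 ∷ []) ≈ᶠ #2 ∧ᶠ call φ (Fst #0 ∷ #1 ∷ Snd #0 ∷ [])
  Φ : Pred (ℕ × ℕ) 0ℓ
  Φ (x , u) = ∃[ k ] Holds ψ (k ∷ x ∷ u ∷ [])
  sh : ∀ x u → Φ (x , u) → Empty D⟨ u ⟩ ⊎ (∃[ y ] D⟨ u ⟩ ≐ ｛ y ｝)
  sh x u (k , refl , _) = shape-index (π₂ k)
  to′ : ∀ x → (∃₂ λ y n → Holds φ (n ∷ x ∷ y ∷ []) × y ∈⁺ B) → (Φ ⟦ B ⟧) x
  to′ x (y , n , hφ , b) = index y , (pair n y , cong index (π₂-pair n y) ,
    subst₂ (λ a b → Holds φ (a ∷ x ∷ b ∷ [])) (sym (π₁-pair n y)) (sym (π₂-pair n y)) hφ) , from (index-⊆ y) b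
  from′ : ∀ x → (Φ ⟦ B ⟧) x → ∃₂ λ y n → Holds φ (n ∷ x ∷ y ∷ []) × y ∈⁺ B
  from′ x (u , (k , refl , hφ) , d) = π₂ k , π₁ k , hφ , to (index-⊆ (π₂ k)) d

-- The construction

-- A node of the tree of outcomes is coded by its address ⟨ length , components ⟩; component i is
-- the outcome at level i: 0 (the element has left A), 1 + j for j < i (elements carry labels for
-- Φ j), or 1 + i (neither).
len : ℕ → ℕ
len a = π₁ a

cmp : ℕ → ℕ → ℕ
cmp a i = nth (π₂ a) i

address : ∀ n (f : ℕ → ℕ) → ∃[ a ] (len a ≡ n × (∀ i → i < n → cmp a i ≡ f i))
address n f with encode n f
... | c , h = pair n c , π₁-pair n c , λ i i<n → trans (cong (λ d → nth d i) (π₂-pair n c)) (h i i<n)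

-- Stage t codes a proposal: an address, an element (0 for the fresh element t) and two witnesses.
-- The padding in pair _ t makes every proposal recur at infinitely many stages.
element : ℕ → ℕ → ℕ
element zero t = t
element (suc a) t = a

adr el w₁ w₂ : ℕ → ℕ
adr t = π₁ (π₁ t)
el t = element (π₁ (π₂ (π₁ t))) t
w₁ t = π₁ (π₂ (π₂ (π₁ t)))
w₂ t = π₂ (π₂ (π₂ (π₁ t)))

proposal : ∀ a c u v N → let t = pair (pair a (pair c (pair u v))) N in
           N ≤ t × adr t ≡ a × el t ≡ element c t × w₁ t ≡ u × w₂ t ≡ v
proposal a c u v N =
  n≤pair (pair a (pair c (pair u v))) N , trans (cong π₁ e) (π₁-pair a _) , cong (λ d → element d t) (trans (cong π₁ e′) (π₁-pair c _)) ,
  trans (cong π₁ e″) (π₁-pair u v) , trans (cong π₂ e″) (π₂-pair u v)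
  where
  t = pair (pair a (pair c (pair u v))) N
  e : π₁ t ≡ pair a (pair c (pair u v))
  e = π₁-pair _ N
  e′ : π₂ (π₁ t) ≡ pair c (pair u v)
  e′ = trans (cong π₂ e) (π₂-pair a _)
  e″ : π₂ (π₂ (π₁ t)) ≡ pair u v
  e″ = trans (cong π₂ e′) (π₂-pair c _)

fresh : ∀ a N → ∃[ t ] (N ≤ t × adr t ≡ a × el t ≡ t)
fresh a N = let le , e , e′ , _ = proposal a 0 0 0 N in _ , le , e , e′

move : ∀ a c u v N → ∃[ t ] (N ≤ t × adr t ≡ a × el t ≡ c × w₁ t ≡ u × w₂ t ≡ v)
move a c u v N = _ , proposal a (suc c) u v N

elementF : Fn 2
fun  elementF (c ∷ t ∷ []) = element c t
prog elementF = prog (precF (tmF #0) (tmF #0))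
ok   elementF (zero ∷ t ∷ []) = ok (precF (tmF #0) (tmF #0)) (0 ∷ t ∷ [])
ok   elementF (suc c ∷ t ∷ []) = ok (precF (tmF #0) (tmF #0)) (suc c ∷ t ∷ [])

Adr El W₁ W₂ : ∀ {n} → Tm n → Tm n
Adr t = Fst (Fst t)
El t = app elementF (Fst (Snd (Fst t)) ∷ t ∷ [])
W₁ t = Fst (Snd (Snd (Fst t)))
W₂ t = Snd (Snd (Snd (Fst t)))

Len : ∀ {n} → Tm n → Tm n
Len a = Fst a

Cmp : ∀ {n} → Tm n → Tm n → Tm n
Cmp a i = Nth (Snd a) i

infix 7 _≤ᶠ_
_≤ᶠ_ : ∀ {n} → Tm n → Tm n → Fm n
t ≤ᶠ u = t <ᶠ Suc u

-- The first variable of a formula that mentions alive entries is the history.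

opaque
  agreeFm : Fm 3
  agreeFm = ∀ᶠ #0 (Cmp #2 #0 ≈ᶠ Cmp #3 #0)

opaque
  lessFm : Fm 2
  lessFm = ∃ᶠ (Suc (Len #0)) (call agreeFm (#0 ∷ #1 ∷ #2 ∷ []) ∧ᶠ #0 <ᶠ Len #2 ∧ᶠ
    (#0 ≈ᶠ Len #1 ∨ᶠ (#0 <ᶠ Len #1 ∧ᶠ Cmp #1 #0 <ᶠ Cmp #2 #0)))

opaque
  strictFm : Fm 2
  strictFm = Len #0 <ᶠ Len #1 ∧ᶠ call agreeFm (Len #0 ∷ #0 ∷ #1 ∷ [])

opaque
  aliveFm : Fm 3
  aliveFm = #1 <ᶠ #2 ∧ᶠ Bit #0 #1 ∧ᶠ
    ∀ᶠ #2 (#2 <ᶠ #0 ⇒ᶠ Bit #1 #0 ⇒ᶠ call lessFm (Adr #2 ∷ Adr #0 ∷ []))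

opaque
  doneFm : Fm 1
  doneFm = ∃ᶠ (Len #0) (Len #1 ≈ᶠ Suc #0 ∧ᶠ Cmp #1 #0 ≈ᶠ lit 0)

opaque
  liveFm : Fm 1
  liveFm = ∃ᶠ (Len #0) (Len #1 ≈ᶠ Suc #0 ∧ᶠ lit 0 <ᶠ Cmp #1 #0)

opaque
  notKilledFm : Fm 3
  notKilledFm = ∀ᶠ #1 (Cmp #1 #0 ≈ᶠ Suc #3 ⇒ᶠ #0 ≤ᶠ #3)

opaque
  remFm : Fm 2
  remFm = ∃ᶠ (Len #0) (Len #1 ≈ᶠ Suc #0 ∧ᶠ lit 0 <ᶠ Cmp #1 #0 ∧ᶠ
    ¬ᶠ (Suc #2 <ᶠ Cmp #1 #0 ∧ᶠ call notKilledFm (#1 ∷ #0 ∷ #2 ∷ [])))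

opaque
  codeFm : Fm 2
  codeFm = call WFm (Fst #1 ∷ Fst (Snd #1) ∷ Suc (Pair #0 (lit 0)) ∷ Snd (Snd #1) ∷ [])

opaque
  labFm : Fm 4
  labFm = ∃ᶠ #3 (Fst #0 ≈ᶠ #2 ∧ᶠ call codeFm (#3 ∷ #0 ∷ []) ∧ᶠ
    call WFm (#1 ∷ Pair #3 (lit 0) ∷ Suc (Pair #3 (Suc #0)) ∷ #4 ∷ []))

opaque
  inFm : Fm 3
  inFm = ∃ᶠ #2 (call aliveFm (#1 ∷ #0 ∷ #3 ∷ []) ∧ᶠ El #0 ≈ᶠ #2)

opaque
  outFm : Fm 3
  outFm = ∃ᶠ #2 (call aliveFm (#1 ∷ #0 ∷ #3 ∷ []) ∧ᶠ El #0 ≈ᶠ #2 ∧ᶠ call doneFm (Adr #0 ∷ []))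

opaque
  removedFm : Fm 5
  removedFm = ∃ᶠ #4 (∃ᶠ #5 (call aliveFm (#2 ∷ #1 ∷ #6 ∷ []) ∧ᶠ call aliveFm (#2 ∷ #0 ∷ #6 ∷ []) ∧ᶠ
    El #1 ≈ᶠ #3 ∧ᶠ call strictFm (Adr #1 ∷ Adr #0 ∷ []) ∧ᶠ call remFm (Adr #1 ∷ #4 ∷ []) ∧ᶠ #5 <ᶠ #0))

opaque
  xFm : Fm 3
  xFm = (Snd #2 ≈ᶠ lit 0 ∧ᶠ call outFm (#0 ∷ Fst #2 ∷ #1 ∷ [])) ∨ᶠ
    ∃ᶠ (Snd #2) (Snd #3 ≈ᶠ Suc #0 ∧ᶠ (¬ᶠ call codeFm (Fst #3 ∷ #0 ∷ []) ∨ᶠ call outFm (#1 ∷ Fst #3 ∷ #2 ∷ []) ∨ᶠ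
      call removedFm (#1 ∷ Fst #3 ∷ Fst #0 ∷ Snd (Snd #0) ∷ #2 ∷ [])))

opaque
  yFm : Fm 3
  yFm = (Snd #2 ≈ᶠ lit 0 ∧ᶠ Fst #2 <ᶠ #1 ∧ᶠ ¬ᶠ call inFm (#0 ∷ Fst #2 ∷ #1 ∷ [])) ∨ᶠ
    (lit 0 <ᶠ Snd #2 ∧ᶠ ∃ᶠ #1 (Bit #1 #0 ∧ᶠ call doneFm (Adr #0 ∷ []) ∧ᶠ lit 0 <ᶠ W₂ #0 ∧ᶠ W₁ #0 ≈ᶠ #3))

opaque
  eFm : Fm 3
  eFm = ¬ᶠ (∃ᶠ (Suc #1) (call xFm (#1 ∷ #0 ∷ #3 ∷ [])) ∧ᶠ ¬ᶠ ∃ᶠ (Suc #1) (call yFm (#1 ∷ #0 ∷ #3 ∷ [])))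

opaque
  nonIgFm : Fm 5
  nonIgFm = ∀ᶠ (Snd #4) (Snd #5 ≈ᶠ Suc #0 ⇒ᶠ ∀ᶠ #2 (call aliveFm (#2 ∷ #0 ∷ #3 ∷ []) ⇒ᶠ El #0 ≈ᶠ Fst #6 ⇒ᶠ
    Len (Adr #0) ≤ᶠ #5 ⇒ᶠ call agreeFm (Len (Adr #0) ∷ Adr #0 ∷ #4 ∷ []) ⇒ᶠ
    ¬ᶠ call remFm (Adr #0 ∷ Fst #1 ∷ [])))

opaque
  secFm : Fm 5
  secFm = #4 ≈ᶠ lit 0 ∨ᶠ ∃ᶠ #4 (#5 ≈ᶠ Suc #0 ∧ᶠ Fst #0 <ᶠ #2 ∧ᶠ call eFm (#1 ∷ #2 ∷ #0 ∷ []) ∧ᶠ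
    call nonIgFm (#1 ∷ #2 ∷ #3 ∷ #4 ∷ #0 ∷ []))

opaque
  slotFm : Fm 5
  slotFm = Len #2 ≈ᶠ Suc #4 ∧ᶠ
    ∀ᶠ (Suc #4) (lit 0 <ᶠ #0 ⇒ᶠ ∃ᶠ #2 (call aliveFm (#2 ∷ #0 ∷ #3 ∷ []) ∧ᶠ Len (Adr #0) ≈ᶠ #1 ∧ᶠ
      call agreeFm (#1 ∷ Adr #0 ∷ #4 ∷ []))) ∧ᶠ
    ∀ᶠ #1 (call aliveFm (#1 ∷ #0 ∷ #2 ∷ []) ⇒ᶠ
      ¬ᶠ (Len (Adr #0) ≈ᶠ Len #3 ∧ᶠ call agreeFm (Len (Adr #0) ∷ Adr #0 ∷ #3 ∷ []))) ∧ᶠ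
    ∀ᶠ (Suc #4)
      ((Cmp #3 #0 ≤ᶠ Suc #0 ∧ᶠ ∀ᶠ (Cmp #3 #0) (Cmp #4 #1 ≈ᶠ Suc #0 ⇒ᶠ #0 <ᶠ #1 ⇒ᶠ
         call notKilledFm (#4 ∷ #1 ∷ #0 ∷ []) ∧ᶠ call labFm (#1 ∷ #0 ∷ #5 ∷ #3 ∷ []))) ∧ᶠ
       (lit 0 <ᶠ Cmp #3 #0 ⇒ᶠ ∀ᶠ #2 (call aliveFm (#2 ∷ #0 ∷ #3 ∷ []) ⇒ᶠ
         ¬ᶠ (Len (Adr #0) ≈ᶠ Suc #1 ∧ᶠ call agreeFm (#1 ∷ Adr #0 ∷ #4 ∷ []) ∧ᶠ Cmp (Adr #0) #1 ≈ᶠ lit 0))))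

-- Variables: history, stage, last index of the address.
opaque
  placeFm : Fm 3
  placeFm = lit 0 <ᶠ Cmp (Adr #1) #2 ∧ᶠ (El #1 ≈ᶠ #1 ∨ᶠ ∃ᶠ #1 (call aliveFm (#1 ∷ #0 ∷ #2 ∷ []) ∧ᶠ
    El #0 ≈ᶠ El #2 ∧ᶠ call liveFm (Adr #0 ∷ []) ∧ᶠ call lessFm (Adr #2 ∷ Adr #0 ∷ [])))

opaque
  attackFm : Fm 3
  attackFm = Cmp (Adr #1) #2 ≈ᶠ lit 0 ∧ᶠ W₂ #1 ≈ᶠ lit 0 ∧ᶠ
    ∃ᶠ #1 (call aliveFm (#1 ∷ #0 ∷ #2 ∷ []) ∧ᶠ El #0 ≈ᶠ El #2 ∧ᶠ Len (Adr #0) ≈ᶠ Suc #3 ∧ᶠ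
      call agreeFm (#3 ∷ Adr #0 ∷ Adr #2 ∷ []) ∧ᶠ lit 0 <ᶠ Cmp (Adr #0) #3) ∧ᶠ
    call WFm (#2 ∷ Pair (El #1) (lit 0) ∷ W₁ #1 ∷ #1 ∷ []) ∧ᶠ
    call secFm (#0 ∷ #1 ∷ Adr #1 ∷ #2 ∷ W₁ #1 ∷ []) ∧ᶠ
    (W₁ #1 ≈ᶠ lit 0 ∨ᶠ ∃ᶠ (W₁ #1) (W₁ #2 ≈ᶠ Suc #0 ∧ᶠ lit 0 <ᶠ Snd #0 ∧ᶠ ¬ᶠ (Fst #0 ≈ᶠ El #2)))

opaque
  restoreFm : Fm 3
  restoreFm = Cmp (Adr #1) #2 ≈ᶠ lit 0 ∧ᶠ ∃ᶠ (W₂ #1) (W₂ #2 ≈ᶠ Suc #0 ∧ᶠ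
    call secFm (#1 ∷ #2 ∷ Adr #2 ∷ #3 ∷ #0 ∷ []) ∧ᶠ Fst (W₁ #2) ≈ᶠ El #2 ∧ᶠ
    ∃ᶠ (Snd (W₁ #2)) (Snd (W₁ #3) ≈ᶠ Suc #0 ∧ᶠ call codeFm (El #3 ∷ #0 ∷ []) ∧ᶠ
      call WFm (#4 ∷ Pair (El #3) (lit 0) ∷ Suc (W₁ #3) ∷ #3 ∷ []) ∧ᶠ
      call WFm (Fst #0 ∷ Fst (Snd #0) ∷ #1 ∷ #3 ∷ []) ∧ᶠ
      ∃ᶠ #3 (call aliveFm (#3 ∷ #0 ∷ #4 ∷ []) ∧ᶠ El #0 ≈ᶠ El #4 ∧ᶠ call doneFm (Adr #0 ∷ []) ∧ᶠ
        #5 <ᶠ Len (Adr #0) ∧ᶠ call agreeFm (#5 ∷ Adr #0 ∷ Adr #4 ∷ []) ∧ᶠ Cmp (Adr #0) #5 ≈ᶠ Suc (Fst #1))))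

opaque
  validFm : Fm 2
  validFm = ∃ᶠ (Len (Adr #1)) (call slotFm (#1 ∷ #2 ∷ Adr #2 ∷ El #2 ∷ #0 ∷ []) ∧ᶠ
    (call placeFm (#1 ∷ #2 ∷ #0 ∷ []) ∨ᶠ call attackFm (#1 ∷ #2 ∷ #0 ∷ []) ∨ᶠ call restoreFm (#1 ∷ #2 ∷ #0 ∷ [])))

open module Construction = History validFm

-- The order of addresses and the notions of the construction

Agree : ℕ → ℕ → ℕ → Set
Agree i a b = ∀ l → l < i → cmp a l ≡ cmp b l

infix 4 _≺_ _⊏_

-- Lexicographic order with proper initial segments first; `i` is the first difference, or the
-- length of `a`. Components beyond the length are junk, so addresses are compared by `Same` rather
-- than by equality.
_≺_ : ℕ → ℕ → Set
a ≺ b = ∃[ i ] (Agree i a b × i < len b × (i ≡ len a ⊎ (i < len a × cmp a i < cmp b i)))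

_⊏_ : ℕ → ℕ → Set
a ⊏ b = len a < len b × Agree (len a) a b

Same : ℕ → ℕ → Set
Same a b = len a ≡ len b × Agree (len a) a b

agree-sym : ∀ {i a b} → Agree i a b → Agree i b a
agree-sym h l p = sym (h l p)

agree-trans : ∀ {i a b c} → Agree i a b → Agree i b c → Agree i a c
agree-trans h h′ l p = trans (h l p) (h′ l p)

agree-≤ : ∀ {i j a b} → i ≤ j → Agree j a b → Agree i a b
agree-≤ i≤j h l p = h l (<-≤-trans p i≤j)

same-sym : ∀ {a b} → Same a b → Same b a
same-sym {a} {b} (e , h) = sym e , agree-sym {a = a} {b} (subst (λ n → Agree n a b) e h)

⊏⇒≺ : ∀ {a b} → a ⊏ b → a ≺ b
⊏⇒≺ (l , h) = _ , h , l , inj₁ refl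

≺-trans : ∀ {a b c} → a ≺ b → b ≺ c → a ≺ c
≺-trans {a} {b} {c} (i , h , l , d) (i′ , h′ , l′ , d′) with <-cmp i i′
... | tri< i<i′ _ _ = i , agree-trans {b = b} h (agree-≤ {a = b} (<⇒≤ i<i′) h′) , <-trans i<i′ l′ , case d
  where
  case : i ≡ len a ⊎ (i < len a × cmp a i < cmp b i) → i ≡ len a ⊎ (i < len a × cmp a i < cmp c i)
  case (inj₁ e) = inj₁ e
  case (inj₂ (p , q)) = inj₂ (p , subst (cmp a i <_) (h′ i i<i′) q)
... | tri≈ _ refl _ = i , agree-trans {b = b} h h′ , l′ , case d d′
  where
  case : i ≡ len a ⊎ (i < len a × cmp a i < cmp b i) → i ≡ len b ⊎ (i < len b × cmp b i < cmp c i) →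
         i ≡ len a ⊎ (i < len a × cmp a i < cmp c i)
  case _ (inj₁ e) = ⊥-elim (<-irrefl e l)
  case (inj₁ e) (inj₂ _) = inj₁ e
  case (inj₂ (p , q)) (inj₂ (_ , q′)) = inj₂ (p , <-trans q q′)
... | tri> _ _ i′<i = i′ , agree-trans {b = b} (agree-≤ {a = a} (<⇒≤ i′<i) h) h′ , l′ , case d′
  where
  i≤ : i ≡ len a ⊎ (i < len a × cmp a i < cmp b i) → i ≤ len a
  i≤ (inj₁ e) = ≤-reflexive e
  i≤ (inj₂ (p , _)) = <⇒≤ p
  case : i′ ≡ len b ⊎ (i′ < len b × cmp b i′ < cmp c i′) → i′ ≡ len a ⊎ (i′ < len a × cmp a i′ < cmp c i′)
  case (inj₁ e) = ⊥-elim (<-irrefl e (<-trans i′<i l))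
  case (inj₂ (_ , q)) = inj₂ (<-≤-trans i′<i (i≤ d) , subst (_< cmp c i′) (sym (h i′ i′<i)) q)

≺-same : ∀ {a b} → a ≺ b → ¬ Same a b
≺-same (i , h , l , inj₁ e) (e′ , _) = <-irrefl (trans e e′) l
≺-same (i , h , l , inj₂ (p , q)) (_ , h′) = <-irrefl (h′ i p) q

≺-irrefl : ∀ {a} → ¬ (a ≺ a)
≺-irrefl p = ≺-same p (refl , λ _ _ → refl)

≺-asym : ∀ {a b} → a ≺ b → ¬ (b ≺ a)
≺-asym p q = ≺-irrefl (≺-trans p q)

-- The extensions of `a` form a convex set that follows `a` directly: if `b` exceeded `a` at a
-- component inside `a`, it would come after everything that extends `a`.
⊏-between : ∀ {a b c} → a ⊏ c → a ≺ b → b ≺ c → a ⊏ b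
⊏-between _ (i , h , l , inj₁ refl) _ = l , h
⊏-between {a} {b} {c} (_ , g) (i , h , l , inj₂ (p , q)) (i′ , h′ , l′ , d′) with <-cmp i′ i
... | tri< i′<i _ _ = ⊥-elim (case d′)
  where
  case : i′ ≡ len b ⊎ (i′ < len b × cmp b i′ < cmp c i′) → ⊥
  case (inj₁ e) = <-irrefl e (<-trans i′<i l)
  case (inj₂ (_ , r)) = <-irrefl (trans (sym (h i′ i′<i)) (g i′ (<-trans i′<i p))) r
... | tri≈ _ refl _ = ⊥-elim (case d′)
  where
  case : i ≡ len b ⊎ (i < len b × cmp b i < cmp c i) → ⊥
  case (inj₁ e) = <-irrefl e l
  case (inj₂ (_ , r)) = <-asym q (subst (cmp b i <_) (sym (g i p)) r)
... | tri> _ _ i<i′ = ⊥-elim (<-irrefl (trans (g i p) (sym (h′ i i<i′))) q)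

-- A performed proposal puts its element at its address and cancels all entries at addresses that do
-- not precede it; in particular it replaces the previous entry of the element.
Alive : ℕ → ℕ → Set
Alive t s = t < s × Perf t × (∀ u → t < u → u < s → Perf u → adr t ≺ adr u)

In : ℕ → ℕ → Set
In a s = ∃[ t ] (Alive t s × el t ≡ a)

Done Live : ℕ → Set
Done a = ∃[ k ] (len a ≡ suc k × cmp a k ≡ 0)
Live a = ∃[ k ] (len a ≡ suc k × 0 < cmp a k)

Out : ℕ → ℕ → Set
Out a s = ∃[ t ] (Alive t s × el t ≡ a × Done (adr t))

-- Φ j has not been dealt with by a label outcome 1 + j at a level between j and i.
NK : ℕ → ℕ → ℕ → Set
NK a i j = ∀ i′ → i′ < i → cmp a i′ ≡ suc j → i′ ≤ j

-- The codes for Φ j of an element at the live address a are to leave D.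
Rem : ℕ → ℕ → Set
Rem a j = ∃[ k ] (len a ≡ suc k × 0 < cmp a k × ¬ (suc j < cmp a k × NK a k j))

-- p = ⟨ j , ⟨ x , n ⟩ ⟩ records that Φ j has the axiom ⟨ x , {⟨ a , 0 ⟩} ⟩ by stage n.
Code : ℕ → ℕ → Set
Code a p = W (π₁ p) (π₁ (π₂ p)) (suc (pair a 0)) (π₂ (π₂ p))

-- The label of c at level i is x, for an axiom ⟨ c , {⟨ c , 1 + ⟨ j , ⟨ x , n ⟩ ⟩ ⟩} ⟩ of the i-th operator.
Lab : ℕ → ℕ → ℕ → ℕ → Set
Lab i j c s = ∃[ p ] (p < s × π₁ p ≡ j × Code c p × W i (pair c 0) (suc (pair c (suc p))) s)

Removed : ℕ → ℕ → ℕ → ℕ → Set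
Removed a j n s = ∃₂ λ t u → Alive t s × Alive u s × el t ≡ a × adr t ⊏ adr u × Rem (adr t) j × n < u

-- X s e and Y s e : by stage s there is a reason for e to leave E, and one for e to come back for good.
X Y : ℕ → ℕ → Set
X s e = (π₂ e ≡ 0 × Out (π₁ e) s) ⊎
        (∃[ p ] (π₂ e ≡ suc p × (¬ Code (π₁ e) p ⊎ Out (π₁ e) s ⊎ Removed (π₁ e) (π₁ p) (π₂ (π₂ p)) s)))
Y s e = (π₂ e ≡ 0 × π₁ e < s × ¬ In (π₁ e) s) ⊎
        (0 < π₂ e × ∃[ t ] (t < s × Perf t × Done (adr t) × 0 < w₂ t × w₁ t ≡ e))

E-at : ℕ → ℕ → Set
E-at s e = ¬ ((∃[ s′ ] (s′ < suc s × X s′ e)) × ¬ (∃[ s′ ] (s′ < suc s × Y s′ e)))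

E D : Subset
E e = ¬ ((∃[ s ] X s e) × ¬ (∃[ s ] Y s e))
D e = E e × 0 < π₂ e

-- No entry at an initial segment of a of length at most k removes e.
NonIg : ℕ → ℕ → ℕ → ℕ → Set
NonIg s a k e = ∀ p → π₂ e ≡ suc p → ∀ t → Alive t s → el t ≡ π₁ e →
  len (adr t) ≤ k → Agree (len (adr t)) (adr t) a → ¬ Rem (adr t) (π₁ p)

-- Evidence at a stage that a condition on E is true for good. `permanent` turns it into truth if
-- the acting element is never dumped, and by `secure` true conditions obtain it on the true path.
-- The bound `π₁ e < s` makes the element of `e` old enough for `old-fixed`.
Sec : ℕ → ℕ → ℕ → ℕ → Set
Sec s a k y = y ≡ 0 ⊎ (∃[ e ] (y ≡ suc e × π₁ e < s × E-at s e × NonIg s a k e))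

Occ : ℕ → ℕ → ℕ → Set
Occ s b n = ∀ i → 0 < i → i ≤ n → ∃[ t ] (Alive t s × len (adr t) ≡ i × Agree i (adr t) b)

Zeroed : ℕ → ℕ → ℕ → Set
Zeroed i a b = len a ≡ suc i × Agree i a b × cmp a i ≡ 0

-- A label outcome needs a label for this very element and an index not yet used up (`NK`). A
-- positive outcome is closed as long as an entry sits at outcome 0 of the same level, for then that
-- level has already succeeded.
Comps : ℕ → ℕ → ℕ → ℕ → Set
Comps s b c n = ∀ i → i < n →
  (cmp b i ≤ suc i × (∀ j → cmp b i ≡ suc j → j < i → NK b i j × Lab i j c s)) ×
  (0 < cmp b i → ∀ t → Alive t s → ¬ Zeroed i (adr t) b)

Slot : ℕ → ℕ → ℕ → ℕ → Set
Slot s b c k = len b ≡ suc k × Occ s b k × (∀ t → Alive t s → ¬ Same (adr t) b) × Comps s b c (suc k)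

-- Attack: operator k enumerates el s from a condition that will stay true, so el s leaves A.
-- Restore: el s left A at a node below label outcome 1 + j, yet its label x lies in Φ j (E); then the
-- code w₁ s can return to D without contradicting its meaning, and operator k enumerates el s from it.
Place Attack Restore : ℕ → ℕ → Set
Place s k = 0 < cmp (adr s) k ×
  (el s ≡ s ⊎ (∃[ t ] (Alive t s × el t ≡ el s × Live (adr t) × adr s ≺ adr t)))
Attack s k = cmp (adr s) k ≡ 0 × w₂ s ≡ 0 ×
  (∃[ t ] (Alive t s × el t ≡ el s × len (adr t) ≡ suc k × Agree k (adr t) (adr s) × 0 < cmp (adr t) k)) ×
  W k (pair (el s) 0) (w₁ s) s × Sec s (adr s) k (w₁ s) ×
  (w₁ s ≡ 0 ⊎ (∃[ e ] (w₁ s ≡ suc e × 0 < π₂ e × ¬ π₁ e ≡ el s)))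
Restore s k = cmp (adr s) k ≡ 0 × (∃[ h ] (w₂ s ≡ suc h × Sec s (adr s) k h ×
  π₁ (w₁ s) ≡ el s × (∃[ p ] (π₂ (w₁ s) ≡ suc p × Code (el s) p ×
  W k (pair (el s) 0) (suc (w₁ s)) s × W (π₁ p) (π₁ (π₂ p)) h s ×
  (∃[ t ] (Alive t s × el t ≡ el s × Done (adr t) × k < len (adr t) × Agree k (adr t) (adr s) ×
    cmp (adr t) k ≡ suc (π₁ p)))))))

Valid : ℕ → Set
Valid s = ∃[ k ] (Slot s (adr s) (el s) k × (Place s k ⊎ Attack s k ⊎ Restore s k))

alive-≤ : ∀ {t s s′} → t < s′ → s′ ≤ s → Alive t s → Alive t s′
alive-≤ t<s′ s′≤s (_ , p , h) = t<s′ , p , λ u t<u u<s′ → h u t<u (<-≤-trans u<s′ s′≤s)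

alive-≺ : ∀ {t u s} → Alive t s → Alive u s → t < u → adr t ≺ adr u
alive-≺ (_ , _ , h) (u<s , pu , _) t<u = h _ t<u u<s pu

alive-new : ∀ {t} → Perf t → Alive t (suc t)
alive-new p = n<1+n _ , p , λ u t<u u<1+t → ⊥-elim (<-irrefl refl (<-≤-trans t<u (s≤s⁻¹ u<1+t)))

alive-extend : ∀ {t s s′} → s ≤ s′ → Alive t s → (∀ u → s ≤ u → u < s′ → Perf u → adr t ≺ adr u) → Alive t s′
alive-extend {t} {s} s≤s′ (t<s , p , h) g = <-≤-trans t<s s≤s′ , p , λ u t<u u<s′ pu →
  [ (λ u<s → h u t<u u<s pu) , (λ s≤u → g u s≤u u<s′ pu) ]′ (<-≤-connex u s)

-- The bounded formulas express the construction

infix 0 _⇌_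
infixr 6 _×⇌_
infixr 5 _⊎⇌_
infixr 4 _→⇌_

_⇌_ : Set → Set → Set
P ⇌ Q = (P → Q) × (Q → P)

id⇌ : ∀ {P : Set} → P ⇌ P
id⇌ = (λ p → p) , (λ p → p)

_×⇌_ : ∀ {P Q P′ Q′ : Set} → P ⇌ Q → P′ ⇌ Q′ → P × P′ ⇌ Q × Q′
(f , g) ×⇌ (f′ , g′) = (λ (p , q) → f p , f′ q) , (λ (p , q) → g p , g′ q)

_⊎⇌_ : ∀ {P Q P′ Q′ : Set} → P ⇌ Q → P′ ⇌ Q′ → P ⊎ P′ ⇌ Q ⊎ Q′
(f , g) ⊎⇌ (f′ , g′) = [ (λ p → inj₁ (f p)) , (λ p → inj₂ (f′ p)) ]′ , [ (λ p → inj₁ (g p)) , (λ p → inj₂ (g′ p)) ]′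

_→⇌_ : ∀ {P Q P′ Q′ : Set} → P ⇌ Q → P′ ⇌ Q′ → (P → P′) ⇌ (Q → Q′)
(f , g) →⇌ (f′ , g′) = (λ h q → f′ (h (g q))) , (λ h p → g′ (h (f p)))

¬⇌ : ∀ {P Q : Set} → P ⇌ Q → (¬ P) ⇌ (¬ Q)
¬⇌ (f , g) = (λ h q → h (g q)) , (λ h p → h (f p))

≤⇌ : ∀ {m n} → m < suc n ⇌ m ≤ n
≤⇌ = s≤s⁻¹ , s≤s

∃⇌ : ∀ {P Q : ℕ → Set} {b} → (∀ k → k < b → P k ⇌ Q k) → (∃[ k ] (k < b × P k)) ⇌ (∃[ k ] (k < b × Q k))
∃⇌ h = (λ (k , l , p) → k , l , proj₁ (h k l) p) , (λ (k , l , q) → k , l , proj₂ (h k l) q)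

∃∞⇌ : ∀ {P Q : ℕ → Set} {b} → (∀ k → k < b → P k ⇌ Q k) → (∀ k → Q k → k < b) → (∃[ k ] (k < b × P k)) ⇌ (∃[ k ] Q k)
∃∞⇌ h b = (λ (k , l , p) → k , proj₁ (h k l) p) , (λ (k , q) → k , b k q , proj₂ (h k (b k q)) q)

∀⇌ : ∀ {P Q : ℕ → Set} {b} → (∀ k → k < b → P k ⇌ Q k) → (∀ k → k < b → P k) ⇌ (∀ k → k < b → Q k)
∀⇌ h = (λ f k l → proj₁ (h k l) (f k l)) , (λ f k l → proj₂ (h k l) (f k l))

∀∞⇌ : ∀ {P Q : ℕ → Set} {b} → (∀ k → k < b → P k ⇌ Q k) → (∀ k → (k < b → Q k) → Q k) →
      (∀ k → k < b → P k) ⇌ (∀ k → Q k)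
∀∞⇌ h b = (λ f k → b k (λ l → proj₁ (h k l) (f k l))) , (λ f k l → proj₂ (h k l) (f k))

W⇌ : ∀ {e x y n} → Holds WFm (e ∷ x ∷ y ∷ n ∷ []) ⇌ W e x y n
W⇌ = ⇒W , W⇒

opaque
  unfolding agreeFm

  agree⇌ : ∀ {i a b} → Holds agreeFm (i ∷ a ∷ b ∷ []) ⇌ Agree i a b
  agree⇌ = id⇌

opaque
  unfolding strictFm

  ⊏⇌ : ∀ {a b} → Holds strictFm (a ∷ b ∷ []) ⇌ a ⊏ b
  ⊏⇌ = id⇌ ×⇌ agree⇌

opaque
  unfolding codeFm

  code⇌ : ∀ {a p} → Holds codeFm (a ∷ p ∷ []) ⇌ Code a p
  code⇌ = W⇌

opaque
  unfolding lessFm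

  ≺⇌ : ∀ {a b} → Holds lessFm (a ∷ b ∷ []) ⇌ a ≺ b
  ≺⇌ {a} {b} = ∃∞⇌ (λ _ _ → agree⇌ ×⇌ id⇌) bound
    where
    bound : ∀ i → Agree i a b × i < len b × (i ≡ len a ⊎ (i < len a × cmp a i < cmp b i)) → i < suc (len a)
    bound i (_ , _ , inj₁ e) = s≤s (≤-reflexive e)
    bound i (_ , _ , inj₂ (p , _)) = m<n⇒m<1+n p

last⇌ : ∀ {a} {P Q : ℕ → Set} → (∀ k → P k ⇌ Q k) →
        (∃[ k ] (k < len a × len a ≡ suc k × P k)) ⇌ (∃[ k ] (len a ≡ suc k × Q k))
last⇌ h = ∃∞⇌ (λ k _ → id⇌ ×⇌ h k) (λ k (e , _) → subst (k <_) (sym e) ≤-refl)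

opaque
  unfolding notKilledFm

  notKilled⇌ : ∀ {a i j} → Holds notKilledFm (a ∷ i ∷ j ∷ []) ⇌ NK a i j
  notKilled⇌ = ∀⇌ λ _ _ → id⇌ →⇌ ≤⇌

opaque
  unfolding remFm

  rem⇌ : ∀ {a j} → Holds remFm (a ∷ j ∷ []) ⇌ Rem a j
  rem⇌ {a} {j} = last⇌ λ k → id⇌ ×⇌ ¬⇌ (id⇌ ×⇌ notKilled⇌ {a} {k} {j})

opaque
  unfolding labFm

  lab⇌ : ∀ {i j c s} → Holds labFm (i ∷ j ∷ c ∷ s ∷ []) ⇌ Lab i j c s
  lab⇌ = ∃⇌ λ _ _ → id⇌ ×⇌ code⇌ ×⇌ W⇌

suc-bound : ∀ {m n} → m ≡ suc n → n < m
suc-bound refl = ≤-refl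

-- The code `hist σ` is reliable only about stages below `σ`; this is the origin of the bounds
-- `s ≤ σ`.
module Transfer (σ : ℕ) where

  H : ℕ
  H = hist σ

  bit⇌ : ∀ {t} → t < σ → look H t ≡ 1 ⇌ Perf t
  bit⇌ l = look⇒perf l , perf⇒look l

  opaque
    unfolding aliveFm

    alive⇌ : ∀ {t s} → s ≤ σ → Holds aliveFm (H ∷ t ∷ s ∷ []) ⇌ Alive t s
    alive⇌ {t} {s} s≤σ =
      (λ (l , b , h) → l , proj₁ (bit⇌ (<-≤-trans l s≤σ)) b ,
         λ u t<u u<s pu → proj₁ (≺⇌ {adr t} {adr u}) (h u u<s t<u (proj₂ (bit⇌ (<-≤-trans u<s s≤σ)) pu))) ,
      (λ (l , p , h) → l , proj₂ (bit⇌ (<-≤-trans l s≤σ)) p ,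
         λ u u<s t<u b → proj₂ (≺⇌ {adr t} {adr u}) (h u t<u u<s (proj₁ (bit⇌ (<-≤-trans u<s s≤σ)) b)))

  opaque
    unfolding inFm

    in⇌ : ∀ {a s} → s ≤ σ → Holds inFm (H ∷ a ∷ s ∷ []) ⇌ In a s
    in⇌ le = ∃∞⇌ (λ k _ → alive⇌ {k} le ×⇌ id⇌) (λ _ (al , _) → proj₁ al)

  opaque
    unfolding doneFm

    done⇌ : ∀ {a} → Holds doneFm (a ∷ []) ⇌ Done a
    done⇌ {a} = last⇌ {a} λ _ → id⇌

  opaque
    unfolding liveFm

    live⇌ : ∀ {a} → Holds liveFm (a ∷ []) ⇌ Live a
    live⇌ {a} = last⇌ {a} λ _ → id⇌

  opaque
    unfolding outFm

    out⇌ : ∀ {a s} → s ≤ σ → Holds outFm (H ∷ a ∷ s ∷ []) ⇌ Out a s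
    out⇌ le = ∃∞⇌ (λ k _ → alive⇌ {k} le ×⇌ id⇌ ×⇌ done⇌ {adr k}) (λ _ (al , _) → proj₁ al)

  opaque
    unfolding removedFm

    removed⇌ : ∀ {a j n s} → s ≤ σ → Holds removedFm (H ∷ a ∷ j ∷ n ∷ s ∷ []) ⇌ Removed a j n s
    removed⇌ {a} {j} le = ∃∞⇌ (λ t _ → ∃∞⇌ (λ u _ → alive⇌ {t} le ×⇌ alive⇌ {u} le ×⇌ id⇌ ×⇌ ⊏⇌ ×⇌ rem⇌ {adr t} {j} ×⇌ id⇌)
      (λ _ (_ , al , _) → proj₁ al)) (λ _ (_ , al , _) → proj₁ al)

  opaque
    unfolding xFm

    X⇌ : ∀ {s e} → s ≤ σ → Holds xFm (H ∷ s ∷ e ∷ []) ⇌ X s e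
    X⇌ {s} {e} le = (id⇌ ×⇌ out⇌ {π₁ e} le) ⊎⇌
      ∃∞⇌ (λ p _ → id⇌ ×⇌ (¬⇌ code⇌ ⊎⇌ out⇌ {π₁ e} le ⊎⇌ removed⇌ {π₁ e} {π₁ p} {π₂ (π₂ p)} le)) (λ _ (q , _) → suc-bound q)

  opaque
    unfolding yFm

    Y⇌ : ∀ {s e} → s ≤ σ → Holds yFm (H ∷ s ∷ e ∷ []) ⇌ Y s e
    Y⇌ {s} {e} le = (id⇌ ×⇌ id⇌ ×⇌ ¬⇌ (in⇌ {π₁ e} le)) ⊎⇌
      (id⇌ ×⇌ ∃⇌ (λ t t<s → bit⇌ (<-≤-trans t<s le) ×⇌ done⇌ {adr t} ×⇌ id⇌))

  opaque
    unfolding eFm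

    E-at⇌ : ∀ {s e} → s ≤ σ → Holds eFm (H ∷ s ∷ e ∷ []) ⇌ E-at s e
    E-at⇌ {s} {e} le = ¬⇌ (∃⇌ (λ s′ l → X⇌ {s′} {e} (≤-trans (s≤s⁻¹ l) le)) ×⇌ ¬⇌ (∃⇌ (λ s′ l → Y⇌ {s′} {e} (≤-trans (s≤s⁻¹ l) le))))

  ∀alive⇌ : ∀ {s} {P Q : ℕ → Set} → s ≤ σ → (∀ t → P t ⇌ Q t) →
            (∀ t → t < s → Holds aliveFm (H ∷ t ∷ s ∷ []) → P t) ⇌ (∀ t → Alive t s → Q t)
  ∀alive⇌ le h = ∀∞⇌ (λ t _ → alive⇌ {t} le →⇌ h t) (λ _ f al → f (proj₁ al) al)

  opaque
    unfolding nonIgFm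

    nonIg⇌ : ∀ {s a k e} → s ≤ σ → Holds nonIgFm (H ∷ s ∷ a ∷ k ∷ e ∷ []) ⇌ NonIg s a k e
    nonIg⇌ {s} {a} le = ∀∞⇌ (λ p _ → id⇌ →⇌ ∀alive⇌ le λ t → id⇌ →⇌ ≤⇌ →⇌ agree⇌ →⇌ ¬⇌ (rem⇌ {adr t} {π₁ p}))
      (λ _ f q → f (suc-bound q) q)

  opaque
    unfolding secFm

    sec⇌ : ∀ {s a k y} → s ≤ σ → Holds secFm (H ∷ s ∷ a ∷ k ∷ y ∷ []) ⇌ Sec s a k y
    sec⇌ {s} {a} {k} {y} le = id⇌ ⊎⇌ ∃∞⇌ (λ e _ → id⇌ ×⇌ id⇌ ×⇌ E-at⇌ {s} {e} le ×⇌ nonIg⇌ {s} {a} {k} {e} le) (λ _ (q , _) → suc-bound q)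

  opaque
    unfolding slotFm

    slot⇌ : ∀ {s b c k} → s ≤ σ → Holds slotFm (H ∷ s ∷ b ∷ c ∷ k ∷ []) ⇌ Slot s b c k
    slot⇌ {s} {b} {c} {k} le = id⇌ ×⇌ occ ×⇌ ∀alive⇌ le (λ _ → ¬⇌ (id⇌ ×⇌ agree⇌)) ×⇌
      (∀⇌ λ i _ → (≤⇌ ×⇌ ∀∞⇌ (λ j _ → id⇌ →⇌ id⇌ →⇌ notKilled⇌ {b} {i} {j} ×⇌ lab⇌ {i} {j} {c} {s})
        (λ _ f q → f (suc-bound q) q)) ×⇌ (id⇌ →⇌ ∀alive⇌ le λ _ → ¬⇌ (id⇌ ×⇌ agree⇌ ×⇌ id⇌)))
      where
      occ : (∀ i → i < suc k → 0 < i → ∃[ t ] (t < s × Holds aliveFm (H ∷ t ∷ s ∷ []) × len (adr t) ≡ i × Holds agreeFm (i ∷ adr t ∷ b ∷ []))) ⇌ Occ s b k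
      occ = (λ f i p l → proj₁ (inner i) (f i (s≤s l) p)) , (λ f i l p → proj₂ (inner i) (f i p (s≤s⁻¹ l)))
        where
        inner : ∀ i → (∃[ t ] (t < s × Holds aliveFm (H ∷ t ∷ s ∷ []) × len (adr t) ≡ i × Holds agreeFm (i ∷ adr t ∷ b ∷ []))) ⇌
                      (∃[ t ] (Alive t s × len (adr t) ≡ i × Agree i (adr t) b))
        inner i = ∃∞⇌ (λ t _ → alive⇌ {t} le ×⇌ id⇌ ×⇌ agree⇌) (λ _ (al , _) → proj₁ al)

  opaque
    unfolding placeFm

    place⇌ : ∀ {k} → Holds placeFm (H ∷ σ ∷ k ∷ []) ⇌ Place σ k
    place⇌ = id⇌ ×⇌ (id⇌ ⊎⇌ ∃∞⇌ (λ t _ → alive⇌ {t} ≤-refl ×⇌ id⇌ ×⇌ live⇌ {adr t} ×⇌ ≺⇌ {adr σ} {adr t}) (λ _ (al , _) → proj₁ al))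

  opaque
    unfolding attackFm

    attack⇌ : ∀ {k} → Holds attackFm (H ∷ σ ∷ k ∷ []) ⇌ Attack σ k
    attack⇌ {k} = id⇌ ×⇌ id⇌ ×⇌ ∃∞⇌ (λ t _ → alive⇌ {t} ≤-refl ×⇌ id⇌ ×⇌ id⇌ ×⇌ agree⇌ ×⇌ id⇌) (λ _ (al , _) → proj₁ al) ×⇌ W⇌ ×⇌
      sec⇌ {σ} {adr σ} {k} {w₁ σ} ≤-refl ×⇌ (id⇌ ⊎⇌ ∃∞⇌ (λ _ _ → id⇌) (λ _ (q , _) → suc-bound q))

  opaque
    unfolding restoreFm

    restore⇌ : ∀ {k} → Holds restoreFm (H ∷ σ ∷ k ∷ []) ⇌ Restore σ k
    restore⇌ {k} = id⇌ ×⇌ ∃∞⇌ (λ h _ → id⇌ ×⇌ sec⇌ {σ} {adr σ} {k} {h} ≤-refl ×⇌ id⇌ ×⇌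
      ∃∞⇌ (λ p _ → id⇌ ×⇌ code⇌ ×⇌ W⇌ ×⇌ W⇌ ×⇌
        ∃∞⇌ (λ t _ → alive⇌ {t} ≤-refl ×⇌ id⇌ ×⇌ done⇌ {adr t} ×⇌ id⇌ ×⇌ agree⇌ ×⇌ id⇌) (λ _ (al , _) → proj₁ al))
        (λ _ (q , _) → suc-bound q)) (λ _ (q , _) → suc-bound q)

  opaque
    unfolding validFm

    valid⇌ : Holds validFm (H ∷ σ ∷ []) ⇌ Valid σ
    valid⇌ = ∃∞⇌ (λ k _ → slot⇌ {σ} {adr σ} {el σ} {k} ≤-refl ×⇌ (place⇌ {k} ⊎⇌ attack⇌ {k} ⊎⇌ restore⇌ {k}))
      (λ _ (sl , _) → suc-bound (proj₁ sl))

valid : ∀ {s} → Perf s → Valid s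
valid {s} p = proj₁ (Transfer.valid⇌ s) (perf⇒ s p)

perform : ∀ {s} → Valid s → Perf s
perform {s} v = ⇒perf s (proj₂ (Transfer.valid⇌ s) v)

-- Moves, cancellation and permanence

module Verification (em : ExcludedMiddle 0ℓ) where

  suc-≡ : ∀ {a k k′} → len a ≡ suc k → len a ≡ suc k′ → k ≡ k′
  suc-≡ e e′ = suc-injective (trans (sym e) e′)

  done-live : ∀ {a} → Done a → ¬ Live a
  done-live (k , e , z) (k′ , e′ , l) with suc-≡ e e′
  ... | refl = <-irrefl (sym z) l

  data Prior (s : ℕ) : Set where
    new : el s ≡ s → Prior s
    moved : ∀ t → Alive t s → el t ≡ el s → adr s ≺ adr t →
            Live (adr t) ⊎ (Done (adr t) × (∃[ k ] (len (adr s) ≡ suc k × cmp (adr s) k ≡ 0 ×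
              k < len (adr t) × Agree k (adr t) (adr s) × 0 < cmp (adr t) k))) → Prior s

  prior : ∀ {s} → Perf s → Prior s
  prior {s} p with valid p
  ... | k , _ , inj₁ (_ , inj₁ e) = new e
  ... | k , _ , inj₁ (_ , inj₂ (t , al , e , lv , lt)) = moved t al e lt (inj₁ lv)
  ... | k , sl , inj₂ (inj₁ (z , _ , (t , al , e , l , ag , pos) , _)) =
    moved t al e (k , agree-sym {a = adr t} ag , subst (k <_) (sym l) ≤-refl ,
      inj₂ (subst (k <_) (sym (proj₁ sl)) ≤-refl , subst (_< cmp (adr t) k) (sym z) pos)) (inj₁ (k , l , pos))
  ... | k , sl , inj₂ (inj₂ (z , h , _ , _ , _ , q , _ , _ , _ , _ , t , al , e , dn , k<l , ag , c)) =
    moved t al e (k , agree-sym {a = adr t} ag , k<l ,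
      inj₂ (subst (k <_) (sym (proj₁ sl)) ≤-refl , subst (_< cmp (adr t) k) (sym z) pos))
      (inj₂ (dn , k , proj₁ sl , z , k<l , ag , pos))
    where
    pos : 0 < cmp (adr t) k
    pos = subst (0 <_) (sym c) (s≤s z≤n)

  -- A fresh element is named after its stage, and a moved one had an entry before. Hence large
  -- elements act only at late stages.
  el≤ : ∀ t → Perf t → el t ≤ t
  el≤ = <-rec _ λ t rec p → go t rec (prior p)
    where
    go : ∀ t → (∀ {u} → u < t → Perf u → el u ≤ u) → Prior t → el t ≤ t
    go t rec (new e) = ≤-reflexive e
    go t rec (moved u (u<t , pu , _) e _ _) = subst (_≤ t) e (≤-trans (rec u<t pu) (<⇒≤ u<t))

  -- A move leads to a preceding address and therefore cancels the entry that it leaves behind.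
  no-duplicate : ∀ u → Perf u → ∀ t → t < u → el t ≡ el u → ¬ Alive t (suc u)
  no-duplicate = <-rec _ λ u rec pu t t<u e al → go u rec pu t t<u e al (prior pu)
    where
    go : ∀ u → (∀ {v} → v < u → Perf v → ∀ t → t < v → el t ≡ el v → ¬ Alive t (suc v)) →
         Perf u → ∀ t → t < u → el t ≡ el u → Alive t (suc u) → Prior u → ⊥
    go u rec pu t t<u e al@(_ , pt , h) (new f) =
      <-irrefl refl (<-≤-trans t<u (≤-trans (≤-reflexive (sym (trans e f))) (el≤ t pt)))
    go u rec pu t t<u e al@(_ , pt , h) (moved v av@(v<u , pv , hv) ev lt _) with <-cmp t v
    ... | tri< t<v _ _ = rec v<u pv t t<v (trans e (sym ev)) (alive-≤ (m<n⇒m<1+n t<v) (≤-trans v<u (n≤1+n u)) al)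
    ... | tri> _ _ v<t = rec t<u pt v v<t (trans ev (sym e)) (alive-≤ (m<n⇒m<1+n v<t) t<u av)
    ... | tri≈ _ refl _ = ≺-asym lt (h u t<u (n<1+n u) pu)

  unique : ∀ {t u s} → Alive t s → Alive u s → el t ≡ el u → t ≡ u
  unique {t} {u} at@(t<s , pt , _) au@(u<s , pu , _) e with <-cmp t u
  ... | tri≈ _ q _ = q
  ... | tri< t<u _ _ = ⊥-elim (no-duplicate u pu t t<u e (alive-≤ (m<n⇒m<1+n t<u) u<s at))
  ... | tri> _ _ u<t = ⊥-elim (no-duplicate t pt u u<t (sym e) (alive-≤ (m<n⇒m<1+n u<t) t<s au))

  after : ∀ {t v u} → Perf t → t < u → Alive v u → el t ≡ el v → t ≤ v
  after {t} {v} pt t<u av e = ≮⇒≥ λ v<t → no-duplicate t pt v v<t (sym e) (alive-≤ (m<n⇒m<1+n v<t) t<u av)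

  not-new : ∀ {t u} → Perf t → t < u → el t ≡ el u → ¬ el u ≡ u
  not-new pt t<u e f = <-irrefl refl (<-≤-trans t<u (≤-trans (≤-reflexive (sym (trans e f))) (el≤ _ pt)))

  decrease : ∀ u {v} → Perf u → Perf v → v < u → el v ≡ el u → adr u ≺ adr v
  decrease = <-rec _ λ u rec {v} pu pv v<u e → go u rec pv v<u e (prior pu)
    where
    go : ∀ u → (∀ {w} → w < u → ∀ {v} → Perf w → Perf v → v < w → el v ≡ el w → adr w ≺ adr v) →
         ∀ {v} → Perf v → v < u → el v ≡ el u → Prior u → adr u ≺ adr v
    go u rec pv v<u e (new f) = ⊥-elim (not-new pv v<u e f)
    go u rec {v} pv v<u e (moved w aw@(w<u , pw , _) ew lt _)
      with m≤n⇒m<n∨m≡n (after pv v<u aw (trans e (sym ew)))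
    ... | inj₁ v<w = ≺-trans lt (rec w<u pw pv v<w (trans e (sym ew)))
    ... | inj₂ refl = lt

  Below : ℕ → ℕ → Set
  Below u t = ∃₂ λ k k′ → len (adr u) ≡ suc k × cmp (adr u) k ≡ 0 × len (adr t) ≡ suc k′ ×
    k ≤ k′ × Agree k (adr u) (adr t)

  -- Placing and attacking start from a live entry, so only restoring can move an element that is
  -- out; it ends at outcome 0 again, at the same level or higher up on the same path.
  done-stays : ∀ u {t} → Perf u → Perf t → t < u → el t ≡ el u → Done (adr t) → Below u t
  done-stays = <-rec _ λ u rec {t} pu pt t<u e d → go u rec pt t<u e d (prior pu)
    where
    go : ∀ u → (∀ {w} → w < u → ∀ {t} → Perf w → Perf t → t < w → el t ≡ el w → Done (adr t) → Below w t) →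
         ∀ {t} → Perf t → t < u → el t ≡ el u → Done (adr t) → Prior u → Below u t
    go u rec pt t<u e d (new f) = ⊥-elim (not-new pt t<u e f)
    go u rec {t} pt t<u e d@(kt , lt , zt) (moved w aw@(w<u , pw , _) ew _ how)
      with m≤n⇒m<n∨m≡n (after pt t<u aw (trans e (sym ew))) | how
    ... | inj₂ refl | inj₁ lv = ⊥-elim (done-live d lv)
    ... | inj₂ refl | inj₂ (_ , k , l , z , k<l , ag , pos) =
      k , kt , l , z , lt , s≤s⁻¹ (subst (k <_) lt k<l) , agree-sym {a = adr w} ag
    ... | inj₁ t<w | inj₁ lv with rec w<u pw pt t<w (trans e (sym ew)) d
    ...   | kw , _ , lw , zw , _ = ⊥-elim (done-live (kw , lw , zw) lv)
    go u rec {t} pt t<u e d (moved w aw@(w<u , pw , _) ew _ how) | inj₁ t<w | inj₂ (_ , k , l , z , k<l , ag , pos)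
      with rec w<u pw pt t<w (trans e (sym ew)) d
    ... | kw , kt , lw , zw , lt , kw≤kt , agw =
      k , kt , l , z , lt , ≤-trans k≤kw kw≤kt ,
      agree-trans {b = adr w} (agree-sym {a = adr w} ag) (agree-≤ {a = adr w} k≤kw agw)
      where
      k≤kw : k ≤ kw
      k≤kw = s≤s⁻¹ (subst (k <_) lw k<l)

  Never : ℕ → Set
  Never a = ∀ s → a < s → In a s

  -- Every entry that is not fresh comes from an alive one, so presence can be traced back; an
  -- element once lost never reappears.
  persist : ∀ {a} s s′ → In a s′ → a < s → s ≤ s′ → In a s
  persist {a} s s′ (t , al , e) = go t s′ al e
    where
    go : ∀ t s′ → Alive t s′ → el t ≡ a → a < s → s ≤ s′ → In a s
    go = <-rec _ λ t rec s′ al e a<s s≤s′ → step t rec s′ al e a<s s≤s′ (<-≤-connex t s)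
      where
      step : ∀ t → (∀ {u} → u < t → ∀ s′ → Alive u s′ → el u ≡ a → a < s → s ≤ s′ → In a s) →
             ∀ s′ → Alive t s′ → el t ≡ a → a < s → s ≤ s′ → t < s ⊎ s ≤ t → In a s
      step t rec s′ al e a<s s≤s′ (inj₁ t<s) = t , alive-≤ t<s s≤s′ al , e
      step t rec s′ al@(_ , pt , _) e a<s s≤s′ (inj₂ s≤t) with prior pt
      ... | new f = ⊥-elim (<-irrefl (trans (sym e) f) (<-≤-trans a<s s≤t))
      ... | moved u au@(u<t , _) eu _ _ = rec u<t t au (trans eu e) a<s s≤t

  survive : ∀ {a v t} → Never a → Alive v t → el v ≡ a → a < suc t → Perf t → ¬ el t ≡ a → adr v ≺ adr t
  survive {a} {v} {t} nv av@(v<t , pv , _) ev a<t pt ne with nv (suc t) a<t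
  ... | w , aw@(w<1+t , pw , hw) , ew with m≤n⇒m<n∨m≡n (s≤s⁻¹ w<1+t)
  ...   | inj₂ refl = ⊥-elim (ne ew)
  ...   | inj₁ w<t with unique av (alive-≤ w<t (n≤1+n t) aw) (trans ev (sym ew))
  ...     | refl = hw t w<t (n<1+n t) pt

  -- If an older element still has an entry after stage `t`, this entry precedes that of `el t`. A
  -- further move would go to a still earlier address and cancel `el t`, which is never dumped.
  old-fixed : ∀ {t} → Perf t → Never (el t) → ∀ u → Perf u → t < u → ¬ el u ≡ el t → t ≤ el u
  old-fixed {t} pt nv = <-rec _ λ u rec pu t<u ne → go u rec pu t<u ne (prior pu)
    where
    go : ∀ u → (∀ {v} → v < u → Perf v → t < v → ¬ el v ≡ el t → t ≤ el v) →
         Perf u → t < u → ¬ el u ≡ el t → Prior u → t ≤ el u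
    go u rec pu t<u ne (new f) = ≤-trans (<⇒≤ t<u) (≤-reflexive (sym f))
    go u rec pu t<u ne (moved v av@(v<u , pv , hv) ev lt _) with <-cmp v t
    ... | tri≈ _ refl _ = ⊥-elim (ne (sym ev))
    ... | tri> _ _ t<v = subst (t ≤_) ev (rec v<u pv t<v (λ q → ne (trans (sym ev) q)))
    ... | tri< v<t _ _ with nv u (≤-<-trans (el≤ t pt) t<u)
    ...   | g , ag@(g<u , pg , _) , eg = ⊥-elim (≺-asym (≺-trans lt v≺g) g≺u)
      where
      g≺u : adr g ≺ adr u
      g≺u = survive nv ag eg (≤-<-trans (el≤ t pt) (m<n⇒m<1+n t<u)) pu ne
      v≺g : adr v ≺ adr g
      v≺g = hv g (<-≤-trans v<t (after pt t<u ag (sym eg))) g<u pg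

  out⇒X : ∀ {e s} → Out (π₁ e) s → X s e
  out⇒X {e} {s} o = case (π₂ e) refl
    where
    case : ∀ m → π₂ e ≡ m → X s e
    case zero q = inj₁ (q , o)
    case (suc p) q = inj₂ (p , q , inj₂ (inj₁ o))

  -- An element that is never dumped protects the condition used when it left A: no entry
  -- can later remove e without cancelling that of el t or violating NonIg.
  permanent : ∀ {t k e} → Perf t → Never (el t) → len (adr t) ≡ suc k → cmp (adr t) k ≡ 0 →
              π₁ e < t → E-at t e → NonIg t (adr t) k e → (π₁ e ≡ el t → Out (el t) t) → E e
  permanent {t} {k} {e} pt nv lt zt a<t et ni own ((s , xs) , noY) = contra (<-cmp s t)
    where
    a = π₁ e
    no-early : ∀ s′ → s′ ≤ t → ¬ X s′ e
    no-early s′ s′≤t x = et ((s′ , s≤s s′≤t , x) , λ (u , _ , y) → noY (u , y))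
    ne : ¬ el t ≡ a
    ne q = no-early t ≤-refl (out⇒X (subst (λ b → Out b t) q (own (sym q))))
    module _ (t<s : t < s) where
      early : ∀ {v} → Alive v s → el v ≡ a → v < t
      early {v} (v<s , pv , _) ev with <-cmp v t
      ... | tri< v<t _ _ = v<t
      ... | tri≈ _ refl _ = ⊥-elim (ne ev)
      ... | tri> _ _ t<v = ⊥-elim (<-irrefl refl (<-≤-trans a<t
            (subst (t ≤_) ev (old-fixed pt nv v pv t<v (λ q → ne (trans (sym q) ev))))))
      no-out : ¬ Out a s
      no-out (v , av , ev , dv) =
        no-early t ≤-refl (out⇒X (v , alive-≤ (early av ev) (<⇒≤ t<s) av , ev , dv))
      no-removal : ∀ {p} → π₂ e ≡ suc p → ¬ Removed a (π₁ p) (π₂ (π₂ p)) s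
      no-removal {p} ep (v , u , av@(v<s , pv , hv) , au@(u<s , pu , hu) , ev , v⊏u , rem , n<u)
        with <-≤-connex u t
      ... | inj₁ u<t = no-early t ≤-refl (inj₂ (p , ep , inj₂ (inj₂
              (v , u , alive-≤ (early av ev) (<⇒≤ t<s) av , alive-≤ u<t (<⇒≤ t<s) au , ev , v⊏u , rem , n<u))))
      ... | inj₂ t≤u with nv s (≤-<-trans (el≤ t pt) t<s)
      ...   | g , ag@(g<s , pg , hg) , eg = ni p ep v (alive-≤ v<t (<⇒≤ t<s) av) ev v≤k agree rem
        where
        v<t = early av ev
        t≤g : t ≤ g
        t≤g = after pt t<s ag (sym eg)
        v≺g : adr v ≺ adr g
        v≺g = hv g (<-≤-trans v<t t≤g) g<s pg
        -- `g` is the entry of `el t` at stage `s`. Once `adr v` is an initial segment of `adr g`,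
        -- it is by `done-stays` also one of `adr t`, of length at most `k`, and there `NonIg`
        -- forbids the removal.
        v⊏g : adr v ⊏ adr g
        v⊏g with <-cmp u g
        ... | tri≈ _ refl _ = v⊏u
        ... | tri> _ _ g<u = ⊏-between v⊏u v≺g (hg u g<u u<s pu)
        -- Here another element acts at `u`, before `g`. It must come after the entry `w` that
        -- `el t` has at that time, yet `g` precedes `w`.
        ... | tri< u<g _ _ = ⊥-elim (≺-asym (≺-trans w≺u (hu g u<g g<s pg)) g≺w)
          where
          u≢ : ¬ el u ≡ el t
          u≢ q = <-irrefl (unique au ag (trans q (sym eg))) u<g
          t<u : t < u
          t<u = ≤∧≢⇒< t≤u (λ q → u≢ (cong el (sym q)))
          mid : In (el t) u
          mid = nv u (≤-<-trans (el≤ t pt) t<u)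
          w = proj₁ mid
          aw = proj₁ (proj₂ mid)
          w≺u : adr w ≺ adr u
          w≺u = survive nv aw (proj₂ (proj₂ mid)) (≤-<-trans (el≤ t pt) (m<n⇒m<1+n t<u)) pu u≢
          g≺w : adr g ≺ adr w
          g≺w = decrease g pg (proj₁ (proj₂ aw)) (<-trans (proj₁ aw) u<g) (trans (proj₂ (proj₂ mid)) (sym eg))
        below : ∃[ kg ] (len (adr g) ≡ suc kg × kg ≤ k × Agree kg (adr g) (adr t))
        below with m≤n⇒m<n∨m≡n t≤g
        ... | inj₂ refl = k , lt , ≤-refl , λ _ _ → refl
        ... | inj₁ t<g with done-stays g pg pt t<g (sym eg) (k , lt , zt)
        ...   | kg , kt , lg , _ , lt′ , kg≤ , agg with suc-≡ lt lt′
        ...     | refl = kg , lg , kg≤ , agg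
        kg≥ : len (adr v) ≤ proj₁ below
        kg≥ = s≤s⁻¹ (subst (len (adr v) <_) (proj₁ (proj₂ below)) (proj₁ v⊏g))
        v≤k : len (adr v) ≤ k
        v≤k = ≤-trans kg≥ (proj₁ (proj₂ (proj₂ below)))
        agree : Agree (len (adr v)) (adr v) (adr t)
        agree = agree-trans {b = adr g} (proj₂ v⊏g) (agree-≤ {a = adr g} kg≥ (proj₂ (proj₂ (proj₂ below))))
    contra : _ → ⊥
    contra (tri< s<t _ _) = no-early s (<⇒≤ s<t) xs
    contra (tri≈ _ refl _) = no-early s ≤-refl xs
    contra (tri> _ _ t<s) = late xs
      where
      late : X s e → ⊥
      late (inj₁ (_ , o)) = no-out t<s o
      late (inj₂ (p , ep , inj₁ c)) = no-early t ≤-refl (inj₂ (p , ep , inj₁ c))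
      late (inj₂ (p , ep , inj₂ (inj₁ o))) = no-out t<s o
      late (inj₂ (p , ep , inj₂ (inj₂ r))) = no-removal t<s ep r

  -- Slots of the tree that accept an entry

  dne : ∀ {P : Set} → ¬ ¬ P → P
  dne {P} h with em {P}
  ... | yes p = p
  ... | no ¬p = ⊥-elim (h ¬p)

  same-≺ : ∀ {a a′ b} → Same a a′ → a ≺ b → a′ ≺ b
  same-≺ {a} {a′} {b} (e , h) (i , g , l , d) =
    i , agree-trans {b = a} (agree-sym {a = a} (agree-≤ {a = a} (i≤ d) h)) g , l , case d
    where
    i≤ : i ≡ len a ⊎ (i < len a × cmp a i < cmp b i) → i ≤ len a
    i≤ (inj₁ q) = ≤-reflexive q
    i≤ (inj₂ (p , _)) = <⇒≤ p
    case : i ≡ len a ⊎ (i < len a × cmp a i < cmp b i) → i ≡ len a′ ⊎ (i < len a′ × cmp a′ i < cmp b i)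
    case (inj₁ q) = inj₁ (trans q e)
    case (inj₂ (p , q)) = inj₂ (subst (i <_) e p , subst (_< cmp b i) (h i p) q)

  ⊏-trans : ∀ {a b c} → a ⊏ b → b ⊏ c → a ⊏ c
  ⊏-trans {a} {b} (l , h) (l′ , h′) = <-trans l l′ , agree-trans {b = b} h (agree-≤ {a = b} (<⇒≤ l) h′)

  branch : ∀ {a b i} → Agree i a b → i < len a → i < len b → cmp a i < cmp b i → a ≺ b
  branch h p q r = _ , h , q , inj₂ (p , r)

  zeroed-≺ : ∀ {i a b} → Zeroed i a b → i < len b → 0 < cmp b i → a ≺ b
  zeroed-≺ {i} {a} {b} (l , h , z) p pos = branch h (subst (i <_) (sym l) ≤-refl) p (subst (_< cmp b i) (sym z) pos)

  snoc : ∀ b i o → ∃[ b′ ] (len b′ ≡ suc i × Agree i b′ b × cmp b′ i ≡ o)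
  snoc b i o with address (suc i) (λ l → pick (l <? i) l)
    where
    pick : ∀ {l} → Dec (l < i) → ℕ → ℕ
    pick (yes _) l = cmp b l
    pick (no _) l = o
  ... | b′ , e , h = b′ , e , agree , last
    where
    agree : Agree i b′ b
    agree l l<i with l <? i | h l (m<n⇒m<1+n l<i)
    ... | yes _ | q = q
    ... | no ¬p | _ = ⊥-elim (¬p l<i)
    last : cmp b′ i ≡ o
    last with i <? i | h i ≤-refl
    ... | yes p | _ = ⊥-elim (<-irrefl refl p)
    ... | no _ | q = q

  lab-≤ : ∀ {i j c s s′} → s ≤ s′ → Lab i j c s → Lab i j c s′
  lab-≤ le (p , p<s , e , c , w) = p , <-≤-trans p<s le , e , c , W-mono le w

  NK-agree : ∀ {a b i j} → Agree i a b → NK a i j → NK b i j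
  NK-agree h nk i′ p e = nk i′ p (trans (h i′ p) e)

  occ-agree : ∀ {s b b′ n} → Agree n b b′ → Occ s b n → Occ s b′ n
  occ-agree {b = b} h oc i pos i≤n with oc i pos i≤n
  ... | t , al , l , ag = t , al , l , agree-trans {b = b} ag (agree-≤ {a = b} i≤n h)

  comps-agree : ∀ {s b b′ c n} → Agree n b b′ → Comps s b c n → Comps s b′ c n
  comps-agree {b = b} {b′} h cs i i<n with cs i i<n
  ... | (le , lb) , zs =
    (subst (_≤ suc i) (h i i<n) le ,
     λ j e j<i → let nk , l = lb j (trans (h i i<n) e) j<i in NK-agree {b} {b′} hi nk , l) ,
    λ pos t al (l , ag , z) → zs (subst (0 <_) (sym (h i i<n)) pos) t al
      (l , agree-trans {b = b′} ag (agree-sym {a = b} hi) , z)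
    where
    hi : Agree i b b′
    hi = agree-≤ {a = b} (<⇒≤ i<n) h

  -- An action that spares an entry also spares the entries at its initial segments, since these
  -- precede it.
  alive-closed : ∀ {t s} → Alive t s → Occ s (adr t) (len (adr t))
  alive-closed {t} {s} al@(t<s , pt , ht) i pos i≤ with valid pt
  ... | k , (l , oc , _) , _ with m≤n⇒m<n∨m≡n i≤
  ... | inj₂ refl = t , al , refl , λ _ _ → refl
  ... | inj₁ i<l with oc i pos (s≤s⁻¹ (subst (i <_) l i<l))
  ... | t′ , al′ , l′ , ag = t′ , alive-extend (<⇒≤ t<s) al′ later , l′ , ag
    where
    t′≺t : adr t′ ≺ adr t
    t′≺t = ⊏⇒≺ (subst (_< len (adr t)) (sym l′) i<l , subst (λ z → Agree z (adr t′) (adr t)) (sym l′) ag)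
    later : ∀ u → t ≤ u → u < s → Perf u → adr t′ ≺ adr u
    later u t≤u u<s pu with m≤n⇒m<n∨m≡n t≤u
    ... | inj₂ refl = t′≺t
    ... | inj₁ t<u = ≺-trans t′≺t (ht u t<u u<s pu)

  len-bound : ∀ t → Perf t → len (adr t) ≤ suc t
  len-bound = <-rec _ λ t rec pt → go t rec (valid pt)
    where
    go : ∀ t → (∀ {u} → u < t → Perf u → len (adr u) ≤ suc u) → Valid t → len (adr t) ≤ suc t
    go t rec (zero , (l , _) , _) = ≤-trans (≤-reflexive l) (s≤s z≤n)
    go t rec (suc k , (l , oc , _) , _) with oc (suc k) (s≤s z≤n) ≤-refl
    ... | u , (u<t , pu , _) , l′ , _ =
      ≤-trans (≤-reflexive l) (s≤s (≤-trans (≤-reflexive (sym l′)) (≤-trans (rec u<t pu) u<t)))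

  -- An older entry at outcome 0 was excluded by `Comps` when `t₀` acted; a newer one would have
  -- cancelled `t₀`.
  zero-free : ∀ {t₀ s i} → Alive t₀ s → i < len (adr t₀) → 0 < cmp (adr t₀) i →
              ∀ t → Alive t s → ¬ Zeroed i (adr t) (adr t₀)
  zero-free {t₀} {s} {i} al₀@(_ , p₀ , _) i<l pos t al zd@(l , ag , z) with valid p₀ | <-cmp t t₀
  ... | k , (l₀ , _ , _ , cs) , _ | tri< t<t₀ _ _ =
    proj₂ (cs i (subst (i <_) l₀ i<l)) pos t (alive-≤ t<t₀ (<⇒≤ (proj₁ al₀)) al) zd
  ... | _ | tri≈ _ refl _ = <-irrefl (sym z) pos
  ... | _ | tri> _ _ t₀<t = ≺-asym (alive-≺ al₀ al t₀<t) (zeroed-≺ zd i<l pos)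

  entry-comps : ∀ {t s} → Alive t s → Comps s (adr t) (el t) (len (adr t))
  entry-comps {t} al@(t<s , pt , _) i i<l with valid pt
  ... | k , (l , _ , _ , cs) , _ with cs i (subst (i <_) l i<l)
  ... | (le , lb) , _ = (le , λ j e j<i → let nk , lab = lb j e j<i in nk , lab-≤ (<⇒≤ t<s) lab) , zero-free al i<l

  comps-snoc : ∀ {s b c n} → Comps s b c n →
    (cmp b n ≤ suc n × (∀ j → cmp b n ≡ suc j → j < n → NK b n j × Lab n j c s)) ×
    (0 < cmp b n → ∀ t → Alive t s → ¬ Zeroed n (adr t) b) → Comps s b c (suc n)
  comps-snoc cs last i i<1+n with m≤n⇒m<n∨m≡n (s≤s⁻¹ i<1+n)
  ... | inj₁ i<n = cs i i<n
  ... | inj₂ refl = last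

  -- Actions at addresses after `b` cancel nothing at initial segments of `b` and occupy neither `b`
  -- nor an address branching off to outcome 0. Labels, once present, remain.
  slot-later : ∀ {s s′ b c k} → s ≤ s′ → Slot s b c k →
               (∀ u → s ≤ u → u < s′ → Perf u → b ≺ adr u) → Slot s′ b c k
  slot-later {s} {s′} {b} {c} {k} s≤s′ (l , oc , fr , cs) above = l , oc′ , fr′ , cs′
    where
    k<l : k < len b
    k<l = subst (k <_) (sym l) ≤-refl
    oc′ : Occ s′ b k
    oc′ i pos i≤k with oc i pos i≤k
    ... | t , al , l′ , ag = t , alive-extend s≤s′ al (λ u su us pu → ≺-trans t≺b (above u su us pu)) , l′ , ag
      where
      t≺b : adr t ≺ b
      t≺b = ⊏⇒≺ (subst (_< len b) (sym l′) (≤-<-trans i≤k k<l) , subst (λ z → Agree z (adr t) b) (sym l′) ag)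
    fr′ : ∀ t → Alive t s′ → ¬ Same (adr t) b
    fr′ t al@(t<s′ , pt , _) sm with <-≤-connex t s
    ... | inj₁ t<s = fr t (alive-≤ t<s s≤s′ al) sm
    ... | inj₂ s≤t = ≺-same (above t s≤t t<s′ pt) (same-sym {adr t} {b} sm)
    cs′ : Comps s′ b c (suc k)
    cs′ i i<n with cs i i<n
    ... | (le , lb) , zs = (le , λ j e j<i → let nk , lab = lb j e j<i in nk , lab-≤ s≤s′ lab) , zs′
      where
      zs′ : 0 < cmp b i → ∀ t → Alive t s′ → ¬ Zeroed i (adr t) b
      zs′ pos t al@(t<s′ , pt , _) zd with <-≤-connex t s
      ... | inj₁ t<s = zs pos t (alive-≤ t<s s≤s′ al) zd
      ... | inj₂ s≤t = ≺-asym (above t s≤t t<s′ pt) (zeroed-≺ zd (<-≤-trans i<n (≤-reflexive (sym l))) pos)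

  Occupied : ℕ → ℕ → Set
  Occupied b s = ∃[ t ] (Alive t s × Same (adr t) b)

  occ-snoc : ∀ {s b b′} → len b′ ≡ suc (len b) → Agree (len b) b′ b → Occ s b (len b) → Occupied b′ s →
             Occ s b′ (len b′)
  occ-snoc {s} {b} {b′} l ag oc (t , al , l′ , ag′) i pos i≤ with m≤n⇒m<n∨m≡n i≤
  ... | inj₂ refl = t , al , l′ , subst (λ z → Agree z (adr t) b′) l′ ag′
  ... | inj₁ i<l = occ-agree {b = b} {b′} (agree-sym {a = b′} ag) oc i pos (s≤s⁻¹ (subst (i <_) l i<l))

  -- Descend along outcome 0 where that address is occupied and along the last outcome otherwise, until
  -- the latter is free; f is fuel, as entries made before stage s have length at most s.
  grow : ∀ {s} (C : ℕ → Set) f b → s < len b + f → Occ s b (len b) → (∀ {c} → C c → Comps s b c (len b)) →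
         ∃₂ λ b′ k → b ⊏ b′ × 0 < cmp b′ k × (∀ {c} → C c → Slot s b′ c k)
  grow {s} C zero b lt oc cs = ⊥-elim (<-irrefl refl (<-≤-trans (subst (s <_) (+-identityʳ _) lt) (short (len b) refl)))
    where
    short : ∀ n → len b ≡ n → len b ≤ s
    short zero e = subst (_≤ s) (sym e) z≤n
    short (suc n) e with oc (len b) (subst (0 <_) (sym e) (s≤s z≤n)) ≤-refl
    ... | t , (t<s , pt , _) , l , _ = ≤-trans (≤-reflexive (sym l)) (≤-trans (len-bound t pt) t<s)
  grow {s} C (suc f) b lt oc cs with snoc b (len b) 0 | snoc b (len b) (suc (len b))
  ... | b₀ , l₀ , ag₀ , z₀ | b₁ , l₁ , ag₁ , z₁ with em {Occupied b₀ s} | em {Occupied b₁ s}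
  ... | yes o | _ =
    let b′ , k , b₀⊏ , r = grow C f b₀ (subst (s <_) (trans (+-suc (len b) f) (cong (_+ f) (sym l₀))) lt)
                             (occ-snoc l₀ ag₀ oc o) comps
    in b′ , k , ⊏-trans (subst (len b <_) (sym l₀) ≤-refl , agree-sym {a = b₀} ag₀) b₀⊏ , r
    where
    comps : ∀ {c} → C c → Comps s b₀ c (len b₀)
    comps {c} hc = subst (Comps s b₀ c) (sym l₀) (comps-snoc (comps-agree {b = b} (agree-sym {a = b₀} ag₀) (cs hc))
      ((subst (_≤ suc (len b)) (sym z₀) z≤n , λ j e → ⊥-elim (0≢1+n (trans (sym z₀) e))) ,
       λ pos → ⊥-elim (<-irrefl (sym z₀) pos)))
  ... | no ¬o₀ | o₁ = go o₁
    where
    comps : ∀ {c} → C c → Comps s b₁ c (suc (len b))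
    comps {c} hc = comps-snoc (comps-agree {b = b} (agree-sym {a = b₁} ag₁) (cs hc))
      ((≤-reflexive z₁ , λ j e j<i → ⊥-elim (<-irrefl (suc-injective (trans (sym e) z₁)) j<i)) ,
       λ _ t al (l , ag , z) → ¬o₀ (t , al , trans l (sym l₀) ,
         subst (λ n → Agree n (adr t) b₀) (sym l) (last t ag z)))
      where
      last : ∀ t → Agree (len b) (adr t) b₁ → cmp (adr t) (len b) ≡ 0 → Agree (suc (len b)) (adr t) b₀
      last t ag z i i<1+l with m≤n⇒m<n∨m≡n (s≤s⁻¹ i<1+l)
      ... | inj₁ i<l = trans (ag i i<l) (trans (ag₁ i i<l) (sym (ag₀ i i<l)))
      ... | inj₂ refl = trans z (sym z₀)
    b⊏b₁ : b ⊏ b₁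
    b⊏b₁ = subst (len b <_) (sym l₁) ≤-refl , agree-sym {a = b₁} ag₁
    go : Dec (Occupied b₁ s) → _
    go (no ¬o₁) = b₁ , len b , b⊏b₁ , subst (0 <_) (sym z₁) (s≤s z≤n) ,
      λ {c} hc → l₁ , occ-agree {b = b} {b₁} (agree-sym {a = b₁} ag₁) oc , (λ t al sm → ¬o₁ (t , al , sm)) , comps hc
    go (yes o) =
      let b′ , k , b₁⊏ , r = grow C f b₁ (subst (s <_) (trans (+-suc (len b) f) (cong (_+ f) (sym l₁))) lt)
                               (occ-snoc l₁ ag₁ oc o) (λ {c} hc → subst (Comps s b₁ c) (sym l₁) (comps hc))
      in b′ , k , ⊏-trans b⊏b₁ b₁⊏ , r

  -- The true path

  root : ℕ
  root = proj₁ (address 0 (λ _ → 0))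

  len-root : len root ≡ 0
  len-root = proj₁ (proj₂ (address 0 (λ _ → 0)))

  at-proposal : ∀ {s b c k} → adr s ≡ b → el s ≡ c → Slot s b c k → Slot s (adr s) (el s) k
  at-proposal {s} {k = k} e e′ = subst₂ (λ a d → Slot s a d k) (sym e) (sym e′)

  infinitely-often : ∀ N → ∃[ t ] (N ≤ t × Perf t)
  infinitely-often N with em {∃[ t ] (N ≤ t × Perf t)}
  ... | yes h = h
  -- A fresh element is named after its stage, which is known only when the slot is; the slot is
  -- therefore sought for all elements at once.
  ... | no none with grow {N} (λ _ → 0 ≡ 0) (suc N) root
                       (m≤n+m (suc N) (len root)) (λ i pos i≤ → ⊥-elim (<⇒≱ pos (subst (i ≤_) len-root i≤)))
                       (λ _ i i< → ⊥-elim (n≮0 (subst (i <_) len-root i<)))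
  ... | b , k , _ , pos , sl with fresh b N
  ... | t , N≤t , e , e′ = ⊥-elim (none (t , N≤t , perform (k ,
          at-proposal e refl (slot-later N≤t (sl refl) λ u N≤u _ pu → ⊥-elim (none (u , N≤u , pu))) ,
          inj₁ (subst (λ a → 0 < cmp a k) (sym e) pos , inj₁ e′))))

  -- Initial segments of the true path; outcomes are chosen as the least ones visited infinitely often.
  OnPath : ℕ → Set
  OnPath a = (∃[ N ] (∀ t → N ≤ t → Perf t → a ≺ adr t)) × (∀ N → ∃[ t ] (N ≤ t × Perf t × a ⊏ adr t))

  Head : ℕ → ℕ → Set
  Head t a = Same (adr t) a × (∀ s → t < s → Alive t s)

  root-on-path : OnPath root
  root-on-path = (0 , λ t _ pt → ⊏⇒≺ (below pt)) , λ N → let t , le , pt = infinitely-often N in t , le , pt , below pt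
    where
    below : ∀ {t} → Perf t → root ⊏ adr t
    below {t} pt = subst₂ _<_ (sym len-root) (sym (proj₁ (proj₁ (proj₂ (valid pt))))) (s≤s z≤n) ,
                   λ l l< → ⊥-elim (n≮0 (subst (l <_) len-root l<))

  uniform : ∀ {P : ℕ → ℕ → Set} B → (∀ o → o < B → ∃[ N ] (∀ t → N ≤ t → P o t)) →
            ∃[ N ] (∀ t → N ≤ t → ∀ o → o < B → P o t)
  uniform zero h = 0 , λ _ _ _ ()
  uniform {P} (suc B) h with uniform {P} B (λ o p → h o (m<n⇒m<1+n p)) | h B ≤-refl
  ... | N , hN | M , hM = N + M , λ t le o p → [ (λ o<B → hN t (≤-trans (m≤m+n N M) le) o o<B) ,
                                        (λ { refl → hM t (≤-trans (m≤n+m M N) le) }) ]′ (m≤n⇒m<n∨m≡n (s≤s⁻¹ p))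

  Often : ℕ → ℕ → Set
  Often a o = ∀ N → ∃[ t ] (N ≤ t × Perf t × a ⊏ adr t × cmp (adr t) (len a) ≡ o)

  not-often : ∀ {a o} → ¬ Often a o → ∃[ N ] (∀ t → N ≤ t → Perf t → a ⊏ adr t → ¬ cmp (adr t) (len a) ≡ o)
  not-often {a} {o} h = dne λ none → h λ N → dne λ none′ →
    none (N , λ t le pt lt e → none′ (t , le , pt , lt , e))

  some-often : ∀ {a} → OnPath a → ∃[ o ] Often a o
  some-often {a} (_ , inf) = dne λ none →
    let N , h = uniform (suc (suc (len a))) (λ o _ → not-often (λ often → none (o , often)))
        t , le , pt , lt = inf N
        k , (l , _ , _ , cs) , _ = valid pt
    in h t le _ (s≤s (proj₁ (proj₁ (cs (len a) (subst (len a <_) l (proj₁ lt)))))) pt lt refl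

  opaque
    -- When the smaller outcomes have ceased, an entry at `b` is never cancelled again and blocks a
    -- second one, so all later actions come strictly after `b`. As the outcome recurs, infinitely
    -- many of them extend `b`.
    next-on-path : ∀ {a} → OnPath a → ∃[ b ] (len b ≡ suc (len a) × Agree (len a) b a × OnPath b × (∃[ t ] Head t b))
    next-on-path {a} pa@((N₀ , h₀) , inf) with some-often pa
    ... | o′ , often′ with least (λ _ → em) o′ often′
    ... | o , often , minimal with snoc a (len a) o | uniform o (λ o′ o′<o → not-often (minimal o′ o′<o))
    ... | b , lb , ag , zb | N₁ , h₁ = b , lb , ag , (settled , inf′) , hd
      where
      M : ℕ
      M = N₀ + N₁
      l<b : len a < len b
      l<b = subst (len a <_) (sym lb) ≤-refl
      agree-b : ∀ {t} → a ⊏ adr t → cmp (adr t) (len a) ≡ o → Agree (len b) b (adr t)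
      agree-b {t} (_ , h) e i i<l with m≤n⇒m<n∨m≡n (s≤s⁻¹ (subst (i <_) lb i<l))
      ... | inj₁ p = trans (ag i p) (h i p)
      ... | inj₂ refl = trans zb (sym e)
      weak : ∀ t → M ≤ t → Perf t → Same (adr t) b ⊎ b ≺ adr t
      weak t le pt with h₀ t (≤-trans (m≤m+n N₀ N₁) le) pt
      ... | i , h , l , inj₂ (p , q) =
        inj₂ (branch (agree-trans {b = a} (agree-≤ {a = b} (<⇒≤ p) ag) h) (<-trans p l<b) l
          (subst (_< cmp (adr t) i) (sym (ag i p)) q))
      ... | .(len a) , h , l , inj₁ refl with <-cmp (cmp (adr t) (len a)) o
      ...   | tri< lt _ _ = ⊥-elim (h₁ t (≤-trans (m≤n+m N₁ N₀) le) _ lt pt (l , h) refl)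
      ...   | tri> _ _ gt = inj₂ (branch (agree-trans {b = a} ag h) l<b l (subst (_< cmp (adr t) (len a)) (sym zb) gt))
      ...   | tri≈ _ e _ with m≤n⇒m<n∨m≡n l
      ...     | inj₁ lt = inj₂ (⊏⇒≺ (subst (_< len (adr t)) (sym lb) lt , agree-b (l , h) e))
      ...     | inj₂ eq = inj₁ (same-sym {b} (trans lb eq , agree-b (l , h) e))
      settled : ∃[ N ] (∀ t → N ≤ t → Perf t → b ≺ adr t)
      settled with em {∃[ t ] (M ≤ t × Perf t × Same (adr t) b)}
      ... | no none = M , λ t le pt → [ (λ sm → ⊥-elim (none (t , le , pt , sm))) , (λ lt → lt) ]′ (weak t le pt)
      ... | yes (t₁ , M≤t₁ , p₁ , sm₁) = suc t₁ , <-rec _ λ u rec lt pu → go u rec lt pu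
        where
        go : ∀ u → (∀ {w} → w < u → suc t₁ ≤ w → Perf w → b ≺ adr w) → suc t₁ ≤ u → Perf u → b ≺ adr u
        go u rec lt pu with weak u (≤-trans M≤t₁ (<⇒≤ lt)) pu
        ... | inj₂ b≺u = b≺u
        ... | inj₁ sm = ⊥-elim (proj₁ (proj₂ (proj₂ (proj₁ (proj₂ (valid pu))))) t₁
                (lt , p₁ , λ w t₁<w w<u pw → same-≺ (same-sym {adr t₁} sm₁) (rec w<u t₁<w pw))
                (both sm₁ (same-sym {adr u} sm)))
          where
          both : ∀ {x y z} → Same x y → Same y z → Same x z
          both {x} {y} {z} (e , h) (e′ , h′) = trans e e′ , agree-trans {b = y} h (subst (λ n → Agree n y z) (sym e) h′)
      inf′ : ∀ N → ∃[ t ] (N ≤ t × Perf t × b ⊏ adr t)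
      inf′ N with often (N + proj₁ settled)
      ... | t , le , pt , lt , e = t , ≤-trans (m≤m+n N _) le , pt , len< , agree-b lt e
        where
        len< : len b < len (adr t)
        len< with m≤n⇒m<n∨m≡n (subst (_≤ len (adr t)) (sym lb) (proj₁ lt))
        ... | inj₁ p = p
        ... | inj₂ eq = ⊥-elim (≺-same (proj₂ settled t (≤-trans (m≤n+m _ N) le) pt) (eq , agree-b lt e))
      hd : ∃[ t ] Head t b
      hd with inf′ (proj₁ settled)
      ... | t , le , pt , b⊏t with valid pt
      ... | k , (l , oc , _) , _ with oc (len b) (subst (0 <_) (sym lb) (s≤s z≤n)) (s≤s⁻¹ (subst (len b <_) l (proj₁ b⊏t)))
      ... | t₀ , al , l₀ , ag₀ = t₀ , same , forever
        where
        same : Same (adr t₀) b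
        same = l₀ , subst (λ n → Agree n (adr t₀) b) (sym l₀) (agree-trans {b = adr t} ag₀ (agree-sym {a = b} (proj₂ b⊏t)))
        forever : ∀ s → t₀ < s → Alive t₀ s
        forever s t₀<s with ≤-total s t
        ... | inj₁ s≤t = alive-≤ t₀<s s≤t al
        ... | inj₂ t≤s = alive-extend t≤s al λ u t≤u _ pu →
                same-≺ (same-sym {adr t₀} same) (proj₂ settled u (≤-trans le t≤u) pu)

  node : ∀ n → ∃[ a ] (len a ≡ n × OnPath a)
  node zero = root , len-root , root-on-path
  node (suc n) =
    let a , l , pa = node n
        b , lb , _ , pb , _ = next-on-path pa
    in b , trans lb (cong suc l) , pb

  path : ℕ → ℕ
  path n = proj₁ (node n)

  len-path : ∀ n → len (path n) ≡ n
  len-path n = proj₁ (proj₂ (node n))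

  on-path : ∀ n → OnPath (path n)
  on-path n = proj₂ (proj₂ (node n))

  agree-next : ∀ n → Agree n (path (suc n)) (path n)
  agree-next n = subst (λ k → Agree k (path (suc n)) (path n)) (len-path n) (proj₁ (proj₂ (proj₂ (next-on-path (on-path n)))))

  head-exists : ∀ n → ∃[ t ] Head t (path (suc n))
  head-exists n = proj₂ (proj₂ (proj₂ (proj₂ (next-on-path (on-path n)))))

  agree-path : ∀ {m n} → m ≤ n → Agree m (path n) (path m)
  agree-path {m} {n} m≤n with m≤n⇒m<n∨m≡n m≤n
  ... | inj₂ refl = λ _ _ → refl
  agree-path {m} {suc n} _ | inj₁ m<1+n =
    agree-trans {b = path n} (agree-≤ {a = path (suc n)} (s≤s⁻¹ m<1+n) (agree-next n)) (agree-path (s≤s⁻¹ m<1+n))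

  hd : ℕ → ℕ
  hd n = proj₁ (head-exists n)

  hd-alive : ∀ n s → hd n < s → Alive (hd n) s
  hd-alive n = proj₂ (proj₂ (head-exists n))

  hd-same : ∀ n → Same (adr (hd n)) (path (suc n))
  hd-same n = proj₁ (proj₂ (head-exists n))

  hd-perf : ∀ n → Perf (hd n)
  hd-perf n = proj₁ (proj₂ (hd-alive n (suc (hd n)) ≤-refl))

  len-hd : ∀ n → len (adr (hd n)) ≡ suc n
  len-hd n = trans (proj₁ (hd-same n)) (len-path (suc n))

  hd-agree : ∀ n → Agree (suc n) (adr (hd n)) (path (suc n))
  hd-agree n = subst (λ k → Agree k (adr (hd n)) (path (suc n))) (len-hd n) (proj₂ (hd-same n))

  outcome : ℕ → ℕ
  outcome n = cmp (path (suc n)) n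

  hd-outcome : ∀ n → cmp (adr (hd n)) n ≡ outcome n
  hd-outcome n = hd-agree n n ≤-refl

  path-cmp : ∀ {i n} → i < n → cmp (path n) i ≡ outcome i
  path-cmp i<n = agree-path i<n _ ≤-refl

  hd-cmp : ∀ {i n} → i ≤ n → cmp (adr (hd n)) i ≡ outcome i
  hd-cmp {i} {n} i≤n = trans (hd-agree n i (s≤s i≤n)) (path-cmp (s≤s i≤n))

  hd-⊏ : ∀ {m n} → m < n → adr (hd m) ⊏ adr (hd n)
  hd-⊏ {m} {n} m<n = subst₂ _<_ (sym (len-hd m)) (sym (len-hd n)) (s≤s m<n) ,
    λ i i< → let i≤m = s≤s⁻¹ (subst (i <_) (len-hd m) i<) in
      trans (hd-cmp i≤m) (sym (hd-cmp (≤-trans i≤m (<⇒≤ m<n))))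

  hd-mono : ∀ {m n} → m < n → hd m < hd n
  hd-mono {m} {n} m<n with <-cmp (hd m) (hd n)
  ... | tri< lt _ _ = lt
  ... | tri≈ _ e _ = ⊥-elim (≺-irrefl (subst (λ t → adr (hd m) ≺ adr t) (sym e) (⊏⇒≺ (hd-⊏ m<n))))
  ... | tri> _ _ gt = ⊥-elim (≺-asym (⊏⇒≺ (hd-⊏ m<n))
          (alive-≺ (hd-alive n _ (m<n⇒m<1+n gt)) (alive-new (hd-perf m)) gt))

  hd≥ : ∀ n → n ≤ hd n
  hd≥ n = s≤s⁻¹ (subst (_≤ suc (hd n)) (len-hd n) (len-bound (hd n) (hd-perf n)))

  hd-never : ∀ n → Never (el (hd n))
  hd-never n s a<s with <-≤-connex (hd n) s | prior (hd-perf n)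
  ... | inj₁ lt | _ = hd n , hd-alive n s lt , refl
  ... | inj₂ s≤ | new e = ⊥-elim (<-irrefl e (<-≤-trans a<s s≤))
  ... | inj₂ s≤ | moved t al e _ _ = persist s (hd n) (t , al , e) a<s s≤

  beyond : ℕ → ℕ
  beyond n = proj₁ (proj₁ (on-path (suc n)))

  -- The source of the contradictions below: a valid proposal is performed, so after `beyond n` no
  -- opportunity before the true path can arise.
  no-smaller : ∀ n {t b} → beyond n ≤ t → Perf t → adr t ≡ b → ¬ b ≺ path (suc n)
  no-smaller n le pt refl lt = ≺-asym lt (proj₂ (proj₁ (on-path (suc n))) _ le pt)

  hd-not-out : ∀ n → Live (adr (hd n)) → ∀ s → ¬ Out (el (hd n)) s
  hd-not-out n lv s (t , al@(_ , pt , _) , e , d) with <-cmp t (hd n)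
  ... | tri≈ _ refl _ = done-live d lv
  ... | tri> _ _ gt = no-duplicate t pt (hd n) gt (sym e) (hd-alive n _ (m<n⇒m<1+n gt))
  ... | tri< lt _ _ with done-stays (hd n) (hd-perf n) pt lt e d
  ...   | k , _ , l , z , _ = done-live (k , l , z) lv

  restored-out : ∀ {s e} → 0 < π₂ e → Y s e → ∃[ t ] Out (π₁ e) t
  restored-out pos (inj₁ (z , _)) = ⊥-elim (<-irrefl (sym z) pos)
  restored-out pos (inj₂ (_ , t , _ , pt , d , w , refl)) with valid pt
  ... | k , (l , _) , inj₁ (p , _) = ⊥-elim (done-live d (k , l , p))
  ... | k , _ , inj₂ (inj₁ (_ , z , _)) = ⊥-elim (<-irrefl (sym z) w)
  ... | k , _ , inj₂ (inj₂ (_ , _ , _ , _ , q , _)) = suc t , t , alive-new pt , sym q , d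

  hd-not-restored : ∀ n {e} → Live (adr (hd n)) → 0 < π₂ e → π₁ e ≡ el (hd n) → ∀ s → ¬ Y s e
  hd-not-restored n lv pos q s y with restored-out pos y
  ... | t , o = hd-not-out n lv t (subst (λ b → Out b t) q o)

  hd-removed : ∀ n {e p} → π₁ e ≡ el (hd n) → π₂ e ≡ suc p → Rem (adr (hd n)) (π₁ p) → ¬ E e
  -- The extension has to be newer than the entry of the head and, as `Removed` demands, newer than
  -- the stage recorded in the copy.
  hd-removed n {e} {p} q ep rem@(k , l , pos , _) he with proj₂ (on-path (suc n)) (suc (hd n + π₂ (π₂ p)))
  ... | t , le , pt , lt =
    he ((suc t , inj₂ (p , ep , inj₂ (inj₂ (hd n , t , hd-alive n _ (m<n⇒m<1+n hd<t) , alive-new pt , sym q ,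
          (subst (_< len (adr t)) (sym (proj₁ (hd-same n))) (proj₁ lt) ,
           agree-trans {b = path (suc n)} (proj₂ (hd-same n))
             (subst (λ z → Agree z (path (suc n)) (adr t)) (sym (proj₁ (hd-same n))) (proj₂ lt))) ,
          rem , ≤-trans (s≤s (m≤n+m _ (hd n))) le)))) ,
        λ (s , y) → hd-not-restored n (k , l , pos) (subst (0 <_) (sym ep) (s≤s z≤n)) q s y)
    where
    hd<t : hd n < t
    hd<t = ≤-trans (s≤s (m≤m+n (hd n) _)) le

  -- E is not s-reducible to D

  settled-E : ∀ {e} → E e → ∃[ N ] (∀ s → N ≤ s → E-at s e)
  settled-E {e} he with em {∃[ s ] Y s e}
  ... | yes (s₀ , y) = s₀ , λ s le (_ , noY) → noY (s₀ , s≤s le , y)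
  ... | no noY = 0 , λ s _ ((s′ , _ , x) , _) → he ((s′ , x) , noY)

  -- After `hd n`, an entry at an initial segment of `path n` is a head. If it were to remove `e`,
  -- then `e` would indeed have left E by `hd-removed`, so `NonIg` holds for members of E.
  secure : ∀ n {y} → y ∈⁺ E → ∃[ N ] (∀ s b → N ≤ s → Agree n b (path n) → Sec s b n y)
  secure n (inj₁ refl) = 0 , λ _ _ _ _ → inj₁ refl
  secure n (inj₂ (e , refl , he)) with settled-E he
  ... | N , h = N + suc (π₁ e) + suc (hd n) , λ s b le ag →
      inj₂ (e , refl , ≤-trans (≤-trans (m≤n+m _ N) (m≤m+n _ (suc (hd n)))) le ,
            h s (≤-trans (≤-trans (m≤m+n N _) (m≤m+n _ (suc (hd n)))) le) ,
            nonig s b (≤-trans (m≤n+m _ (N + suc (π₁ e))) le) ag)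
    where
    nonig : ∀ s b → hd n < s → Agree n b (path n) → NonIg s b n e
    nonig s b hd<s ag p ep t al@(_ , pt , _) et l≤n agt rem@(i , l , pos , _) with unique-address
      where
      i<n : i < n
      i<n = subst (_≤ n) l l≤n
      hdi<s : hd i < s
      hdi<s = <-trans (hd-mono i<n) hd<s
      same : Same (adr t) (adr (hd i))
      same = trans l (sym (len-hd i)) , λ m m< →
        let m<1+i = subst (m <_) l m< in
        trans (agt m m<) (trans (ag m (<-≤-trans m< l≤n))
          (trans (path-cmp (<-≤-trans m< l≤n)) (sym (hd-cmp (s≤s⁻¹ m<1+i)))))
      unique-address : t ≡ hd i
      unique-address with <-cmp t (hd i)
      ... | tri≈ _ q _ = q
      ... | tri< lt _ _ = ⊥-elim (≺-same (alive-≺ al (hd-alive i s hdi<s) lt) same)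
      ... | tri> _ _ gt = ⊥-elim (≺-same (alive-≺ (hd-alive i s hdi<s) al gt) (same-sym {adr t} same))
    ... | refl = hd-removed i (sym et) ep rem he

  done-slot : ∀ {t s b i} → Alive t s → i < len (adr t) → 0 < cmp (adr t) i → Zeroed i b (adr t) → Slot s b (el t) i
  done-slot {t} {s} {b} {i} al i<l pos (l , ag , z) = l , occ-agree {b = adr t} {b} (agree-sym {a = b} ag)
      (λ m p m≤i → alive-closed al m p (≤-trans m≤i (<⇒≤ i<l))) , free , comps
    where
    free : ∀ u → Alive u s → ¬ Same (adr u) b
    free u au (e , h) = zero-free al i<l pos u au (trans e l ,
      (λ m m<i → trans (h m (subst (m <_) (sym (trans e l)) (m<n⇒m<1+n m<i))) (ag m m<i)) ,
      trans (h i (subst (i <_) (sym (trans e l)) ≤-refl)) z)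
    comps : Comps s b (el t) (suc i)
    comps = comps-snoc (comps-agree {b = adr t} (agree-sym {a = b} ag) (λ m m<i → entry-comps al m (<-trans m<i i<l)))
      ((subst (_≤ suc i) (sym z) z≤n , λ j e → ⊥-elim (0≢1+n (trans (sym z) e))) , λ p → ⊥-elim (<-irrefl (sym z) p))

  -- The element of a head is never dumped, so the condition of an attack stays true by `permanent`.
  -- A restoring action supplies the copy `w₁` itself, which `Y` keeps in E.
  done-head : ∀ n → cmp (adr (hd n)) n ≡ 0 →
              ¬ E (pair (el (hd n)) 0) × (∃₂ λ y m → W n (pair (el (hd n)) 0) y m × y ∈⁺ D)
  done-head n z with valid (hd-perf n)
  ... | k , (l , _) , how with suc-≡ l (len-hd n)
  ... | refl = not-in , witness how
    where
    a = el (hd n)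
    not-in : ¬ E (pair a 0)
    not-in he = he ((suc (hd n) , inj₁ (π₂-pair a 0 , hd n , alive-new (hd-perf n) , sym (π₁-pair a 0) , k , l , z)) , noY)
      where
      noY : ¬ (∃[ s ] Y s (pair a 0))
      noY (s , inj₁ (_ , a<s , none)) = none (subst (λ b → In b s) (sym (π₁-pair a 0)) (hd-never n s (subst (_< s) (π₁-pair a 0) a<s)))
      noY (s , inj₂ (p , _)) = <-irrefl (sym (π₂-pair a 0)) p
    witness : Place (hd n) k ⊎ Attack (hd n) k ⊎ Restore (hd n) k → ∃₂ λ y m → W n (pair a 0) y m × y ∈⁺ D
    witness (inj₁ (p , _)) = ⊥-elim (<-irrefl (sym z) p)
    witness (inj₂ (inj₁ (_ , _ , _ , w , inj₁ e , _))) = _ , _ , w , inj₁ e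
    witness (inj₂ (inj₁ (_ , _ , _ , w , inj₂ (e , q , _) , inj₁ e′))) = ⊥-elim (0≢1+n (trans (sym e′) q))
    witness (inj₂ (inj₁ (_ , _ , _ , w , inj₂ (e , q , a<t , et , ni) , inj₂ (e′ , q′ , pos , ne))))
      with suc-injective (trans (sym q) q′)
    ... | refl = _ , _ , w , inj₂ (e , q , permanent (hd-perf n) (hd-never n) l z a<t et ni (λ r → ⊥-elim (ne r)) , pos)
    witness (inj₂ (inj₂ (_ , h , q , _ , _ , p , ep , _ , w , _))) =
      _ , _ , w , inj₂ (w₁ (hd n) , refl , (λ (_ , noY) → noY (suc (hd n) , inj₂ (pos , hd n , ≤-refl , hd-perf n ,
        (k , l , z) , subst (0 <_) (sym q) (s≤s z≤n) , refl))) , pos)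
      where
      pos : 0 < π₂ (w₁ (hd n))
      pos = subst (0 <_) (sym ep) (s≤s z≤n)

  agree-hd-path : ∀ n → Agree n (adr (hd n)) (path n)
  agree-hd-path n i i<n = trans (hd-cmp (<⇒≤ i<n)) (sym (path-cmp i<n))

  ≺-path : ∀ {b} n → b ≺ adr (hd n) → b ≺ path (suc n)
  ≺-path {b} n (i , h , l , d) = i , agree-trans {b = adr (hd n)} h (agree-≤ {a = adr (hd n)} (<⇒≤ i<) (hd-agree n)) ,
      subst (i <_) (sym (len-path (suc n))) i< , case d
    where
    i< : i < suc n
    i< = subst (i <_) (len-hd n) l
    case : i ≡ len b ⊎ (i < len b × cmp b i < cmp (adr (hd n)) i) → i ≡ len b ⊎ (i < len b × cmp b i < cmp (path (suc n)) i)
    case (inj₁ e) = inj₁ e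
    case (inj₂ (p , q)) = inj₂ (p , subst (cmp b i <_) (hd-agree n i i<) q)

  hd-last : ∀ n → n < len (adr (hd n))
  hd-last n = subst (n <_) (sym (len-hd n)) ≤-refl

  -- A true condition becomes `Sec` at all late stages; then attacking at the outcome 0 sibling of
  -- the head would be a valid action before the true path.
  no-attack : ∀ n {y m} → 0 < cmp (adr (hd n)) n → W n (pair (el (hd n)) 0) y m → y ∈⁺ E →
              ¬ (y ≡ 0 ⊎ (∃[ e ] (y ≡ suc e × 0 < π₂ e × ¬ π₁ e ≡ el (hd n))))
  no-attack n {y} {m} pos w hy cond with secure n hy | snoc (adr (hd n)) n 0
  ... | N , sec | b , l , ag , z with move b (el (hd n)) y 0 (N + m + suc (hd n) + beyond n)
  ... | t , le , e , e′ , e₁ , e₂ = no-smaller n (≤-trans (m≤n+m _ (N + m + suc (hd n))) le) perf e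
          (≺-path n (zeroed-≺ (l , ag , z) (hd-last n) pos))
    where
    al : Alive (hd n) t
    al = hd-alive n t (≤-trans (≤-trans (m≤n+m _ (N + m)) (m≤m+n _ (beyond n))) le)
    slot : Slot t b (el (hd n)) n
    slot = done-slot al (hd-last n) pos (l , ag , z)
    perf : Perf t
    perf = perform (n , at-proposal e e′ slot , inj₂ (inj₁
      (trans (cong (λ c → cmp c n) e) z , e₂ ,
       (hd n , al , sym e′ , len-hd n , subst (Agree n (adr (hd n))) (sym e) (agree-sym {a = b} ag) , pos) ,
       subst₂ (λ c u → W n (pair c 0) u t) (sym e′) (sym e₁) (W-mono (≤-trans (≤-trans (m≤n+m m N) (≤-trans (m≤m+n _ (suc (hd n))) (m≤m+n _ (beyond n)))) le) w) ,
       subst₂ (λ c u → Sec t c n u) (sym e) (sym e₁)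
         (sec t b (≤-trans (≤-trans (m≤m+n N m) (≤-trans (m≤m+n _ (suc (hd n))) (m≤m+n _ (beyond n)))) le)
              (agree-trans {b = adr (hd n)} ag (agree-hd-path n))) ,
       subst₂ (λ u c → u ≡ 0 ⊎ (∃[ e ] (u ≡ suc e × 0 < π₂ e × ¬ π₁ e ≡ c))) (sym e₁) (sym e′) cond)))

  -- With a label, the element could leave the head for the address with outcome `suc j`, or for a
  -- free slot below it if that address is taken. Both precede the true path.
  no-label : ∀ n {j s} → suc j < cmp (adr (hd n)) n → NK (adr (hd n)) n j → ¬ Lab n j (el (hd n)) s
  no-label n {j} {s} j<o nk lab with snoc (adr (hd n)) n (suc j)
  ... | b , l , ag , z = contra (em {Occupied b s₁})
    where
    a = el (hd n)
    s₁ = s + suc (hd n) + beyond n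
    pos : 0 < cmp (adr (hd n)) n
    pos = <-trans (s≤s z≤n) j<o
    al : ∀ {t} → s₁ ≤ t → Alive (hd n) t
    al le = hd-alive n _ (≤-trans (≤-trans (m≤n+m _ s) (m≤m+n _ (beyond n))) le)
    al₁ = al ≤-refl
    n<l = hd-last n
    o≤ : cmp (adr (hd n)) n ≤ suc n
    o≤ = proj₁ (proj₁ (entry-comps al₁ n n<l))
    occ : Occ s₁ b n
    occ = occ-agree {b = adr (hd n)} {b} (agree-sym {a = b} ag) (λ m p m≤n → alive-closed al₁ m p (≤-trans m≤n (<⇒≤ n<l)))
    comps : Comps s₁ b a (suc n)
    comps = comps-snoc (comps-agree {b = adr (hd n)} (agree-sym {a = b} ag) (λ m m<n → entry-comps al₁ m (<-trans m<n n<l)))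
      ((subst (_≤ suc n) (sym z) (≤-trans (<⇒≤ j<o) o≤) , λ j′ e _ → label j′ (suc-injective (trans (sym z) e))) ,
       λ _ t au (l′ , ag′ , z′) → zero-free al₁ n<l pos t au (l′ , agree-trans {b = b} ag′ ag , z′))
      where
      label : ∀ j′ → j ≡ j′ → NK b n j′ × Lab n j′ a s₁
      label j′ refl = NK-agree {adr (hd n)} {b} (agree-sym {a = b} ag) nk ,
        lab-≤ (≤-trans (m≤m+n s (suc (hd n))) (m≤m+n _ (beyond n))) lab
    b≺ : ∀ {b′} → n < len b′ → Agree n b′ b → cmp b′ n ≡ suc j → b′ ≺ adr (hd n)
    b≺ {b′} p h q = branch (agree-trans {b = b} h ag) p n<l (subst (_< cmp (adr (hd n)) n) (sym q) j<o)
    run : ∀ {b′ k} → 0 < cmp b′ k → b′ ≺ adr (hd n) → Slot s₁ b′ a k → ⊥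
    run {b′} {k} p lt sl with move b′ a 0 0 s₁
    ... | t , le , e , e′ , _ = no-smaller n (≤-trans (m≤n+m (beyond n) (s + suc (hd n))) le) perf e (≺-path n lt)
      where
      above : ∀ u → s₁ ≤ u → u < t → Perf u → b′ ≺ adr u
      above u le′ _ pu = ≺-trans (≺-path n lt) (proj₂ (proj₁ (on-path (suc n))) u (≤-trans (m≤n+m (beyond n) (s + suc (hd n))) le′) pu)
      perf : Perf t
      perf = perform (k , at-proposal e e′ (slot-later le sl above) , inj₁ (subst (λ c → 0 < cmp c k) (sym e) p ,
        inj₂ (hd n , al le , sym e′ , (n , len-hd n , pos) , subst (_≺ adr (hd n)) (sym e) lt)))
    contra : Dec (Occupied b s₁) → ⊥
    contra (no ¬o) = run (subst (0 <_) (sym z) (s≤s z≤n)) (b≺ (subst (n <_) (sym l) ≤-refl) (λ _ _ → refl) z)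
      (l , occ , (λ t au sm → ¬o (t , au , sm)) , comps)
    contra (yes (t , au , sm)) =
      let b′ , k , (b< , h) , p , sl = grow (_≡ a) (suc s₁) b (m≤n+m (suc s₁) (len b)) occb
                                   (λ { refl → subst (Comps s₁ b a) (sym l) comps })
          n<b = subst (n <_) (sym l) ≤-refl
      in run p (b≺ (<-trans n<b b<) (agree-sym {a = b} (agree-≤ {a = b} (<⇒≤ n<b) h)) (trans (sym (h n n<b)) z)) (sl refl)
      where
      occb : Occ s₁ b (len b)
      occb i q i≤ with m≤n⇒m<n∨m≡n i≤
      ... | inj₂ refl = t , au , proj₁ sm , subst (λ c → Agree c (adr t) b) (proj₁ sm) (proj₂ sm)
      ... | inj₁ i< = occ i q (s≤s⁻¹ (subst (i <_) l i<))

  live-head : ∀ n → 0 < cmp (adr (hd n)) n →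
              E (pair (el (hd n)) 0) × (∀ {y m} → W n (pair (el (hd n)) 0) y m → ¬ y ∈⁺ D)
  live-head n pos = is-in , none
    where
    a = el (hd n)
    lv : Live (adr (hd n))
    lv = n , len-hd n , pos
    is-in : E (pair a 0)
    is-in ((s , inj₁ (_ , o)) , _) = hd-not-out n lv s (subst (λ b → Out b s) (π₁-pair a 0) o)
    is-in ((s , inj₂ (p , q , _)) , _) = 0≢1+n (trans (sym (π₂-pair a 0)) q)
    none : ∀ {y m} → W n (pair a 0) y m → ¬ y ∈⁺ D
    none w (inj₁ refl) = no-attack n pos w (inj₁ refl) (inj₁ refl)
    none {y} {m} w (inj₂ (e , refl , he , p)) with em {π₁ e ≡ a}
    ... | no ne = no-attack n pos w (inj₂ (e , refl , he)) (inj₂ (e , refl , p , ne))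
    ... | yes q = own (π₂ e) refl
      where
      own : ∀ r → π₂ e ≡ r → ⊥
      own zero r = <-irrefl (sym r) p
      own (suc r) er = hd-removed n q er (n , len-hd n , pos , λ (j<o , nk) → no-label n j<o nk
          (r , m≤n+m (suc r) m , refl , code , W-mono (m≤m+n m (suc r)) (subst (λ c → W n (pair a 0) (suc c) m) e≡ w))) he
        where
        e≡ : e ≡ pair a (suc r)
        e≡ = trans (sym (pair-π e)) (cong₂ pair q er)
        code : Code a r
        code = dne λ ¬c → he ((0 , inj₂ (r , er , inj₁ (subst (λ b → ¬ Code b r) (sym q) ¬c))) ,
                 λ (s , y) → hd-not-restored n lv p q s y)

  not-below-D : ∀ n → ¬ (∀ x → E x ⇔ (∃₂ λ y m → W n x y m × y ∈⁺ D))
  not-below-D n h with cmp (adr (hd n)) n in eq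
  ... | zero = let ni , wit = done-head n eq in ni (Equivalence.from (h _) wit)
  ... | suc o = let ii , none = live-head n (subst (0 <_) (sym eq) (s≤s z≤n))
                    y , m , w , hy = Equivalence.to (h _) ii
                in none w hy

  -- Sets s-reducible to E: the two cases for an operator

  Z : ℕ → Subset
  Z j x = ∃₂ λ y n → W j x y n × y ∈⁺ E

  Dumped : ℕ → Set
  Dumped a = ∃[ s ] (a < s × ¬ In a s)

  dumped-in : ∀ {a} → Dumped a → E (pair a 0)
  dumped-in {a} (s , a<s , none) (_ , noY) = noY (s , inj₁ (π₂-pair a 0 ,
    subst (_< s) (sym (π₁-pair a 0)) a<s , subst (λ b → ¬ In b s) (sym (π₁-pair a 0)) none))

  never : ∀ {a} → ¬ Dumped a → Never a
  never nd s a<s = dne λ none → nd (s , a<s , none)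

  not-in⇒out : ∀ {a} → ¬ E (pair a 0) → ¬ Dumped a × (∃[ s ] Out a s)
  not-in⇒out {a} ni = (λ d → ni (dumped-in d)) , dne λ none → ni λ ((s , x) , _) → go none s x
    where
    go : ¬ (∃[ s ] Out a s) → ∀ s → ¬ X s (pair a 0)
    go none s (inj₁ (_ , o)) = none (s , subst (λ b → Out b s) (π₁-pair a 0) o)
    go none s (inj₂ (p , q , _)) = 0≢1+n (trans (sym (π₂-pair a 0)) q)

  -- If `pair a 0` is not in E, then `a` is out for good and its copy must have been restored. The
  -- condition `h` checked on that occasion stays true by `permanent` and puts the element
  -- `π₁ (π₂ p)` into `Z (π₁ p)`.
  code-sound : ∀ {a p} → Code a p → E (pair a (suc p)) → Z (π₁ p) (π₁ (π₂ p))
  code-sound {a} {p} c he with em {E (pair a 0)}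
  ... | yes h = _ , _ , c , inj₂ (_ , refl , h)
  ... | no ni with not-in⇒out ni
  ... | nd , s , o = find (dne λ noY → he ((s , out⇒X (subst (λ b → Out b s) (sym (π₁-pair a (suc p))) o)) , noY))
    where
    e = pair a (suc p)
    find : ∃[ s ] Y s e → Z (π₁ p) (π₁ (π₂ p))
    find (s , inj₁ (q , _)) = ⊥-elim (0≢1+n (trans (sym q) (π₂-pair a (suc p))))
    find (s , inj₂ (_ , t , _ , pt , d , pos , q)) with valid pt
    ... | k , (l , _) , inj₁ (live , _) = ⊥-elim (done-live d (k , l , live))
    ... | k , _ , inj₂ (inj₁ (_ , z , _)) = ⊥-elim (<-irrefl (sym z) pos)
    ... | k , (l , _) , inj₂ (inj₂ (z , h , _ , sec , r , p′ , ep , _ , _ , w , u , al , eu , du , _))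
      with suc-injective (trans (sym ep) (trans (cong π₂ q) (π₂-pair a (suc p))))
    ... | refl = h , t , w , member sec
      where
      a≡ : a ≡ el t
      a≡ = trans (sym (trans (cong π₁ q) (π₁-pair a (suc p)))) r
      member : Sec t (adr t) k h → h ∈⁺ E
      member (inj₁ e) = inj₁ e
      member (inj₂ (e , e≡ , a<t , et , ni)) = inj₂ (e , e≡ ,
        permanent pt (subst Never a≡ (never nd)) l z a<t et ni (λ _ → u , al , eu , du))

  -- All entries of so large an element come after `path (suc i)`. To survive a stage that acts
  -- below this address, an entry must precede the acting one, and by convexity it then extends
  -- `path (suc i)`; later moves only go down in the order.
  below-path : ∀ i {a} → ¬ Dumped a → beyond i ≤ a → ∃[ N ] (∀ s → N ≤ s → ∃[ u ] (Alive u s × el u ≡ a × path (suc i) ⊏ adr u))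
  below-path i {a} nd le with proj₂ (on-path (suc i)) a
  ... | t , a≤t , pt , lt = suc t , λ s t<s → go s t<s (never nd s (≤-<-trans a≤t t<s))
    where
    above : ∀ {u} → Perf u → el u ≡ a → path (suc i) ≺ adr u
    above pu refl = proj₂ (proj₁ (on-path (suc i))) _ (≤-trans le (el≤ _ pu)) pu
    first : ∃[ u ] (Alive u (suc t) × el u ≡ a × path (suc i) ⊏ adr u)
    first with never nd (suc t) (s≤s a≤t)
    ... | u , al@(u<1+t , pu , hu) , e with m≤n⇒m<n∨m≡n (s≤s⁻¹ u<1+t)
    ... | inj₂ refl = u , al , e , lt
    ... | inj₁ u<t = u , al , e , ⊏-between lt (above pu e) (hu t u<t ≤-refl pt)
    go : ∀ s → t < s → In a s → ∃[ u ] (Alive u s × el u ≡ a × path (suc i) ⊏ adr u)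
    go s t<s (v , av@(_ , pv , _) , ev) with first
    ... | u , al@(u<1+t , pu , _) , e , lt′ with <-≤-connex t v
    ... | inj₂ v≤t with unique (alive-≤ (s≤s v≤t) t<s av) al (trans ev (sym e))
    ...   | refl = v , av , ev , lt′
    go s t<s (v , av@(_ , pv , _) , ev) | u , al@(u<1+t , pu , _) , e , lt′ | inj₁ t<v =
      v , av , ev , ⊏-between lt′ (above pv ev) (decrease v pv pu (<-≤-trans u<1+t t<v) (trans e (sym ev)))

  module Infinite {i j : ℕ} (o≡ : outcome i ≡ suc j) (j<i : j < i) where

    labelled : ∀ {a} → beyond i ≤ a → ¬ Dumped a → E (pair a 0) →
               ∃₂ λ p n → π₁ p ≡ j × Code a p × W i (pair a 0) (suc (pair a (suc p))) n × Z j (π₁ (π₂ p))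
    labelled {a} le nd he with below-path i nd le
    ... | N , h with h N ≤-refl
    ... | u , al , refl , (l , ag) with proj₂ (proj₁ (entry-comps al i i<l)) j
            (trans (sym (ag i (subst (i <_) (sym (len-path (suc i))) ≤-refl))) o≡) j<i
      where
      i<l : i < len (adr u)
      i<l = <-trans (subst (i <_) (sym (len-path (suc i))) ≤-refl) l
    ... | _ , p , _ , refl , c , w = p , _ , refl , c , w , (_ , _ , c , inj₂ (_ , refl , he))

    label-sound : ∀ {a p n} → beyond i ≤ a → π₁ p ≡ j → Code a p → W i (pair a 0) (suc (pair a (suc p))) n →
                  Z j (π₁ (π₂ p)) → E (pair a 0)
    label-sound {a} {p} {n} le refl c w (h , m , w′ , hh) = dne contra
      where
      contra : ¬ ¬ E (pair a 0)
      contra ni with not-in⇒out ni | secure i hh | snoc (path i) i 0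
      ... | nd , s , (v , av@(v<s , pv , _) , ev , dv) | N₁ , sec | b , lb , agb , zb with below-path i nd le
      -- The proposal restores the copy occurring in the axiom of operator `i`; the sum exceeds the
      -- stages of all facts involved. The successor in `suc h` distinguishes it from an attack,
      -- where `w₂` is 0.
      ... | N₂ , bel with move b a (pair a (suc p)) (suc h) (N₁ + N₂ + s + n + m + beyond i)
      ... | t , le′ , e , e′ , e₁ , e₂ with bel t (≤-trans (≤-trans (m≤n+m N₂ N₁) (≤-trans (m≤m+n _ s)
                (≤-trans (m≤m+n _ n) (≤-trans (m≤m+n _ m) (m≤m+n _ (beyond i)))))) le′)
      ... | u , au@(_ , pu , _) , eu , (lu , agu) = no-smaller i (≤-trans (m≤n+m (beyond i) _) le′) perf e
              (branch agb′ (subst (i <_) (sym lb) ≤-refl) (subst (i <_) (sym (len-path (suc i))) ≤-refl)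
                (subst₂ _<_ (sym zb) (sym o≡) (s≤s z≤n)))
        where
        m≤ : m ≤ t
        m≤ = ≤-trans (≤-trans (m≤n+m m _) (m≤m+n _ (beyond i))) le′
        n≤ : n ≤ t
        n≤ = ≤-trans (≤-trans (m≤n+m n _) (≤-trans (m≤m+n _ m) (m≤m+n _ (beyond i)))) le′
        s≤ : s ≤ t
        s≤ = ≤-trans (≤-trans (m≤n+m s _) (≤-trans (m≤m+n _ n) (≤-trans (m≤m+n _ m) (m≤m+n _ (beyond i))))) le′
        N₁≤ : N₁ ≤ t
        N₁≤ = ≤-trans (≤-trans (m≤m+n N₁ N₂) (≤-trans (m≤m+n _ s) (≤-trans (m≤m+n _ n)
                (≤-trans (m≤m+n _ m) (m≤m+n _ (beyond i)))))) le′
        agb′ : Agree i b (path (suc i))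
        agb′ = agree-trans {b = path i} agb (agree-sym {a = path (suc i)} (agree-next i))
        i<p : i < len (path (suc i))
        i<p = subst (i <_) (sym (len-path (suc i))) ≤-refl
        i<u : i < len (adr u)
        i<u = <-trans i<p lu
        cu : cmp (adr u) i ≡ suc j
        cu = trans (sym (agu i i<p)) o≡
        agbu : Agree i b (adr u)
        agbu = agree-trans {b = path (suc i)} agb′ (agree-≤ {a = path (suc i)} (<⇒≤ i<p) agu)
        du : Done (adr u)
        du with m≤n⇒m<n∨m≡n (after pv (<-≤-trans v<s s≤) au (trans ev (sym eu)))
        ... | inj₂ refl = dv
        ... | inj₁ v<u with done-stays u pu pv v<u (trans ev (sym eu)) dv
        ...   | k , _ , l , z , _ = k , l , z
        slot : Slot t b a i
        slot = subst (λ d → Slot t b d i) eu (done-slot au i<u (subst (0 <_) (sym cu) (s≤s z≤n)) (lb , agbu , zb))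
        perf : Perf t
        perf = perform (i , at-proposal e e′ slot , inj₂ (inj₂
          (trans (cong (λ d → cmp d i) e) zb , h , e₂ , subst (λ d → Sec t d i h) (sym e) (sec t b N₁≤ agb) ,
           trans (trans (cong π₁ e₁) (π₁-pair a (suc p))) (sym e′) ,
           p , trans (cong π₂ e₁) (π₂-pair a (suc p)) , subst (λ d → Code d p) (sym e′) c ,
           subst₂ (λ d r → W i (pair d 0) (suc r) t) (sym e′) (sym e₁) (W-mono n≤ w) , W-mono m≤ w′ ,
           u , au , trans eu (sym e′) , du , i<u , subst (Agree i (adr u)) (sym e) (agree-sym {a = b} agbu) , cu)))

  module Finite {j : ℕ} (fin : ∀ i → outcome i ≡ suc j → i ≤ j) where

    -- `Comps` demands `NK` for a label outcome, which excludes an earlier use of the same label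
    -- above level `o`.
    once : ∀ {i i′ o} → i′ < i → outcome i ≡ suc o → outcome i′ ≡ suc o → ¬ o < i′
    once {i} {i′} {o} i′<i e e′ o<i′ = <-irrefl refl (<-≤-trans o<i′
      (proj₁ (proj₂ (proj₁ (entry-comps (alive-new (hd-perf i)) i (hd-last i))) o (trans (hd-outcome i) e) (<-trans o<i′ i′<i))
        i′ i′<i (trans (hd-cmp (<⇒≤ i′<i)) e′)))

    smaller-rare : ∀ n → ∃[ I ] (∀ i → I < i → ∀ o → o < n → ¬ outcome i ≡ suc o)
    smaller-rare zero = 0 , λ _ _ _ ()
    smaller-rare (suc n) with smaller-rare n | em {∃[ i ] (n < i × outcome i ≡ suc n)}
    ... | I , h | no none = I + n , λ i I<i o o<1+n e → [ (λ o<n → h i (≤-<-trans (m≤m+n I n) I<i) o o<n e) ,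
            (λ { refl → none (i , ≤-<-trans (m≤n+m n I) I<i , e) }) ]′ (m≤n⇒m<n∨m≡n (s≤s⁻¹ o<1+n))
    ... | I , h | yes (i₀ , n<i₀ , e₀) = I + i₀ , λ i I<i o o<1+n e → [ (λ o<n → h i (≤-<-trans (m≤m+n I i₀) I<i) o o<n e) ,
            (λ { refl → once (≤-<-trans (m≤n+m i₀ I) I<i) e e₀ n<i₀ }) ]′ (m≤n⇒m<n∨m≡n (s≤s⁻¹ o<1+n))

    -- Far down the path every positive outcome exceeds `suc j`: smaller label outcomes have ceased
    -- by `once`, and `suc j` itself by `fin`. The latter also gives `NK`.
    rarely-removed : ∃[ I ] (∀ i → I < i → ¬ Rem (adr (hd i)) j)
    rarely-removed with smaller-rare j
    ... | I , h = I + j , λ i I<i (k , l , pos , nkeep) → go i I<i k (suc-≡ l (len-hd i)) pos nkeep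
      where
      go : ∀ i → I + j < i → ∀ k → k ≡ i → 0 < cmp (adr (hd i)) k → ¬ (suc j < cmp (adr (hd i)) k × NK (adr (hd i)) k j) → ⊥
      go i I<i .i refl pos nkeep = nkeep (big , λ i′ i′<i e → fin i′ (trans (sym (hd-cmp (<⇒≤ i′<i))) e))
        where
        big : suc j < cmp (adr (hd i)) i
        big with cmp (adr (hd i)) i in eq
        ... | zero = ⊥-elim (<-irrefl refl pos)
        ... | suc o with <-cmp j o
        ...   | tri< lt _ _ = s≤s lt
        ...   | tri≈ _ refl _ = ⊥-elim (<⇒≱ (≤-<-trans (m≤n+m j I) I<i) (fin i (trans (sym (hd-outcome i)) eq)))
        ...   | tri> _ _ gt = ⊥-elim (h i (≤-<-trans (m≤m+n I j) I<i) o gt (trans (sym (hd-outcome i)) eq))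

    -- Larger than every element held by one of the finitely many heads that may remove copies for
    -- `j`.
    threshold : ℕ
    threshold = suc (hd (proj₁ rarely-removed))

    -- The final entry of `a` is either a head that keeps the copies for `j`, or it is not extended
    -- after stage `M`, so that a copy carrying stage `M` is out of reach of `Removed`.
    coded : ∀ {a x n} → threshold ≤ a → E (pair a 0) → ¬ Dumped a → W j x (suc (pair a 0)) n →
            ∃[ m ] (Code a (pair j (pair x m)) × E (pair a (suc (pair j (pair x m)))))
    coded {a} {x} {n} th≤a he nd w = M , code , λ ((s , xs) , _) → not-removed s xs
      where
      μ = hd a
      -- Past the axiom, past the stage `μ` from which on `a` keeps its entry, and past the last
      -- action not after `path (suc a)`.
      M = n + suc (suc μ) + beyond a
      p = pair j (pair x M)
      j≡ : π₁ p ≡ j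
      j≡ = π₁-pair j (pair x M)
      x≡ : π₁ (π₂ p) ≡ x
      x≡ = trans (cong π₁ (π₂-pair j (pair x M))) (π₁-pair x M)
      M≡ : π₂ (π₂ p) ≡ M
      M≡ = trans (cong π₂ (π₂-pair j (pair x M))) (π₂-pair x M)
      code : Code a p
      code = subst (λ c → c) (sym (cong₂ (λ (y , z) k → W y z (suc (pair a 0)) k) (cong₂ _,_ j≡ x≡) M≡))
               (W-mono (≤-trans (m≤m+n n (suc (suc μ))) (m≤m+n _ (beyond a))) w)
      a<μ : a ≤ μ
      a<μ = hd≥ a
      -- Since `a ≤ μ` and the element of `hd a` is never dumped, `old-fixed` stops `a` from moving
      -- after `μ`.
      fixed : ∃[ u ] (el u ≡ a × (∀ s v → μ < s → Alive v s → el v ≡ a → v ≡ u) × (u ≡ μ ⊎ (Alive u (suc μ) × adr u ≺ adr μ)))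
      fixed with never nd (suc μ) (s≤s a<μ)
      ... | u , au@(u<1+μ , pu , hu) , eu = u , eu , same , pos
        where
        pos : u ≡ μ ⊎ (Alive u (suc μ) × adr u ≺ adr μ)
        pos with m≤n⇒m<n∨m≡n (s≤s⁻¹ u<1+μ)
        ... | inj₂ q = inj₁ q
        ... | inj₁ u<μ = inj₂ (au , hu μ u<μ ≤-refl (hd-perf a))
        same : ∀ s v → μ < s → Alive v s → el v ≡ a → v ≡ u
        same s v μ<s av@(_ , pv , _) ev with <-≤-connex μ v
        ... | inj₂ v≤μ = unique (alive-≤ (s≤s v≤μ) μ<s av) au (trans ev (sym eu))
        ... | inj₁ μ<v with el v ≟ el μ
        ...   | yes q = ⊥-elim (no-duplicate v pv μ μ<v (sym q) (hd-alive a _ (m<n⇒m<1+n μ<v)))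
        ...   | no ne with m≤n⇒m<n∨m≡n a<μ
        ...     | inj₁ a<μ′ = ⊥-elim (<⇒≱ a<μ′ (subst (μ ≤_) ev (old-fixed (hd-perf a) (hd-never a) v pv μ<v ne)))
        ...     | inj₂ a≡μ with m≤n⇒m<n∨m≡n (s≤s⁻¹ u<1+μ)
        ...       | inj₂ u≡μ = ⊥-elim (ne (trans ev (trans (sym eu) (cong el u≡μ))))
        ...       | inj₁ u<μ = ⊥-elim (<-irrefl a≡μ (≤-<-trans (subst (_≤ u) eu (el≤ u pu)) u<μ))
      u = proj₁ fixed
      eu = proj₁ (proj₂ fixed)
      only = proj₁ (proj₂ (proj₂ fixed))
      not-hd : ∀ i → u ≡ hd i → Rem (adr u) j → ⊥
      not-hd i q rem with <-≤-connex (proj₁ rarely-removed) i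
      ... | inj₁ I<i = proj₂ rarely-removed i I<i (subst (λ v → Rem (adr v) j) q rem)
      ... | inj₂ i≤I = <⇒≱ th≤a (subst (_≤ hd (proj₁ rarely-removed)) (trans (cong el (sym q)) eu) (≤-trans (el≤ (hd i) (hd-perf i)) (hd-≤ i≤I)))
        where
        hd-≤ : ∀ {m n} → m ≤ n → hd m ≤ hd n
        hd-≤ {m} {n} m≤n with m≤n⇒m<n∨m≡n m≤n
        ... | inj₁ lt = <⇒≤ (hd-mono lt)
        ... | inj₂ refl = ≤-refl
      not-removed : ∀ s → ¬ X s (pair a (suc p))
      not-removed s (inj₁ (z , _)) = 0≢1+n (trans (sym z) (π₂-pair a (suc p)))
      not-removed s (inj₂ (q , eq , rest)) with suc-injective (trans (sym eq) (π₂-pair a (suc p)))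
      ... | refl = go rest
        where
        a≡ : π₁ (pair a (suc p)) ≡ a
        a≡ = π₁-pair a (suc p)
        go : _ → ⊥
        go (inj₁ ¬c) = ¬c (subst (λ b → Code b p) (sym a≡) code)
        go (inj₂ (inj₁ o)) = he ((s , inj₁ (π₂-pair a 0 , subst (λ b → Out b s) (trans a≡ (sym (π₁-pair a 0))) o)) , noY)
          where
          noY : ¬ (∃[ s ] Y s (pair a 0))
          noY (s , inj₁ (_ , a<s , none)) = nd (s , subst (_< s) (π₁-pair a 0) a<s , subst (λ b → ¬ In b s) (π₁-pair a 0) none)
          noY (s , inj₂ (pos , _)) = <-irrefl (sym (π₂-pair a 0)) pos
        go (inj₂ (inj₂ (t , t′ , at , at′@(t′<s , pt′ , _) , et , lt , rem , M<t′))) = contra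
          where
          M<t″ : M < t′
          M<t″ = subst (_< t′) M≡ M<t′
          μ<s : μ < s
          μ<s = <-trans (≤-trans (≤-trans (n≤1+n _) (≤-trans (m≤n+m _ n) (m≤m+n _ (beyond a)))) (<⇒≤ M<t″)) t′<s
          t≡u : t ≡ u
          t≡u = only s t μ<s at (trans et a≡)
          rem′ : Rem (adr u) j
          rem′ = subst₂ (λ v k → Rem (adr v) k) t≡u j≡ rem
          contra : ⊥
          contra with proj₂ (proj₂ (proj₂ fixed))
          ... | inj₁ q = not-hd a q rem′
          ... | inj₂ (au , u≺μ) = not-hd i (same-entry i<a) rem′
            where
            u⊏t′ : adr u ⊏ adr t′
            u⊏t′ = subst (λ v → adr v ⊏ adr t′) t≡u lt
            u≺path : adr u ≺ path (suc a)
            u≺path = ≺-path a u≺μ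
            path≺t′ : path (suc a) ≺ adr t′
            path≺t′ = proj₂ (proj₁ (on-path (suc a))) t′ (≤-trans (m≤n+m (beyond a) _) (<⇒≤ M<t″)) pt′
            -- A removal after `M` squeezes the true path between `adr u` and its extension
            -- `adr t′`; thus `u` sits on the path and, by uniqueness of entries at an address, is a
            -- head.
            u⊏path : adr u ⊏ path (suc a)
            u⊏path = ⊏-between u⊏t′ u≺path path≺t′
            i = proj₁ rem′
            lu : len (adr u) ≡ suc i
            lu = proj₁ (proj₂ rem′)
            i<a : i < a
            i<a = s≤s⁻¹ (subst₂ _<_ lu (len-path (suc a)) (proj₁ u⊏path))
            same-entry : i < a → u ≡ hd i
            same-entry i<a with <-cmp u (hd i)
            ... | tri≈ _ q _ = q
            ... | tri< lt′ _ _ = ⊥-elim (≺-same (alive-≺ au ai lt′) sm)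
              where
              ai = hd-alive i (suc μ) (<-trans (hd-mono i<a) ≤-refl)
              sm : Same (adr u) (adr (hd i))
              sm = trans lu (sym (len-hd i)) , λ m m< → trans (proj₂ u⊏path m m<)
                (trans (path-cmp (<-trans (subst (m <_) lu m<) (s≤s i<a))) (sym (hd-cmp (s≤s⁻¹ (subst (m <_) lu m<)))))
            ... | tri> _ _ gt = ⊥-elim (≺-same (alive-≺ ai au gt) (same-sym {adr u} sm))
              where
              ai = hd-alive i (suc μ) (<-trans (hd-mono i<a) ≤-refl)
              sm : Same (adr u) (adr (hd i))
              sm = trans lu (sym (len-hd i)) , λ m m< → trans (proj₂ u⊏path m m<)
                (trans (path-cmp (<-trans (subst (m <_) lu m<) (s≤s i<a))) (sym (hd-cmp (s≤s⁻¹ (subst (m <_) lu m<)))))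

-- Complexity of D and E, the reductions and the minimal cover

module Classical (em : ExcludedMiddle 0ℓ) where

  open Verification em

  -- The complement is the difference of the c.e. sets given by `φ` and `ψ`. The disjunction of
  -- `∃ ψ` and `∀ ¬ φ` can be prenexed in both orders, which yields the two second-level forms.
  limit-set : ∀ {A : Subset} (φ ψ : Fm 2) →
    (∀ e → A e ⇔ (¬ ((∃[ k ] Holds φ (k ∷ e ∷ [])) × ¬ (∃[ k ] Holds ψ (k ∷ e ∷ []))))) →
    Co-2-CE A × Δ⁰₂ A
  limit-set {A} φ ψ h = (V φ , V ψ , ce φ (λ _ → mk⇔ (λ v → v) (λ v → v)) , ce ψ (λ _ → mk⇔ (λ v → v) (λ v → v)) ,
      (λ {e} ¬a → dne λ k → ¬a (from (h e) k)) , (λ {e} d a → to (h e) a d)) ,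
    (Holds σ , computable σ , λ e → mk⇔ (σ→ e) (λ (y , g) → from (h e) λ ((k , p) , noψ) → [ (λ q → noψ (y , q)) , (λ ¬p → ¬p p) ]′ (g k))) ,
    (Holds π , computable π , λ e → mk⇔ (π→ e) (λ g → from (h e) λ ((k , p) , noψ) → let z , d = g k in
      [ (λ ¬p → ¬p p) , (λ q → noψ (z , q)) ]′ d))
    where
    V : Fm 2 → Subset
    V χ e = ∃[ k ] Holds χ (k ∷ e ∷ [])
    σ π : Fm 3
    σ = call ψ (#1 ∷ #0 ∷ []) ∨ᶠ ¬ᶠ call φ (#2 ∷ #0 ∷ [])
    π = ¬ᶠ call φ (#1 ∷ #0 ∷ []) ∨ᶠ call ψ (#2 ∷ #0 ∷ [])
    σ→ : ∀ e → A e → ∃[ y ] (∀ z → Holds σ (e ∷ y ∷ z ∷ []))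
    σ→ e a with em {V ψ e}
    ... | yes (y , q) = y , λ _ → inj₁ q
    ... | no noψ = 0 , λ z → inj₂ (λ p → to (h e) a ((z , p) , noψ))
    π→ : ∀ e → A e → ∀ y → ∃[ z ] Holds π (e ∷ y ∷ z ∷ [])
    π→ e a y with em {V ψ e}
    ... | yes (z , q) = z , inj₂ q
    ... | no noψ = 0 , inj₁ (λ p → to (h e) a ((y , p) , noψ))

  X∃ Y∃ : Fm 2
  X∃ = call xFm (app histF (#0 ∷ []) ∷ #0 ∷ #1 ∷ [])
  Y∃ = call yFm (app histF (#0 ∷ []) ∷ #0 ∷ #1 ∷ [])

  X∃⇌ : ∀ {s e} → Holds X∃ (s ∷ e ∷ []) ⇌ X s e
  X∃⇌ {s} {e} = Transfer.X⇌ s {s} {e} ≤-refl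

  Y∃⇌ : ∀ {s e} → Holds Y∃ (s ∷ e ∷ []) ⇌ Y s e
  Y∃⇌ {s} {e} = Transfer.Y⇌ s {s} {e} ≤-refl

  E-limit : Co-2-CE E × Δ⁰₂ E
  E-limit = limit-set X∃ Y∃ λ e → mk⇔
    (λ he ((s , x) , noY) → he ((s , proj₁ X∃⇌ x) , λ (t , y) → noY (t , proj₂ Y∃⇌ y)))
    (λ h ((s , x) , noY) → h ((s , proj₂ X∃⇌ x) , λ (t , y) → noY (t , proj₁ Y∃⇌ y)))

  D-limit : Co-2-CE D × Δ⁰₂ D
  D-limit = limit-set (X∃ ∨ᶠ Snd #1 ≈ᶠ lit 0) (Y∃ ∧ᶠ lit 0 <ᶠ Snd #1) λ e → mk⇔ (D→ e) (D← e)
    where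
    D→ : ∀ e → D e → ¬ ((∃[ s ] (Holds X∃ (s ∷ e ∷ []) ⊎ π₂ e ≡ 0)) × ¬ (∃[ s ] (Holds Y∃ (s ∷ e ∷ []) × 0 < π₂ e)))
    D→ e (he , p) ((s , inj₁ x) , noY) = he ((s , proj₁ X∃⇌ x) , λ (t , y) → noY (t , proj₂ Y∃⇌ y , p))
    D→ e (he , p) ((s , inj₂ z) , noY) = <-irrefl (sym z) p
    D← : ∀ e → ¬ ((∃[ s ] (Holds X∃ (s ∷ e ∷ []) ⊎ π₂ e ≡ 0)) × ¬ (∃[ s ] (Holds Y∃ (s ∷ e ∷ []) × 0 < π₂ e))) → D e
    D← e h = (λ ((s , x) , noY) → h ((s , inj₁ (proj₂ X∃⇌ x)) , λ (t , y , _) → noY (t , proj₁ Y∃⇌ y))) ,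
             n≢0⇒n>0 (λ z → h ((0 , inj₂ z) , λ (_ , _ , p) → <-irrefl (sym z) p))

  D≤E : D ≤ₛ E
  D≤E = ≤ₛ-fm (#2 ≈ᶠ Suc #1 ∧ᶠ lit 0 <ᶠ Snd #1) λ x → mk⇔
    (λ (he , p) → suc x , 0 , (refl , p) , inj₂ (x , refl , he))
    (λ { (_ , _ , (refl , p) , inj₂ (.x , refl , he)) → he , p })

  E≰D : ¬ E ≤ₛ D
  E≰D le = let n , h = ≤ₛ-index le in not-below-D n h

  -- Finitely many elements are outside the reach of the uniform arguments; their membership is put
  -- into the reduction as a constant.
  table : ∀ N → ∃[ c ] (∀ a → a < N → nth c a ≡ 1 ⇔ E (pair a 0))
  table N with encode N (λ a → χ (em {E (pair a 0)}))
  ... | c , h = c , λ a a<N → mk⇔ (λ e → χ⇒ em (trans (sym (h a a<N)) e)) (λ he → trans (h a a<N) (⇒χ em he))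

  dumped-Y : ∀ {a s} → a < s → ¬ In a s → Y s (pair a 0)
  dumped-Y {a} {s} a<s none = inj₁ (π₂-pair a 0 , subst (_< s) (sym (π₁-pair a 0)) a<s ,
    subst (λ b → ¬ In b s) (sym (π₁-pair a 0)) none)

  Y-in : ∀ {s e} → Y s e → E e
  Y-in y (_ , noY) = noY (_ , y)

  a-part : ∀ {x} → π₂ x ≡ 0 → pair (π₁ x) 0 ≡ x
  a-part {x} z = trans (cong (pair (π₁ x)) (sym z)) (pair-π x)

  module Reductions (Z : Subset) (j : ℕ) (hZ : ∀ x → Z x ⇔ (∃₂ λ y n → W j x y n × y ∈⁺ E)) where

    -- Copies are handled by `D ≤ₛ Z`, small elements by the table, dumped ones by their c.e. event
    -- and the others by labels. Being dumped need not be decided, as `label-sound` holds for dumped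
    -- elements too.
    above : ∀ i → outcome i ≡ suc j → j < i → D ≤ₛ Z → E ≤ₛ Z
    above i o≡ j<i D≤Z with ≤ₛ-index D≤Z | table (beyond i)
    ... | θ , hD | c , hc = ≤ₛ-fm φ λ x → mk⇔ (E→ x) (E← x)
      where
      N = beyond i
      open Infinite o≡ j<i
      labelFm : Fm 3
      labelFm = ∃ᶠ #0 (#3 ≈ᶠ Suc (Fst (Snd #0)) ∧ᶠ Fst #0 ≈ᶠ lit j ∧ᶠ call codeFm (Fst #2 ∷ #0 ∷ []) ∧ᶠ
        call WFm (lit i ∷ Pair (Fst #2) (lit 0) ∷ Suc (Pair (Fst #2) (Suc #0)) ∷ #1 ∷ []))
      φ : Fm 3
      φ = (lit 0 <ᶠ Snd #1 ∧ᶠ call WFm (lit θ ∷ #1 ∷ #2 ∷ #0 ∷ [])) ∨ᶠ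
          (Snd #1 ≈ᶠ lit 0 ∧ᶠ ((#2 ≈ᶠ lit 0 ∧ᶠ Fst #1 <ᶠ lit N ∧ᶠ Nth (lit c) (Fst #1) ≈ᶠ lit 1) ∨ᶠ
            (#2 ≈ᶠ lit 0 ∧ᶠ call Y∃ (#0 ∷ #1 ∷ [])) ∨ᶠ (lit N ≤ᶠ Fst #1 ∧ᶠ labelFm)))
      E→ : ∀ x → E x → ∃₂ λ y n → Holds φ (n ∷ x ∷ y ∷ []) × y ∈⁺ Z
      E→ x he = case (π₂ x) refl
        where
        case : ∀ m → π₂ x ≡ m → ∃₂ λ y n → Holds φ (n ∷ x ∷ y ∷ []) × y ∈⁺ Z
        case (suc m) q = let p = subst (0 <_) (sym q) (s≤s z≤n)
                             y , n , w , hy = to (hD x) (he , p)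
                         in y , n , inj₁ (p , W⇒ w) , hy
        case zero z with <-≤-connex (π₁ x) N | em {Dumped (π₁ x)}
        ... | inj₁ a<N | _ = 0 , 0 , inj₂ (z , inj₁ (refl , a<N , from (hc (π₁ x) a<N) (subst E (sym (a-part z)) he))) , inj₁ refl
        ... | inj₂ _ | yes (s , a<s , none) =
          0 , s , inj₂ (z , inj₂ (inj₁ (refl , proj₂ Y∃⇌ (subst (Y s) (a-part z) (dumped-Y a<s none))))) , inj₁ refl
        ... | inj₂ N≤a | no nd with labelled N≤a nd (subst E (sym (a-part z)) he)
        ...   | p , n , j≡ , code , w , hz = suc (π₁ (π₂ p)) , suc p + n ,
                inj₂ (z , inj₂ (inj₂ (s≤s N≤a , p , m≤m+n (suc p) n , refl , j≡ , proj₂ code⇌ code , W⇒ (W-mono (m≤n+m n (suc p)) w)))) ,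
                inj₂ (_ , refl , from (hZ _) hz)
      E← : ∀ x → (∃₂ λ y n → Holds φ (n ∷ x ∷ y ∷ []) × y ∈⁺ Z) → E x
      E← x (y , n , inj₁ (p , w) , hy) = proj₁ (from (hD x) (y , n , ⇒W w , hy))
      E← x (y , n , inj₂ (z , inj₁ (_ , a<N , e)) , _) = subst E (a-part z) (to (hc (π₁ x) a<N) e)
      E← x (y , n , inj₂ (z , inj₂ (inj₁ (_ , d))) , _) = Y-in {n} {x} (proj₁ Y∃⇌ d)
      E← x (y , n , inj₂ (z , inj₂ (inj₂ (_ , p , _ , refl , _ , _ , _))) , inj₁ ())
      E← x (y , n , inj₂ (z , inj₂ (inj₂ (N≤a , p , _ , refl , j≡ , code , w))) , inj₂ (_ , refl , hz)) =
        subst E (a-part z) (label-sound (s≤s⁻¹ N≤a) j≡ (proj₁ code⇌ code) (⇒W w) (to (hZ _) hz))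

    -- A condition that is already a copy is kept, one on a small or dumped element becomes empty,
    -- and `coded` supplies a copy for the rest. The operator may accept every copy for `j` and `x`,
    -- whatever its stage, because `code-sound` makes each of them correct.
    below : (∀ i → outcome i ≡ suc j → i ≤ j) → Z ≤ₛ D
    below fin with table (Finite.threshold fin)
    ... | c , hc = ≤ₛ-fm φ λ x → mk⇔ (λ z → Z→ x (to (hZ x) z)) (λ h → from (hZ x) (Z← x h))
      where
      open Finite fin
      N = threshold
      baseFm codedFm φ : Fm 3
      baseFm = ∃ᶠ #0 (call WFm (lit j ∷ #2 ∷ Suc (Pair #0 (lit 0)) ∷ #1 ∷ []) ∧ᶠ
        ((#0 <ᶠ lit N ∧ᶠ Nth (lit c) #0 ≈ᶠ lit 1) ∨ᶠ call Y∃ (#1 ∷ Pair #0 (lit 0) ∷ [])))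
      codedFm = ∃ᶠ #2 (#3 ≈ᶠ Suc #0 ∧ᶠ (call WFm (lit j ∷ #2 ∷ #3 ∷ #1 ∷ []) ∨ᶠ
        ∃ᶠ #1 (Snd #1 ≈ᶠ Suc (Pair (lit j) (Pair #3 #0)) ∧ᶠ call codeFm (Fst #1 ∷ Pair (lit j) (Pair #3 #0) ∷ []))))
      φ = (#2 ≈ᶠ lit 0 ∧ᶠ (call WFm (lit j ∷ #1 ∷ lit 0 ∷ #0 ∷ []) ∨ᶠ baseFm)) ∨ᶠ codedFm
      ZE : ℕ → Set
      ZE x = ∃₂ λ y n → W j x y n × y ∈⁺ E
      Z→ : ∀ x → ZE x → ∃₂ λ y n → Holds φ (n ∷ x ∷ y ∷ []) × y ∈⁺ D
      Z→ x (.0 , n , w , inj₁ refl) = 0 , n , inj₁ (refl , inj₁ (W⇒ w)) , inj₁ refl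
      Z→ x (.(suc e) , n , w , inj₂ (e , refl , he)) = case (π₂ e) refl
        where
        case : ∀ m → π₂ e ≡ m → ∃₂ λ y n → Holds φ (n ∷ x ∷ y ∷ []) × y ∈⁺ D
        case (suc m) q = suc e , n , inj₂ (e , ≤-refl , refl , inj₁ (W⇒ w)) , inj₂ (e , refl , he , subst (0 <_) (sym q) (s≤s z≤n))
        case zero z = go (<-≤-connex a N) em
          where
          a = π₁ e
          e≡ : e ≡ pair a 0
          e≡ = sym (a-part z)
          w′ : ∀ k → W j x (suc (pair a 0)) (k + n)
          w′ k = W-mono (m≤n+m n k) (subst (λ d → W j x (suc d) n) e≡ w)
          go : a < N ⊎ N ≤ a → Dec (Dumped a) → ∃₂ λ y n → Holds φ (n ∷ x ∷ y ∷ []) × y ∈⁺ D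
          go (inj₁ a<N) _ = 0 , suc a + n , inj₁ (refl , inj₂ (a , m≤m+n (suc a) n , W⇒ (w′ (suc a)) ,
            inj₁ (a<N , from (hc a a<N) (subst E e≡ he)))) , inj₁ refl
          go (inj₂ _) (yes (s , a<s , none)) = 0 , s + n , inj₁ (refl , inj₂ (a , <-≤-trans a<s (m≤m+n s n) , W⇒ (w′ s) ,
            inj₂ (proj₂ Y∃⇌ (dumped-Y (<-≤-trans a<s (m≤m+n s n)) (λ i → none (persist s (s + n) i a<s (m≤m+n s n)))))))  , inj₁ refl
          go (inj₂ N≤a) (no nd) with coded N≤a (subst E e≡ he) nd (w′ 0)
          ... | m , code , hr = suc (pair a (suc p)) , suc m ,
                inj₂ (pair a (suc p) , ≤-refl , refl , inj₂ (m , ≤-refl , π₂-pair a (suc p) ,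
                  proj₂ code⇌ (subst (λ b → Code b p) (sym (π₁-pair a (suc p))) code))) ,
                inj₂ (_ , refl , hr , subst (0 <_) (sym (π₂-pair a (suc p))) (s≤s z≤n))
            where
            p = pair j (pair x m)
      Z← : ∀ x → (∃₂ λ y n → Holds φ (n ∷ x ∷ y ∷ []) × y ∈⁺ D) → ZE x
      Z← x (y , n , inj₁ (_ , inj₁ w) , _) = 0 , n , ⇒W w , inj₁ refl
      Z← x (y , n , inj₁ (_ , inj₂ (a , _ , w , inj₁ (a<N , e))) , _) = _ , n , ⇒W w , inj₂ (_ , refl , to (hc a a<N) e)
      Z← x (y , n , inj₁ (_ , inj₂ (a , _ , w , inj₂ d)) , _) = _ , n , ⇒W w , inj₂ (_ , refl , Y-in {n} (proj₁ Y∃⇌ d))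
      Z← x (y , n , inj₂ (e , _ , refl , _) , inj₁ ())
      Z← x (y , n , inj₂ (e , _ , refl , inj₁ w) , inj₂ (_ , refl , he , _)) = _ , n , ⇒W w , inj₂ (e , refl , he)
      Z← x (y , n , inj₂ (e , _ , refl , inj₂ (m , _ , q , code)) , inj₂ (_ , refl , he , _)) =
        subst₂ (λ i z → ∃₂ λ y n → W i z y n × y ∈⁺ E) (π₁-pair j _)
          (trans (cong π₁ (π₂-pair j (pair x m))) (π₁-pair x m))
          (code-sound (proj₁ code⇌ code) (subst E (trans (sym (pair-π e)) (cong (pair (π₁ e)) q)) he))

  minimal-cover : ¬ (∃ λ (Z : Subset) → D <ₛ Z × Z <ₛ E)
  minimal-cover (Z , (D≤Z , Z≰D) , (Z≤E , E≰Z)) with ≤ₛ-index Z≤E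
  ... | j , hZ with em {∃[ i ] (outcome i ≡ suc j × j < i)}
  ... | yes (i , o≡ , j<i) = E≰Z (Reductions.above Z j hZ i o≡ j<i D≤Z)
  ... | no none = Z≰D (Reductions.below Z j hZ λ i o≡ → ≮⇒≥ λ j<i → none (i , o≡ , j<i))

theorem2p2 : ExcludedMiddle 0ℓ →
    ∃₂ λ (D E : Subset) →
    (Δ⁰₂ D × Δ⁰₂ E) ×
    (Co-2-CE D × Co-2-CE E) ×
    D <ₛ E ×
    ¬ (∃ λ (Z : Subset) → D <ₛ Z × Z <ₛ E)
theorem2p2 em = D , E , (proj₂ D-limit , proj₂ E-limit) , (proj₁ D-limit , proj₁ E-limit) , (D≤E , E≰D) , minimal-cover
  where open Classical em
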